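{- If a binary decision problem can be solved in pseudo-polynomial time, then it belongs to $\mathsf{Smoothed\text{ - }P}$ (with respect to any parameterized family of distributions of the form described in the context).
   Context: Binary decision problem: an instance of size $n$ is a triple $(S,w,t)$, where $S\subseteq\{0,1\}^n$ (the structure of the problem; the problem determines which sets $S$ occur) is encoded by a string of length polynomial in $n$, $w=(w_1,\dots,w_n)$ is a vector of $n$-bit coefficients $w_i\in\{0,1,\dots,2^n-1\}$, and $t$ is a threshold. The question is whether there exists $x\in S$ with $w^Tx\le t$. Pseudo-polynomial time means solvable by a deterministic algorithm whose running time is polynomial in $n$ and the magnitude of the coefficients, i.e. $O((n2^b)^c)$ for some constant $c$ when the coefficients have $b$ bits each. Parameterized families of distributions. In general, a parameterized family of distributions $\mathcal{D}=(D_{n,x,\phi})_{n,x,\phi}$ consists, for every $n$, every instance $x$ of length $n$ (a problem-dependent size measure) and every admissible $\phi$, of a probability distribution $D_{n,x,\phi}$ with support contained in $\{0,1\}^{\le\mathrm{poly}(n)}$. Let $S_{n,x}=\{y\mid D_{n,x,\phi}(y)>0\text{ for some }\phi\}$ and $N_{n,x}=|S_{n,x}|$. The parameter satisfies $\phi\in[1/N_{n,x},1]$, its values are discretized so that they are described by at most $\mathrm{poly}(n)$ bits, and $D_{n,x,\phi}(y)\le\phi$ for all $n,x,\phi,y$. Perturbation model for binary decision problems: $\mathcal{D}$ is any parameterized family with the following properties. $S$ and $t$ are part of the input and not subject to randomness; the coefficients $w_1,\dots,w_n$ are drawn according to independent distributions on $\{0,\dots,2^n-1\}$; for each $i$, the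 probability that $w_i$ assumes any specific value is at most $\phi^{1/n}$; and $N_{n,(S,w,t)}=2^{n^2}$ for every instance of size $n$, so $\phi$ ranges in $[2^{ -n^2},1]$. $\mathsf{Smoothed\text{ - }P}$ is the class of all pairs $(L,\mathcal{D})$ ($L\subseteq\{0,1\}^*$, $\mathcal{D}$ a parameterized family of distributions) for which there is a deterministic algorithm $A$ deciding $L$ with smoothed polynomial running time: there exists $\varepsilon>0$ such that for all $n,x,\phi$, $\mathbb{E}_{y\sim D_{n,x,\phi}}\bigl(t_A(y;n,\phi)^{\varepsilon}\bigr)=O(n\cdot N_{n,x}\cdot\phi)$, where $t_A(y;n,\phi)$ is the running time of $A$ on input $y$ with parameters $n,\phi$. -}

module Defs where

open import Level using (0ℓ)
open import Algebra.Bundles using (CommutativeRing; Semiring)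
import Algebra.Definitions.RawSemiring as RawSemiringDefs
open import Data.Bool.Base using (Bool; true; false; if_then_else_)
open import Data.Fin.Base using (Fin; zero; suc; toℕ)
open import Data.List.Base as List using (List; []; _∷_; _++_; length)
open import Data.List.Membership.Propositional using (_∈_)
open import Data.List.Relation.Unary.Unique.Propositional using (Unique)
open import Data.Maybe.Base using (just)
open import Data.Nat.Base as ℕ using (ℕ; zero; suc; NonZero)
open import Data.Product.Base using (Σ; ∃; ∃-syntax; _×_; _,_)
open import Data.Vec.Base as Vec using (Vec; []; _∷_; lookup; _[_]≔_)
open import Data.Vec.Relation.Unary.All using (All)
open import Function.Bundles using (_⇔_)
open import Relation.Binary.PropositionalEquality using (_≡_)
open import Relation.Binary.Structures using (IsDecTotalOrder)
open import Relation.Nullary using (¬_)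
open import Relation.Unary using (Pred)

String : Set
String = List Bool

poly : ℕ → ℕ → ℕ
poly k n = n ℕ.^ k ℕ.+ k

-- Deterministic algorithms: structured programs over k stacks of bits, that
-- is, multitape Turing machines (a tape is a pair of stacks, and the finite
-- control can be kept in a stack of bounded height); the translation costs a
-- constant factor in each direction.

Store : ℕ → Set
Store k = Vec String k

infixr 5 _⨾_

data Prog (k : ℕ) : Set where
  skip  : Prog k
  push  : Fin k → Bool → Prog k
  pop   : Fin k → Prog k
  _⨾_   : Prog k → Prog k → Prog k
  -- branch on the top of a stack: empty, false, true
  case  : Fin k → Prog k → Prog k → Prog k → Prog k
  -- repeat as long as the stack is nonempty
  while : Fin k → Prog k → Prog k

-- P ⊢ σ ⇓ τ ∣ t : started in σ, the program P halts in τ after t ≥ 1 steps.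

infix 4 _⊢_⇓_∣_

data _⊢_⇓_∣_ {k : ℕ} : Prog k → Store k → Store k → ℕ → Set where
  ⇓skip  : ∀ {σ} → skip ⊢ σ ⇓ σ ∣ 1
  ⇓push  : ∀ {σ i b} → push i b ⊢ σ ⇓ σ [ i ]≔ (b ∷ lookup σ i) ∣ 1
  ⇓pop   : ∀ {σ i} → pop i ⊢ σ ⇓ σ [ i ]≔ List.drop 1 (lookup σ i) ∣ 1
  ⇓seq   : ∀ {P Q σ τ υ s t} →
           P ⊢ σ ⇓ τ ∣ s → Q ⊢ τ ⇓ υ ∣ t → P ⨾ Q ⊢ σ ⇓ υ ∣ s ℕ.+ t
  ⇓empty : ∀ {i P Q R σ τ t} →
           lookup σ i ≡ [] → P ⊢ σ ⇓ τ ∣ t → case i P Q R ⊢ σ ⇓ τ ∣ suc t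
  ⇓false : ∀ {i P Q R σ τ t bs} →
           lookup σ i ≡ false ∷ bs → Q ⊢ σ ⇓ τ ∣ t →
           case i P Q R ⊢ σ ⇓ τ ∣ suc t
  ⇓true  : ∀ {i P Q R σ τ t bs} →
           lookup σ i ≡ true ∷ bs → R ⊢ σ ⇓ τ ∣ t →
           case i P Q R ⊢ σ ⇓ τ ∣ suc t
  ⇓done  : ∀ {i P σ} → lookup σ i ≡ [] → while i P ⊢ σ ⇓ σ ∣ 1
  ⇓loop  : ∀ {i P σ τ υ s t b bs} →
           lookup σ i ≡ b ∷ bs → P ⊢ σ ⇓ τ ∣ s → while i P ⊢ τ ⇓ υ ∣ t →
           while i P ⊢ σ ⇓ υ ∣ suc (s ℕ.+ t)

-- The answer is read off the top of stack 0.

Accepting : ∀ {k} → Store (suc k) → Set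
Accepting σ = List.head (Vec.head σ) ≡ just true

record Decides {A : Set} {k : ℕ} (P : Prog (suc k)) (load : A → Store (suc k))
               (L : Pred A 0ℓ) (time : A → ℕ) : Set where
  field
    final   : A → Store (suc k)
    halts   : ∀ a → P ⊢ load a ⇓ final a ∣ time a
    correct : ∀ a → Accepting (final a) ⇔ L a

-- The real numbers enter only as an ordered field whose nonnegative elements
-- have roots.  The real numbers are one such field; completeness is never
-- assumed, so whatever is shown for all such fields holds in particular for ℝ.

record OrderedFieldWithRoots : Set₁ where
  infix 4 _≤_
  field
    commutativeRing : CommutativeRing 0ℓ 0ℓ
  open CommutativeRing commutativeRing public
    using (Carrier; _≈_; _+_; _*_; 0#; 1#)
  open RawSemiringDefs (Semiring.rawSemiring (CommutativeRing.semiring commutativeRing)) public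
    using (_^_; sum; product)
    renaming (_×_ to _·_)
  field
    _≤_             : Carrier → Carrier → Set
    isDecTotalOrder : IsDecTotalOrder _≈_ _≤_
    +-monoˡ-≤       : ∀ {x y} z → x ≤ y → x + z ≤ y + z
    *-nonNegative   : ∀ {x y} → 0# ≤ x → 0# ≤ y → 0# ≤ x * y
    0≉1             : ¬ 0# ≈ 1#
    inverse         : ∀ x → ¬ x ≈ 0# → ∃[ y ] x * y ≈ 1#
    root            : (k : ℕ) .{{_ : NonZero k}} → Carrier → Carrier
    root-nonNegative : ∀ k .{{_ : NonZero k}} {x} → 0# ≤ x → 0# ≤ root k x
    root-power      : ∀ k .{{_ : NonZero k}} {x} → 0# ≤ x → root k x ^ k ≈ x

  infix 4 _<_
  _<_ : Carrier → Carrier → Set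
  x < y = x ≤ y × ¬ x ≈ y

  fromℕ : ℕ → Carrier
  fromℕ m = m · 1#

  sumOver : {A : Set} → List A → (A → Carrier) → Carrier
  sumOver as f = List.foldr (λ a acc → f a + acc) 0# as

  -- r = t ^ ε for an integer t ≥ 1 and an arbitrary exponent ε > 0, by
  -- comparison with the rational powers t ^ (p / q).
  IsPower : ℕ → Carrier → Carrier → Set
  IsPower t ε r = 0# ≤ r × (∀ p q .{{_ : NonZero q}} →
    (fromℕ p ≤ fromℕ q * ε → fromℕ t ^ p ≤ r ^ q) ×
    (fromℕ q * ε ≤ fromℕ p → r ^ q ≤ fromℕ t ^ p))

-- Parameterized families of distributions.  IsInstance n x says that x is an
-- instance of length n.  The discretized parameters φ are given by bit
-- strings d, which stand for the numbers φ = value n d.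

record ParamFamily (ℝ : OrderedFieldWithRoots)
                   (IsInstance : ℕ → Pred String 0ℓ) : Set₁ where
  open OrderedFieldWithRoots ℝ
  field
    value      : ℕ → String → Carrier
    Admissible : ℕ → String → Pred String 0ℓ
    mass       : (n : ℕ) (x d y : String) → Carrier
    -- an enumeration of S_{n,x}
    support    : ℕ → String → List String
    degree     : ℕ

  N : ℕ → String → ℕ
  N n x = length (support n x)

  field
    support-unique : ∀ {n x} → IsInstance n x → Unique (support n x)
    ∈-support      : ∀ {n x} → IsInstance n x → ∀ y →
      y ∈ support n x ⇔ (∃[ d ] Admissible n x d × 0# < mass n x d y)
    support-length : ∀ {n x} → IsInstance n x →
      ∀ {y} → y ∈ support n x → length y ℕ.≤ poly degree n
    value-length   : ∀ {n x d} → IsInstance n x → Admissible n x d →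
      length d ℕ.≤ poly degree n
    value-injective : ∀ {n x d d′} → IsInstance n x →
      Admissible n x d → Admissible n x d′ → value n d ≈ value n d′ → d ≡ d′
    -- φ ≥ 1 / N, with the denominator cleared
    value-lower    : ∀ {n x d} → IsInstance n x → Admissible n x d →
      1# ≤ fromℕ (N n x) * value n d
    value-upper    : ∀ {n x d} → IsInstance n x → Admissible n x d →
      value n d ≤ 1#
    mass-nonNegative : ∀ {n x d} → IsInstance n x → Admissible n x d →
      ∀ y → 0# ≤ mass n x d y
    mass-total     : ∀ {n x d} → IsInstance n x → Admissible n x d →
      sumOver (support n x) (mass n x d) ≈ 1#
    mass-upper     : ∀ {n x d} → IsInstance n x → Admissible n x d →
      ∀ y → mass n x d y ≤ value n d

  expectation : ℕ → String → String → (String → Carrier) → Carrier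
  expectation n x d f = sumOver (support n x) λ y → mass n x d y * f y

-- An algorithm gets the input y together with n (in unary) and φ.

loadParam : ∀ {k} → String × ℕ × String → Store (3 ℕ.+ k)
loadParam (y , n , d) =
  y ∷ List.replicate n true ∷ d ∷ Vec.replicate _ []

module _ (ℝ : OrderedFieldWithRoots) {IsInstance : ℕ → Pred String 0ℓ} where
  open OrderedFieldWithRoots ℝ

  SmoothedPolynomial : ParamFamily ℝ IsInstance → (String × ℕ × String → ℕ) → Set
  SmoothedPolynomial 𝓓 time =
    ∃[ ε ] 0# < ε × (∃[ C ] ∀ n x d → IsInstance n x → Admissible n x d →
      Σ (String → Carrier) λ timeᵋ →
        (∀ y → IsPower (time (y , n , d)) ε (timeᵋ y)) ×
        expectation n x d timeᵋ ≤ fromℕ C * (fromℕ n * fromℕ (N n x) * value n d))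
    where open ParamFamily 𝓓

  Smoothed-P : Pred String 0ℓ → ParamFamily ℝ IsInstance → Set
  Smoothed-P L 𝓓 =
    ∃[ k ] Σ (Prog (3 ℕ.+ k)) λ A → Σ (String × ℕ × String → ℕ) λ time →
      Decides A loadParam (λ (y , _) → L y) time × SmoothedPolynomial 𝓓 time

-- A binary decision problem: IsStructure n s says that s encodes one of the
-- sets S ⊆ {0,1}ⁿ occurring in the problem, and Feasible n s is that set.
-- Thresholds have polynomially many bits, like every other part of an
-- instance.

record BinaryProblem : Set₁ where
  field
    IsStructure      : ℕ → Pred String 0ℓ
    Feasible         : (n : ℕ) → String → Pred (Vec Bool n) 0ℓ
    structureDegree  : ℕ
    structure-length : ∀ {n s} → IsStructure n s →
                       length s ℕ.≤ poly structureDegree n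
    thresholdDegree  : ℕ

  Coefficients : ℕ → Set
  Coefficients n = Vec (Fin (2 ℕ.^ n)) n

  Threshold : ℕ → Set
  Threshold n = Fin (2 ℕ.^ poly thresholdDegree n)

-- The k lowest bits of m, least significant first.

bits : ℕ → ℕ → String
bits zero    m = []
bits (suc k) m = (m ℕ.% 2 ℕ.≡ᵇ 1) ∷ bits k (m ℕ./ 2)

-- Self-delimiting encoding of strings.

delimit : String → String
delimit []       = false ∷ []
delimit (b ∷ bs) = true ∷ b ∷ delimit bs

weight : ∀ {n} → Vec (Fin (2 ℕ.^ n)) n → Vec Bool n → ℕ
weight w x = Vec.sum (Vec.zipWith (λ wᵢ xᵢ → if xᵢ then toℕ wᵢ else 0) w x)

module _ (Π : BinaryProblem) where
  open BinaryProblem Π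

  encode : (n : ℕ) → String → Coefficients n → Threshold n → String
  encode n s w t =
    List.replicate n true ++ false ∷ delimit s
      ++ delimit (bits (poly thresholdDegree n) (toℕ t))
      ++ List.concat (List.map (λ wᵢ → bits n (toℕ wᵢ)) (Vec.toList w))

  IsInstance : ℕ → Pred String 0ℓ
  IsInstance n y =
    NonZero n × (∃[ s ] ∃[ w ] ∃[ t ] IsStructure n s × y ≡ encode n s w t)

  Language : Pred String 0ℓ
  Language y = ∃[ n ] NonZero n × (∃[ s ] ∃[ w ] ∃[ t ]
    IsStructure n s × y ≡ encode n s w t ×
    (∃[ x ] Feasible n s x × weight w x ℕ.≤ toℕ t))

  PseudoPolynomial : Set
  PseudoPolynomial =
    ∃[ k ] Σ (Prog (suc k)) λ A → Σ (String → ℕ) λ time →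
      Decides A (λ y → y ∷ Vec.replicate k []) Language time ×
      (∃[ c ] ∃[ C ] ∀ n → NonZero n → ∀ s w t → IsStructure n s →
        ∀ b → All (λ wᵢ → toℕ wᵢ ℕ.< 2 ℕ.^ b) w →
        time (encode n s w t) ℕ.≤ C ℕ.* (n ℕ.* 2 ℕ.^ b) ℕ.^ c)

module _ (ℝ : OrderedFieldWithRoots) (Π : BinaryProblem) where
  open OrderedFieldWithRoots ℝ
  open BinaryProblem Π

  -- The distribution `mass` of the perturbed instances arises by keeping s and
  -- t and drawing the i-th coefficient from p i, independently of the others.

  record DrawsCoefficients (n : ℕ) .{{_ : NonZero n}} (s : String)
                           (t : Threshold n) (φ : Carrier)
                           (mass : String → Carrier) : Set where
    field
      p             : Fin n → Fin (2 ℕ.^ n) → Carrier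
      p-nonNegative : ∀ i v → 0# ≤ p i v
      p-total       : ∀ i → sum (p i) ≈ 1#
      p-upper       : ∀ i v → p i v ≤ root n φ
      independent   : ∀ w → mass (encode Π n s w t)
                            ≈ product (λ i → p i (lookup w i))
      concentrated  : ∀ y → 0# < mass y → ∃[ w ] y ≡ encode Π n s w t

  record IsPerturbation (𝓓 : ParamFamily ℝ (IsInstance Π)) : Set where
    open ParamFamily 𝓓
    field
      draws  : ∀ n .{{_ : NonZero n}} s w t → IsStructure n s →
               ∀ d → Admissible n (encode Π n s w t) d →
               DrawsCoefficients n s t (value n d) (mass n (encode Π n s w t) d)
      N-size : ∀ {n x} → IsInstance Π n x → N n x ≡ 2 ℕ.^ (n ℕ.* n)

{-# OPTIONS --safe #-}

-- Run the pseudo-polynomial algorithm on rounded instances.  For m = n, …, 1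
-- ask whether the coefficients ⌊wᵢ/2ᵐ⌋ + 1 (if so, accept) and ⌊wᵢ/2ᵐ⌋ (if
-- not, reject) meet the threshold ⌊t/2ᵐ⌋; if both questions fail to decide,
-- decrease m, and for m = 0 use the original instance.  If m is undecided,
-- some solution x meets the threshold when rounded down but no solution does
-- when rounded up.  For an item i of x, given the other coefficients, this
-- confines ⌊wᵢ/2ᵐ⌋ to a window of 2n values, so by the union bound it has
-- probability at most 2n² 2ᵐ ψ, where ψ = φ^(1/n).  If the algorithm stops
-- after inspecting L leading bits, its time T is at most (A n 2ᴸ)ᵃ.  Thus
-- Z = T^(1/4a) has Z⁴ ≤ A n 2ᴸ, and n² Z ≤ n³ + A 2ᴸ follows by distinguishing Z ≤ n and Z ≥ n.
-- Now 𝔼 2ᴸ ≤ 1 + 4n³ r for r = 2ⁿ ψ, and 1 ≤ r ≤ rⁿ = N φ.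

module Submission where

open import Defs
open import Algebra.Bundles using (CommutativeRing)
open import Data.Bool.Base using (Bool; true; false; not; if_then_else_; _∧_)
import Data.Bool.Properties as Bool
open import Data.Empty using (⊥-elim)
open import Data.Fin.Base as Fin using (Fin; zero; suc; _↑ʳ_; _↑ˡ_; toℕ; fromℕ<)
open import Data.Fin.Patterns
import Data.Fin.Properties as Fin
open import Data.List.Base as List using (List; []; _∷_; _++_; length; _ʳ++_; reverse; replicate; take; drop)
import Data.List.Properties as List
open import Data.List.Membership.Propositional using (_∈_; lose)
import Data.List.Membership.Propositional.Properties as ∈
import Data.List.Relation.Unary.All as ListAll
open import Data.List.Relation.Unary.AllPairs using ([]; _∷_)
open import Data.List.Relation.Unary.Any using (here; there)
open import Data.List.Relation.Unary.Unique.Propositional using (Unique)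
open import Data.Maybe.Base using (Maybe; just; nothing; fromMaybe)
import Data.Maybe.Properties as Maybe
open import Data.Nat.Base as ℕ using (ℕ; zero; suc; NonZero; z≤n; s≤s)
import Data.Nat.Properties as ℕ
open import Data.Product.Base using (Σ; ∃-syntax; _×_; _,_; proj₁; proj₂)
open import Data.Sum.Base using (_⊎_; inj₁; inj₂)
open import Data.Vec.Base as Vec using (Vec; []; _∷_; lookup; _[_]≔_)
import Data.Vec.Properties as Vec
open import Data.Vec.Relation.Unary.All as All using (All)
import Data.Vec.Relation.Unary.All.Properties as All
open import Function.Base using (_∘_; id)
open import Function.Bundles using (_⇔_; mk⇔; Equivalence)
open import Function.Construct.Composition using (_⇔-∘_)
open import Function.Construct.Symmetry using (⇔-sym)
open import Function.Definitions using (Injective)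
open import Relation.Binary.Bundles using (Poset)
open import Relation.Binary.PropositionalEquality as ≡
  using (_≡_; refl; sym; trans; cong; cong₂; subst; subst₂; module ≡-Reasoning)
open import Relation.Binary.Structures using (IsDecTotalOrder)
open import Relation.Nullary using (¬_; Dec; yes; no; contradiction)
open import Relation.Nullary.Decidable using (True; toWitness; _→-dec_; ⌊_⌋)

-- Both questions compare with the same floor of `t/2ᵐ`. If a rounded-up weight is at most this
-- floor, multiplying by `2ᵐ` bounds the true weight by `t`; conversely a solution within `t` stays
-- within the floor when rounded down, because its rounded weight is an integer. So every answer is
-- right without any assumption on the distribution, and only the time is random. The window
-- argument resembles the isolation lemma. The solution in question may change with the coefficient
-- being varied, but failure of the rounded-up question concerns all solutions at once, so the
-- solution found for one value constrains every other value. The fourth root answers to the factor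
-- `n` in the class: the expected value of `2ᴸ` carries `n³`, so `n²` has to be gained before taking
-- expectations. For `Z ≥ n` it comes from `n³ Z ≤ Z⁴`, where one further factor `n` cancels the `n`
-- in front of `2ᴸ`. The solver must also be right on ill-formed strings, where nothing is known
-- about the time of the given algorithm.

module Algorithms where

  open import Data.Nat.Base
  open import Data.Nat.DivMod
  open import Data.Nat.Divisibility using (divides)
  open import Data.Nat.Induction using (<-wellFounded; Acc; acc)
  open import Data.Nat.Properties

  -- Renaming stacks and bounding running times

  rename : ∀ {j k} → (Fin j → Fin k) → Prog j → Prog k
  rename ρ skip           = skip
  rename ρ (push i b)     = push (ρ i) b
  rename ρ (pop i)        = pop (ρ i)
  rename ρ (P ⨾ Q)        = rename ρ P ⨾ rename ρ Q
  rename ρ (case i P Q R) = case (ρ i) (rename ρ P) (rename ρ Q) (rename ρ R)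
  rename ρ (while i P)    = while (ρ i) (rename ρ P)

  module _ {j k : ℕ} (ρ : Fin j → Fin k) where

    Embeds : Store j → Store k → Set
    Embeds σ Σ = ∀ i → lookup Σ (ρ i) ≡ lookup σ i

    AgreeOutside : Store k → Store k → Set
    AgreeOutside Σ Σ′ = ∀ l → (∀ i → ¬ ρ i ≡ l) → lookup Σ′ l ≡ lookup Σ l

    update-embeds : Injective _≡_ _≡_ ρ → ∀ {σ Σ} i {x y} → x ≡ y → Embeds σ Σ →
      Embeds (σ [ i ]≔ x) (Σ [ ρ i ]≔ y)
    update-embeds inj {σ} {Σ} i refl e i′ with i′ Fin.≟ i
    ... | yes refl = trans (Vec.lookup∘updateAt (ρ i) Σ) (sym (Vec.lookup∘updateAt i σ))
    ... | no i′≢i  = trans (Vec.lookup∘updateAt′ (ρ i′) (ρ i) (i′≢i ∘ inj) Σ)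
                       (trans (e i′) (sym (Vec.lookup∘updateAt′ i′ i i′≢i σ)))

    update-outside : ∀ {Σ} i {x} → AgreeOutside Σ (Σ [ ρ i ]≔ x)
    update-outside {Σ} i l l∉ = Vec.lookup∘updateAt′ l (ρ i) (λ eq → l∉ i (sym eq)) Σ

    -- Injectivity keeps distinct stacks distinct, so the renamed program makes the same steps.
    -- `AgreeOutside` is the frame condition: together with `Embeds` it determines every stack of
    -- the final store.
    rename-⇓ : Injective _≡_ _≡_ ρ → ∀ {P σ τ t} → P ⊢ σ ⇓ τ ∣ t → ∀ {Σ} → Embeds σ Σ →
      ∃[ Σ′ ] rename ρ P ⊢ Σ ⇓ Σ′ ∣ t × Embeds τ Σ′ × AgreeOutside Σ Σ′
    rename-⇓ inj ⇓skip e = _ , ⇓skip , e , λ _ _ → refl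
    rename-⇓ inj (⇓push {σ} {i} {b}) {Σ} e =
      _ , ⇓push , update-embeds inj {σ} {Σ} i (cong (b ∷_) (sym (e i))) e , update-outside {Σ} i
    rename-⇓ inj (⇓pop {σ} {i}) {Σ} e =
      _ , ⇓pop , update-embeds inj {σ} {Σ} i (cong (drop 1) (sym (e i))) e , update-outside {Σ} i
    rename-⇓ inj (⇓seq p q) e =
      let _ , p′ , e′ , o′ = rename-⇓ inj p e
          _ , q′ , e″ , o″ = rename-⇓ inj q e′
      in _ , ⇓seq p′ q′ , e″ , λ l l∉ → trans (o″ l l∉) (o′ l l∉)
    rename-⇓ inj (⇓empty eq p) e =
      let _ , p′ , r = rename-⇓ inj p e in _ , ⇓empty (trans (e _) eq) p′ , r
    rename-⇓ inj (⇓false eq p) e =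
      let _ , p′ , r = rename-⇓ inj p e in _ , ⇓false (trans (e _) eq) p′ , r
    rename-⇓ inj (⇓true eq p) e =
      let _ , p′ , r = rename-⇓ inj p e in _ , ⇓true (trans (e _) eq) p′ , r
    rename-⇓ inj (⇓done eq) e = _ , ⇓done (trans (e _) eq) , e , λ _ _ → refl
    rename-⇓ inj (⇓loop eq p q) e =
      let _ , p′ , e′ , o′ = rename-⇓ inj p e
          _ , q′ , e″ , o″ = rename-⇓ inj q e′
      in _ , ⇓loop (trans (e _) eq) p′ q′ , e″ , λ l l∉ → trans (o″ l l∉) (o′ l l∉)

  lookup-extensional : ∀ {k} {σ τ : Store k} → (∀ i → lookup σ i ≡ lookup τ i) → σ ≡ τ
  lookup-extensional {σ = []}    {[]}    eq = refl
  lookup-extensional {σ = _ ∷ _} {_ ∷ _} eq =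
    cong₂ _∷_ (eq zero) (lookup-extensional (eq ∘ suc))

  gather : ∀ {j k} → Vec (Fin k) j → Store k → Store j
  gather ρ Σ = Vec.map (lookup Σ) ρ

  -- The selected stacks form a vector rather than a function, so that on an explicit store
  -- `scatter` evaluates and the final store of a subroutine is found by computation.
  scatter : ∀ {j k} → Vec (Fin k) j → Store j → Store k → Store k
  scatter []      []      Σ = Σ
  scatter (i ∷ ρ) (x ∷ σ) Σ = scatter ρ σ Σ [ i ]≔ x

  scatter-outside : ∀ {j k} (ρ : Vec (Fin k) j) σ Σ → AgreeOutside (lookup ρ) Σ (scatter ρ σ Σ)
  scatter-outside []      []      Σ l l∉ = refl
  scatter-outside (i ∷ ρ) (x ∷ σ) Σ l l∉ =
    trans (Vec.lookup∘updateAt′ l i (λ eq → l∉ zero (sym eq)) (scatter ρ σ Σ))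
          (scatter-outside ρ σ Σ l (l∉ ∘ suc))

  scatter-embeds : ∀ {j k} (ρ : Vec (Fin k) j) → Injective _≡_ _≡_ (lookup ρ) →
    ∀ σ Σ → Embeds (lookup ρ) σ (scatter ρ σ Σ)
  scatter-embeds (i ∷ ρ) inj (x ∷ σ) Σ zero    = Vec.lookup∘updateAt i (scatter ρ σ Σ)
  scatter-embeds (i ∷ ρ) inj (x ∷ σ) Σ (suc l) =
    trans (Vec.lookup∘updateAt′ (lookup ρ l) i (λ eq → Fin.0≢1+n (sym (inj eq))) (scatter ρ σ Σ))
          (scatter-embeds ρ (λ eq → Fin.suc-injective (inj eq)) σ Σ l)

  record Run {k : ℕ} (P : Prog k) (σ τ : Store k) (T : ℕ) : Set where
    constructor run
    field
      {steps} : ℕ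
      halts   : P ⊢ σ ⇓ τ ∣ steps
      bounded : steps ≤ T

  -- The bound κ * ℓ is kept as a pair so that the constants κ can be inferred.
  record Lin {k : ℕ} (P : Prog k) (σ τ : Store k) (κ ℓ : ℕ) : Set where
    constructor lin
    field
      toRun : Run P σ τ (κ * ℓ)

  open Lin public

  infixr 5 _then_ _▷_

  _then_ : ∀ {k} {P Q : Prog k} {σ τ υ S T} → Run P σ τ S → Run Q τ υ T → Run (P ⨾ Q) σ υ (S + T)
  run p s≤ then run q t≤ = run (⇓seq p q) (+-mono-≤ s≤ t≤)

  weaken : ∀ {k} {P : Prog k} {σ τ S T} → S ≤ T → Run P σ τ S → Run P σ τ T
  weaken S≤T (run p s≤) = run p (≤-trans s≤ S≤T)

  loop-run : ∀ {k} {P : Prog k} {σ τ υ S T i b bs} → lookup σ i ≡ b ∷ bs →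
    Run P σ τ S → Run (while i P) τ υ T → Run (while i P) σ υ (suc (S + T))
  loop-run eq (run p s≤) (run q t≤) = run (⇓loop eq p q) (s≤s (+-mono-≤ s≤ t≤))

  case-empty : ∀ {k} {P Q R : Prog k} {σ τ T i} → lookup σ i ≡ [] → Run P σ τ T → Run (case i P Q R) σ τ (suc T)
  case-empty eq (run p p≤) = run (⇓empty eq p) (s≤s p≤)

  case-true : ∀ {k} {P Q R : Prog k} {σ τ T i bs} → lookup σ i ≡ true ∷ bs → Run R σ τ T → Run (case i P Q R) σ τ (suc T)
  case-true eq (run p p≤) = run (⇓true eq p) (s≤s p≤)

  retarget : ∀ {k} {P : Prog k} {σ τ τ′ T} → τ ≡ τ′ → Run P σ τ T → Run P σ τ′ T
  retarget refl p = p

  _▷_ : ∀ {k} {P Q : Prog k} {σ τ υ κ κ′ ℓ} → Lin P σ τ κ ℓ → Lin Q τ υ κ′ ℓ → Lin (P ⨾ Q) σ υ (κ + κ′) ℓ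
  _▷_ {κ = κ} {κ′} {ℓ} (lin p) (lin q) = lin (weaken (≤-reflexive (sym (*-distribʳ-+ ℓ κ κ′))) (p then q))

  infixr 5 _⟨_⟩_

  -- Spelling out the intermediate stores keeps them in normal form.
  _⟨_⟩_ : ∀ {k} (σ : Store k) {P Q : Prog k} {τ υ κ κ′ ℓ} → Lin P σ τ κ ℓ → Lin Q τ υ κ′ ℓ → Lin (P ⨾ Q) σ υ (κ + κ′) ℓ
  σ ⟨ p ⟩ q = p ▷ q

  scale : ∀ {k} {P : Prog k} {σ τ κ ℓ ℓ′} → ℓ ≤ ℓ′ → Lin P σ τ κ ℓ → Lin P σ τ κ ℓ′
  scale {κ = κ} ℓ≤ (lin p) = lin (weaken (*-monoʳ-≤ κ ℓ≤) p)

  constant : ∀ {k} {P : Prog k} {σ τ T ℓ} → 0 < ℓ → Run P σ τ T → Lin P σ τ T ℓ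
  constant {T = T} {suc ℓ} _ p = lin (weaken (m≤m*n T (suc ℓ)) p)

  -- The strict inequality gives `ℓ ≥ 1`, which pays for the additive 1. Every cost thus becomes a
  -- plain multiple of `ℓ`, and the constants just add up under `_▷_`.
  affine : ∀ {k} {P : Prog k} {σ τ ℓ} {x} c → x < ℓ → Run P σ τ (1 + x * c) → Lin P σ τ (suc c) ℓ
  affine {ℓ = ℓ} {x} c x<ℓ p = lin (weaken bound p)
    where
    open ≤-Reasoning
    bound : 1 + x * c ≤ suc c * ℓ
    bound = begin
      1 + x * c ≤⟨ +-mono-≤ (≤-trans (s≤s z≤n) x<ℓ) (≤-trans (*-monoˡ-≤ c (<⇒≤ x<ℓ)) (≤-reflexive (*-comm ℓ c))) ⟩
      ℓ + c * ℓ ∎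

  target : ∀ {k} {P : Prog k} {σ τ τ′ κ ℓ} → τ ≡ τ′ → Lin P σ τ κ ℓ → Lin P σ τ′ κ ℓ
  target refl p = p

  -- Decidable, so that for a literal list of stacks the implicit argument `inj` below is settled by
  -- evaluation.
  injective? : ∀ {j k} (ρ : Vec (Fin k) j) → Dec (∀ a b → lookup ρ a ≡ lookup ρ b → a ≡ b)
  injective? ρ = Fin.all? λ a → Fin.all? λ b → (lookup ρ a Fin.≟ lookup ρ b) →-dec (a Fin.≟ b)

  on : ∀ {j k} → Vec (Fin k) j → Prog j → Prog k
  on ρ = rename (lookup ρ)

  module _ {j k : ℕ} (ρ : Vec (Fin k) j) {inj : True (injective? ρ)} where

    on-⇓ : ∀ {P τ t Σ} → P ⊢ gather ρ Σ ⇓ τ ∣ t → on ρ P ⊢ Σ ⇓ scatter ρ τ Σ ∣ t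
    on-⇓ {P} {τ} {t} {Σ} p
      with Σ′ , p′ , e , o ← rename-⇓ (lookup ρ) (toWitness inj _ _) p {Σ} (λ i → sym (Vec.lookup-map i (lookup Σ) ρ))
      = subst (λ Σ′ → on ρ P ⊢ Σ ⇓ Σ′ ∣ t) (lookup-extensional same) p′
      where
      same : ∀ l → lookup Σ′ l ≡ lookup (scatter ρ τ Σ) l
      same l with Fin.any? (λ i → lookup ρ i Fin.≟ l)
      ... | yes (i , refl) = trans (e i) (sym (scatter-embeds ρ (toWitness inj _ _) τ Σ i))
      ... | no l∉ = trans (o l (λ i eq → l∉ (i , eq))) (sym (scatter-outside ρ τ Σ l (λ i eq → l∉ (i , eq))))

    on-run : ∀ {P τ T Σ} → Run P (gather ρ Σ) τ T → Run (on ρ P) Σ (scatter ρ τ Σ) T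
    on-run (run p t≤) = run (on-⇓ p) t≤

    on-lin : ∀ {P τ κ ℓ Σ} → Lin P (gather ρ Σ) τ κ ℓ → Lin (on ρ P) Σ (scatter ρ τ Σ) κ ℓ
    on-lin (lin p) = lin (on-run p)

    on-lin′ : ∀ Σ {P τ κ ℓ} → Lin P (gather ρ Σ) τ κ ℓ → Lin (on ρ P) Σ (scatter ρ τ Σ) κ ℓ
    on-lin′ Σ = on-lin

  data SplitFin (c k : ℕ) : Fin (c + k) → Set where
    left  : ∀ i → SplitFin c k (i ↑ˡ k)
    right : ∀ i → SplitFin c k (c ↑ʳ i)

  splitFin : ∀ c {k} l → SplitFin c k l
  splitFin zero    l       = right l
  splitFin (suc c) zero    = left zero
  splitFin (suc c) (suc l) with splitFin c l
  ... | left i  = left (suc i)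
  ... | right i = right i

  -- The given algorithm uses an unknown number of stacks, so it cannot be embedded through a
  -- literal list as with `on`; it is placed above all working stacks instead.
  raise-run : ∀ {c k} (ξ : Store c) {P : Prog k} {σ τ T} →
    Run P σ τ T → Run (rename (c ↑ʳ_) P) (ξ Vec.++ σ) (ξ Vec.++ τ) T
  raise-run {c} ξ {P} {σ} {τ} (run p t≤)
    with Σ′ , p′ , e , o ← rename-⇓ (c ↑ʳ_) (Fin.↑ʳ-injective c _ _) p {ξ Vec.++ σ} (Vec.lookup-++ʳ ξ σ)
    = run (subst (λ Σ′ → rename (c ↑ʳ_) P ⊢ ξ Vec.++ σ ⇓ Σ′ ∣ _) (lookup-extensional same) p′) t≤
    where
    apart : ∀ {c k} (j : Fin c) (i : Fin k) → ¬ c ↑ʳ i ≡ j ↑ˡ k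
    apart (suc j) i eq = apart j i (Fin.suc-injective eq)
    same : ∀ l → lookup Σ′ l ≡ lookup (ξ Vec.++ τ) l
    same l with splitFin c l
    ... | left i  = trans (o _ (apart i)) (trans (Vec.lookup-++ˡ ξ σ i) (sym (Vec.lookup-++ˡ ξ τ i)))
    ... | right i = trans (e i) (sym (Vec.lookup-++ʳ ξ τ i))

  -- For `root-isPower`, which compares powers of a base that is at least 1.
  steps-positive : ∀ {k} {P : Prog k} {σ τ t} → P ⊢ σ ⇓ τ ∣ t → 1 ≤ t
  steps-positive ⇓skip        = ≤-refl
  steps-positive ⇓push        = ≤-refl
  steps-positive ⇓pop         = ≤-refl
  steps-positive (⇓seq p q)   = ≤-trans (steps-positive p) (m≤m+n _ _)
  steps-positive (⇓empty _ _) = s≤s z≤n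
  steps-positive (⇓false _ _) = s≤s z≤n
  steps-positive (⇓true _ _)  = s≤s z≤n
  steps-positive (⇓done _)    = ≤-refl
  steps-positive (⇓loop _ _ _) = s≤s z≤n

  -- A step pushes at most one bit. This bounds the work of clearing the stacks that a query leaves
  -- behind.
  height-growth : ∀ {k} {P : Prog k} {σ τ t} → P ⊢ σ ⇓ τ ∣ t →
    ∀ i → length (lookup τ i) ≤ length (lookup σ i) + t
  height-growth ⇓skip i = m≤m+n _ _
  height-growth (⇓push {σ} {j} {b}) i with i Fin.≟ j
  ... | yes refl = ≤-reflexive (trans (cong length (Vec.lookup∘updateAt i σ)) (+-comm 1 (length (lookup σ i))))
  ... | no i≢j   = ≤-trans (≤-reflexive (cong length (Vec.lookup∘updateAt′ i j i≢j σ))) (m≤m+n _ _)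
  height-growth (⇓pop {σ} {j}) i with i Fin.≟ j
  ... | yes refl = ≤-trans (≤-reflexive (trans (cong length (Vec.lookup∘updateAt i σ)) (List.length-drop 1 (lookup σ i))))
                     (≤-trans (m∸n≤m (length (lookup σ i)) 1) (m≤m+n _ _))
  ... | no i≢j   = ≤-trans (≤-reflexive (cong length (Vec.lookup∘updateAt′ i j i≢j σ))) (m≤m+n _ _)
  height-growth {σ = σ} (⇓seq {s = s} {t} p q) i =
    ≤-trans (height-growth q i) (≤-trans (+-monoˡ-≤ t (height-growth p i))
      (≤-reflexive (+-assoc (length (lookup σ i)) s t)))
  height-growth (⇓empty _ p) i = ≤-trans (height-growth p i) (+-monoʳ-≤ _ (n≤1+n _))
  height-growth (⇓false _ p) i = ≤-trans (height-growth p i) (+-monoʳ-≤ _ (n≤1+n _))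
  height-growth (⇓true _ p)  i = ≤-trans (height-growth p i) (+-monoʳ-≤ _ (n≤1+n _))
  height-growth (⇓done _)    i = m≤m+n _ _
  height-growth {σ = σ} (⇓loop {s = s} {t} _ p q) i =
    ≤-trans (height-growth q i) (≤-trans (+-monoˡ-≤ t (height-growth p i))
      (≤-trans (≤-reflexive (+-assoc (length (lookup σ i)) s t)) (+-monoʳ-≤ (length (lookup σ i)) (n≤1+n _))))

  forEach : ∀ {k} → Fin k → (Bool → Prog k) → Prog k
  forEach i P = while i (case i skip (pop i ⨾ P false) (pop i ⨾ P true))

  each-[] : ∀ {k} (P : Bool → Prog (suc k)) {σ} → Run (forEach zero P) ([] ∷ σ) ([] ∷ σ) 1
  each-[] P = run (⇓done refl) ≤-refl

  -- The three extra steps are the loop test, the branch and the `pop`.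
  each-∷ : ∀ {k} (P : Bool → Prog (suc k)) {b xs σ τ υ S T} →
    Run (P b) (xs ∷ σ) τ S → Run (forEach zero P) τ υ T → Run (forEach zero P) ((b ∷ xs) ∷ σ) υ (3 + (S + T))
  each-∷ P {b = false} (run p s≤) (run q t≤) =
    run (⇓loop refl (⇓false refl (⇓seq ⇓pop p)) q) (s≤s (s≤s (s≤s (+-mono-≤ s≤ t≤))))
  each-∷ P {b = true} (run p s≤) (run q t≤) =
    run (⇓loop refl (⇓true refl (⇓seq ⇓pop p)) q) (s≤s (s≤s (s≤s (+-mono-≤ s≤ t≤))))

  -- Subroutines on few stacks

  shorter : ∀ (xs : String) {ys ℓ} → length xs + length ys < ℓ → length (xs ʳ++ ys) < ℓ
  shorter xs {ys} {ℓ} = subst (_< ℓ) (sym (List.length-ʳ++ xs {ys}))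

  shorter[] : ∀ (xs : String) {ℓ} → length xs < ℓ → length (xs ʳ++ []) < ℓ
  shorter[] xs {ℓ} xs< = shorter xs (subst (_< ℓ) (sym (+-identityʳ (length xs))) xs<)

  reverse-twice : ∀ (xs : String) {zs} → (xs ʳ++ []) ʳ++ zs ≡ xs ++ zs
  reverse-twice xs = List.ʳ++-ʳ++ xs

  reverse-twice[] : ∀ (xs : String) → (xs ʳ++ []) ʳ++ [] ≡ xs
  reverse-twice[] xs = trans (reverse-twice xs) (List.++-identityʳ xs)

  moveBit : Bool → Prog 2
  moveBit b = push 1F b

  move : Prog 2
  move = forEach 0F moveBit

  move-run : ∀ xs {ys} → Run move (xs ∷ ys ∷ []) ([] ∷ (xs ʳ++ ys) ∷ []) (1 + length xs * 4)
  move-run []       = each-[] moveBit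
  move-run (x ∷ xs) = each-∷ moveBit (run ⇓push ≤-refl) (move-run xs)

  move-lin : ∀ {ℓ xs ys} → length xs < ℓ → Lin move (xs ∷ ys ∷ []) ([] ∷ (xs ʳ++ ys) ∷ []) 5 ℓ
  move-lin {xs = xs} xs< = affine 4 xs< (move-run xs)

  moveTwiceBit : Bool → Prog 3
  moveTwiceBit b = push 1F b ⨾ push 2F b

  moveTwice : Prog 3
  moveTwice = forEach 0F moveTwiceBit

  moveTwice-run : ∀ xs {ys zs} →
    Run moveTwice (xs ∷ ys ∷ zs ∷ []) ([] ∷ (xs ʳ++ ys) ∷ (xs ʳ++ zs) ∷ []) (1 + length xs * 5)
  moveTwice-run []       = each-[] moveTwiceBit
  moveTwice-run (x ∷ xs) = each-∷ moveTwiceBit (run (⇓seq ⇓push ⇓push) ≤-refl) (moveTwice-run xs)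

  moveTwice-lin : ∀ {ℓ xs ys zs} → length xs < ℓ →
    Lin moveTwice (xs ∷ ys ∷ zs ∷ []) ([] ∷ (xs ʳ++ ys) ∷ (xs ʳ++ zs) ∷ []) 6 ℓ
  moveTwice-lin {xs = xs} xs< = affine 5 xs< (moveTwice-run xs)

  -- A single `move` reverses, hence the detour through a scratch stack; the way back restores the
  -- original and makes the copy at once.
  copy : Prog 3
  copy = on (0F ∷ 1F ∷ []) move ⨾ on (1F ∷ 0F ∷ 2F ∷ []) moveTwice

  copy-lin : ∀ {ℓ xs} → length xs < ℓ → Lin copy (xs ∷ [] ∷ [] ∷ []) (xs ∷ [] ∷ xs ∷ []) 11 ℓ
  copy-lin {xs = xs} xs< =
    target (cong₂ (λ a b → a ∷ [] ∷ b ∷ []) (reverse-twice[] xs) (reverse-twice[] xs))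
      (on-lin (0F ∷ 1F ∷ []) (move-lin xs<) ▷ on-lin (1F ∷ 0F ∷ 2F ∷ []) (moveTwice-lin (shorter[] xs xs<)))

  emit : Prog 3
  emit = on (0F ∷ 1F ∷ []) move ⨾ on (1F ∷ 2F ∷ []) move

  emit-lin : ∀ {ℓ xs out} → length xs < ℓ → Lin emit (xs ∷ [] ∷ out ∷ []) ([] ∷ [] ∷ (xs ++ out) ∷ []) 10 ℓ
  emit-lin {xs = xs} xs< =
    target (cong (λ a → [] ∷ [] ∷ a ∷ []) (reverse-twice xs))
      (on-lin (0F ∷ 1F ∷ []) (move-lin xs<) ▷ on-lin (1F ∷ 2F ∷ []) (move-lin (shorter[] xs xs<)))

  marked : String → String → String
  marked []       out = out
  marked (b ∷ bs) out = marked bs (true ∷ b ∷ out)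

  -- `marked` puts its pairs in front of `out`, so on a reversed string it yields `delimit` of the
  -- original; the closing `false` has to be in place beforehand.
  marked-reverse : ∀ xs {ys out} → marked (xs ʳ++ ys) (false ∷ out) ≡ marked ys (delimit xs ++ out)
  marked-reverse []       = refl
  marked-reverse (x ∷ xs) {ys} = marked-reverse xs {x ∷ ys}

  markBit : Bool → Prog 2
  markBit b = push 1F b ⨾ push 1F true

  marks : Prog 2
  marks = forEach 0F markBit

  marks-run : ∀ xs {out} → Run marks (xs ∷ out ∷ []) ([] ∷ marked xs out ∷ []) (1 + length xs * 5)
  marks-run []       = each-[] markBit
  marks-run (x ∷ xs) = each-∷ markBit (run (⇓seq ⇓push ⇓push) ≤-refl) (marks-run xs)

  emitDelimited : Prog 3
  emitDelimited = on (0F ∷ 1F ∷ []) move ⨾ push 2F false ⨾ on (1F ∷ 2F ∷ []) marks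

  emitDelimited-lin : ∀ {ℓ xs out} → length xs < ℓ →
    Lin emitDelimited (xs ∷ [] ∷ out ∷ []) ([] ∷ [] ∷ (delimit xs ++ out) ∷ []) 12 ℓ
  emitDelimited-lin {xs = xs} {out} xs< =
    target (cong (λ a → [] ∷ [] ∷ a ∷ []) (marked-reverse xs {[]} {out}))
      (on-lin (0F ∷ 1F ∷ []) (move-lin xs<)
        ▷ constant (≤-trans (s≤s z≤n) xs<) (run ⇓push ≤-refl)
        ▷ on-lin (1F ∷ 2F ∷ []) (affine 5 (shorter[] xs xs<) (marks-run (xs ʳ++ []))))

  -- Bit strings are little-endian.
  shiftRight : ℕ → String → String
  shiftRight m x = drop m x ++ replicate (m ⊓ length x) false

  -- Stack 1 keeps the counter for reuse. Stack 3 receives a zero for each bit really removed, so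
  -- the padding restores the length even if `x` is shorter than `m`.
  dropBit : Bool → Prog 4
  dropBit b = push 1F b ⨾ case 2F skip (pop 2F ⨾ push 3F false) (pop 2F ⨾ push 3F false)

  dropBits : Prog 4
  dropBits = forEach 0F dropBit

  dropBits-run : ∀ m {w} x {z} → Run dropBits (m ∷ w ∷ x ∷ z ∷ [])
    ([] ∷ (m ʳ++ w) ∷ drop (length m) x ∷ (replicate (length m ⊓ length x) false ʳ++ z) ∷ []) (1 + length m * 7)
  dropBits-run []      x  = each-[] dropBit
  dropBits-run (b ∷ m) (false ∷ x) =
    each-∷ dropBit (run (⇓seq ⇓push (⇓false refl (⇓seq ⇓pop ⇓push))) ≤-refl) (dropBits-run m x)
  dropBits-run (b ∷ m) (true ∷ x) =
    each-∷ dropBit (run (⇓seq ⇓push (⇓true refl (⇓seq ⇓pop ⇓push))) ≤-refl) (dropBits-run m x)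
  dropBits-run (b ∷ m) {w} [] {z} =
    each-∷ dropBit (run (⇓seq ⇓push (⇓empty refl ⇓skip)) (n≤1+n 3)) (subst₂
      (λ x k → Run dropBits (m ∷ (b ∷ w) ∷ [] ∷ z ∷ []) ([] ∷ (m ʳ++ (b ∷ w)) ∷ x ∷ (replicate k false ʳ++ z) ∷ []) (1 + length m * 7))
      (List.drop-[] (length m)) (⊓-zeroʳ (length m)) (dropBits-run m []))

  -- The zeros become the high bits and must lie below the surviving bits, which are therefore set
  -- aside on stack 3 while the zeros are moved into place.
  shift : Prog 5
  shift = on (0F ∷ 1F ∷ 2F ∷ 4F ∷ []) dropBits ⨾ on (2F ∷ 3F ∷ []) move ⨾ on (4F ∷ 2F ∷ []) move
        ⨾ on (3F ∷ 2F ∷ []) move ⨾ on (1F ∷ 0F ∷ []) move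

  shift-lin : ∀ {ℓ m x} → length m < ℓ → length x < ℓ →
    Lin shift (m ∷ [] ∷ x ∷ [] ∷ [] ∷ []) (m ∷ [] ∷ shiftRight (length m) x ∷ [] ∷ [] ∷ []) 28 ℓ
  shift-lin {ℓ} {m} {x} m< x< =
    target (cong₂ (λ a b → a ∷ [] ∷ b ∷ [] ∷ [] ∷ []) (reverse-twice[] m)
             (trans (reverse-twice (drop (length m) x)) (cong (drop (length m) x ++_) (reverse-twice[] pad))))
      (on-lin (0F ∷ 1F ∷ 2F ∷ 4F ∷ []) (affine 7 m< (dropBits-run m x))
        ▷ on-lin (2F ∷ 3F ∷ []) (move-lin rest<)
        ▷ on-lin (4F ∷ 2F ∷ []) (move-lin (shorter[] pad pad<))
        ▷ on-lin (3F ∷ 2F ∷ []) (move-lin (shorter[] (drop (length m) x) rest<))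
        ▷ on-lin (1F ∷ 0F ∷ []) (move-lin (shorter[] m m<)))
    where
    pad : String
    pad = replicate (length m ⊓ length x) false
    rest< : length (drop (length m) x) < ℓ
    rest< = ≤-<-trans (≤-trans (≤-reflexive (List.length-drop (length m) x)) (m∸n≤m _ (length m))) x<
    pad< : length pad < ℓ
    pad< = ≤-<-trans (≤-trans (≤-reflexive (List.length-replicate (length m ⊓ length x))) (m⊓n≤n (length m) (length x))) x<

  -- A carry out of the last bit is dropped, which preserves the length. For the coefficients of an
  -- instance this cannot occur, because rounding with `m ≥ 1` leaves the top bit free.
  increment : String → String
  increment []          = []
  increment (false ∷ x) = true ∷ x
  increment (true ∷ x)  = false ∷ increment x

  carries : String → String
  carries []          = []
  carries (false ∷ x) = []
  carries (true ∷ x)  = false ∷ carries x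

  uncarried : String → String
  uncarried []          = []
  uncarried (false ∷ x) = true ∷ x
  uncarried (true ∷ x)  = uncarried x

  carries-uncarried : ∀ x → carries x ++ uncarried x ≡ increment x
  carries-uncarried []          = refl
  carries-uncarried (false ∷ x) = refl
  carries-uncarried (true ∷ x)  = cong (false ∷_) (carries-uncarried x)

  length-carries : ∀ x → length (carries x) ≤ length x
  length-carries []          = z≤n
  length-carries (false ∷ x) = z≤n
  length-carries (true ∷ x)  = s≤s (length-carries x)

  length-increment : ∀ x → length (increment x) ≡ length x
  length-increment []          = refl
  length-increment (false ∷ x) = refl
  length-increment (true ∷ x)  = cong suc (length-increment x)

  -- Stack 0 holds a one-bit flag whose removal ends the loop: `while` tests a stack for emptiness
  -- only, not for its top bit. `countLoop` and `undelimitLoop` follow the same pattern.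
  carryLoop : Prog 3
  carryLoop = while 0F (case 1F (pop 0F) (pop 1F ⨾ push 1F true ⨾ pop 0F) (pop 1F ⨾ push 2F false))

  carryLoop-run : ∀ x {c} → Run carryLoop ((true ∷ []) ∷ x ∷ c ∷ []) ([] ∷ uncarried x ∷ (carries x ʳ++ c) ∷ [])
    (6 + length x * 4)
  carryLoop-run []          = run (⇓loop refl (⇓empty refl ⇓pop) (⇓done refl)) (m≤m+n 4 _)
  carryLoop-run (false ∷ x) = run (⇓loop refl (⇓false refl (⇓seq ⇓pop (⇓seq ⇓push ⇓pop))) (⇓done refl)) (m≤m+n 6 _)
  carryLoop-run (true ∷ x) with run p p≤ ← carryLoop-run x =
    run (⇓loop refl (⇓true refl (⇓seq ⇓pop ⇓push)) p) (+-monoʳ-≤ 4 p≤)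

  incr : Prog 3
  incr = push 0F true ⨾ carryLoop ⨾ on (2F ∷ 1F ∷ []) move

  incr-lin : ∀ {ℓ x} → length x < ℓ → Lin incr ([] ∷ x ∷ [] ∷ []) ([] ∷ increment x ∷ [] ∷ []) 16 ℓ
  incr-lin {ℓ} {x} x< =
    target (cong (λ a → [] ∷ a ∷ [] ∷ []) (trans (reverse-twice (carries x)) (carries-uncarried x)))
      (constant (≤-trans (s≤s z≤n) x<) (run ⇓push ≤-refl)
        ▷ lin {κ = 10} (weaken bound (carryLoop-run x))
        ▷ on-lin (2F ∷ 1F ∷ []) (move-lin (shorter[] (carries x) (≤-<-trans (length-carries x) x<))))
    where
    open ≤-Reasoning
    bound : 6 + length x * 4 ≤ 10 * ℓ
    bound = begin
      6 + length x * 4 ≤⟨ +-mono-≤ (m≤m*n 6 ℓ {{>-nonZero (≤-trans (s≤s z≤n) x<)}}) (*-monoˡ-≤ 4 (<⇒≤ x<)) ⟩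
      6 * ℓ + ℓ * 4    ≡⟨ cong (6 * ℓ +_) (*-comm ℓ 4) ⟩
      6 * ℓ + 4 * ℓ    ≡⟨ *-distribʳ-+ ℓ 6 4 ⟨
      10 * ℓ           ∎

  -- One copy of the block, on stack 3, is to be rounded; the other, on stack 4, accumulates the
  -- input in reverse so that it can be restored for the next query.
  grabBit : Bool → Prog 5
  grabBit b = push 1F b ⨾
    case 2F skip (pop 2F ⨾ push 3F false ⨾ push 4F false) (pop 2F ⨾ push 3F true ⨾ push 4F true)

  grabBits : Prog 5
  grabBits = forEach 0F grabBit

  grabBits-run : ∀ c {w} r {x y} → Run grabBits (c ∷ w ∷ r ∷ x ∷ y ∷ [])
    ([] ∷ (c ʳ++ w) ∷ drop (length c) r ∷ (take (length c) r ʳ++ x) ∷ (take (length c) r ʳ++ y) ∷ []) (1 + length c * 8)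
  grabBits-run []      r  = each-[] grabBit
  grabBits-run (b ∷ c) (false ∷ r) =
    each-∷ grabBit (run (⇓seq ⇓push (⇓false refl (⇓seq ⇓pop (⇓seq ⇓push ⇓push)))) ≤-refl) (grabBits-run c r)
  grabBits-run (b ∷ c) (true ∷ r) =
    each-∷ grabBit (run (⇓seq ⇓push (⇓true refl (⇓seq ⇓pop (⇓seq ⇓push ⇓push)))) ≤-refl) (grabBits-run c r)
  grabBits-run (b ∷ c) {w} [] {x} {y} =
    each-∷ grabBit (run (⇓seq ⇓push (⇓empty refl ⇓skip)) (≤-trans (n≤1+n 3) (n≤1+n 4))) (subst₂
      (λ r t → Run grabBits (c ∷ (b ∷ w) ∷ [] ∷ x ∷ y ∷ []) ([] ∷ (c ʳ++ (b ∷ w)) ∷ r ∷ (t ʳ++ x) ∷ (t ʳ++ y) ∷ []) (1 + length c * 8))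
      (List.drop-[] (length c)) (List.take-[] (length c)) (grabBits-run c []))

  grab : Prog 5
  grab = grabBits ⨾ on (1F ∷ 0F ∷ []) move

  grab-lin : ∀ {ℓ c r y} → length c < ℓ → Lin grab (c ∷ [] ∷ r ∷ [] ∷ y ∷ [])
    (c ∷ [] ∷ drop (length c) r ∷ reverse (take (length c) r) ∷ (take (length c) r ʳ++ y) ∷ []) 14 ℓ
  grab-lin {c = c} {r} {y} c< =
    target (cong (λ a → a ∷ [] ∷ drop (length c) r ∷ reverse (take (length c) r) ∷ (take (length c) r ʳ++ y) ∷ []) (reverse-twice[] c))
      (affine 8 c< (grabBits-run c r) ▷ on-lin (1F ∷ 0F ∷ []) (move-lin (shorter[] c c<)))

  -- A string that ends prematurely leaves the rest [].  No error needs to be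
  -- raised, as a well-formed instance of size n ends with n * n > 0 bits.

  ones : String → String
  ones (true ∷ y) = true ∷ ones y
  ones _          = []

  afterOnes : String → String
  afterOnes []          = []
  afterOnes (false ∷ y) = y
  afterOnes (true ∷ y)  = afterOnes y

  payload : String → String
  payload (true ∷ b ∷ y) = b ∷ payload y
  payload _              = []

  afterDelimited : String → String
  afterDelimited []             = []
  afterDelimited (false ∷ y)    = y
  afterDelimited (true ∷ [])    = []
  afterDelimited (true ∷ b ∷ y) = afterDelimited y

  countLoop : Prog 3
  countLoop = while 0F (case 1F (pop 0F) (pop 1F ⨾ pop 0F) (pop 1F ⨾ push 2F true))

  countLoop-run : ∀ y {x} → Run countLoop ((true ∷ []) ∷ y ∷ x ∷ []) ([] ∷ afterOnes y ∷ (ones y ʳ++ x) ∷ [])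
    (1 + suc (length y) * 4)
  countLoop-run []          = run (⇓loop refl (⇓empty refl ⇓pop) (⇓done refl)) (m≤m+n 4 _)
  countLoop-run (false ∷ y) = run (⇓loop refl (⇓false refl (⇓seq ⇓pop ⇓pop)) (⇓done refl)) (m≤m+n 5 _)
  countLoop-run (true ∷ y) with run p p≤ ← countLoop-run y =
    run (⇓loop refl (⇓true refl (⇓seq ⇓pop ⇓push)) p) (+-monoʳ-≤ 4 p≤)

  undelimitLoop : Prog 3
  undelimitLoop = while 0F (case 1F (pop 0F) (pop 1F ⨾ pop 0F)
    (pop 1F ⨾ case 1F (pop 0F) (pop 1F ⨾ push 2F false) (pop 1F ⨾ push 2F true)))

  undelimitLoop-run : ∀ y {x} → Run undelimitLoop ((true ∷ []) ∷ y ∷ x ∷ []) ([] ∷ afterDelimited y ∷ (payload y ʳ++ x) ∷ [])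
    (1 + suc (length y) * 6)
  undelimitLoop-run []          = run (⇓loop refl (⇓empty refl ⇓pop) (⇓done refl)) (m≤m+n 4 _)
  undelimitLoop-run (false ∷ y) = run (⇓loop refl (⇓false refl (⇓seq ⇓pop ⇓pop)) (⇓done refl)) (m≤m+n 5 _)
  undelimitLoop-run (true ∷ []) = run (⇓loop refl (⇓true refl (⇓seq ⇓pop (⇓empty refl ⇓pop))) (⇓done refl)) (m≤m+n 6 _)
  undelimitLoop-run (true ∷ false ∷ y) with run p p≤ ← undelimitLoop-run y =
    run (⇓loop refl (⇓true refl (⇓seq ⇓pop (⇓false refl (⇓seq ⇓pop ⇓push)))) p)
      (+-monoʳ-≤ 6 (≤-trans p≤ (m≤n+m _ 6)))
  undelimitLoop-run (true ∷ true ∷ y) with run p p≤ ← undelimitLoop-run y =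
    run (⇓loop refl (⇓true refl (⇓seq ⇓pop (⇓true refl (⇓seq ⇓pop ⇓push)))) p)
      (+-monoʳ-≤ 6 (≤-trans p≤ (m≤n+m _ 6)))

  -- The given algorithm is guaranteed to work only when all stacks but its input are empty, hence a
  -- full clearing after every query.
  clearAll : ∀ k → Prog k
  clearAll zero    = skip
  clearAll (suc k) = while 0F (pop 0F) ⨾ rename suc (clearAll k)

  clear-run : ∀ {k} x {σ : Store k} → Run (while 0F (pop 0F)) (x ∷ σ) ([] ∷ σ) (1 + length x * 2)
  clear-run []      = run (⇓done refl) ≤-refl
  clear-run (b ∷ x) with run p p≤ ← clear-run x = run (⇓loop refl ⇓pop p) (+-monoʳ-≤ 2 p≤)

  clearAll-run : ∀ {k} (σ : Store k) {h} → (∀ i → length (lookup σ i) ≤ h) →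
    Run (clearAll k) σ (Vec.replicate k []) (1 + k * (1 + h * 2))
  clearAll-run []      _ = run ⇓skip ≤-refl
  clearAll-run {suc k} (x ∷ σ) {h} σ≤ =
    weaken bound (clear-run x then raise-run ([] ∷ []) (clearAll-run σ (σ≤ ∘ suc)))
    where
    open ≤-Reasoning
    bound : 1 + length x * 2 + (1 + k * (1 + h * 2)) ≤ 1 + suc k * (1 + h * 2)
    bound = begin
      1 + length x * 2 + (1 + k * (1 + h * 2)) ≤⟨ +-monoˡ-≤ _ (s≤s (*-monoˡ-≤ 2 (σ≤ zero))) ⟩
      (1 + h * 2) + suc (k * (1 + h * 2))      ≡⟨ +-suc (1 + h * 2) (k * (1 + h * 2)) ⟩
      1 + suc k * (1 + h * 2)                  ∎

  -- Rounded instances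

  pattern 10F = suc 9F
  pattern 11F = suc 10F
  pattern 12F = suc 11F
  pattern 13F = suc 12F
  pattern 14F = suc 13F
  pattern 15F = suc 14F

  -- The working stacks: answer (initially the input), size and parameter (both
  -- ignored), copy of the input, structure, threshold, reversed coefficients,
  -- size, number of bits to drop, six auxiliary stacks, and the stacks of the
  -- pseudo-polynomial algorithm.
  work : ∀ {k} (ans n d y s t r size m x v z w r′ g : String) → Store k → Store (15 + k)
  work ans n d y s t r size m x v z w r′ g as =
    ans ∷ n ∷ d ∷ y ∷ s ∷ t ∷ r ∷ size ∷ m ∷ x ∷ v ∷ z ∷ w ∷ r′ ∷ g ∷ as

  adjust : Bool → ℕ → String → String
  adjust false m x = shiftRight m x
  adjust true  m x = increment (shiftRight m x)

  length-shiftRight : ∀ m x → length (shiftRight m x) ≡ length x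
  length-shiftRight m x = begin
    length (shiftRight m x)                                       ≡⟨ List.length-++ (drop m x) ⟩
    length (drop m x) + length (replicate (m ⊓ length x) false)   ≡⟨ cong₂ _+_ (List.length-drop m x) (List.length-replicate (m ⊓ length x)) ⟩
    (length x ∸ m) + (m ⊓ length x)                               ≡⟨ cong (_+ (m ⊓ length x)) (m∸n≡m∸m⊓n (length x) m) ⟩
    (length x ∸ (m ⊓ length x)) + (m ⊓ length x)                  ≡⟨ m∸n+n≡m (m⊓n≤n m (length x)) ⟩
    length x                                                      ∎
    where
    open ≡-Reasoning
    m∸n≡m∸m⊓n : ∀ a b → a ∸ b ≡ a ∸ (b ⊓ a)
    m∸n≡m∸m⊓n zero    zero    = refl
    m∸n≡m∸m⊓n zero    (suc b) = refl
    m∸n≡m∸m⊓n (suc a) zero    = refl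
    m∸n≡m∸m⊓n (suc a) (suc b) = m∸n≡m∸m⊓n a b

  length-adjust : ∀ b m x → length (adjust b m x) ≡ length x
  length-adjust false m x = length-shiftRight m x
  length-adjust true  m x = trans (length-increment (shiftRight m x)) (length-shiftRight m x)

  -- A relation that follows the loop of `build`, one `cut` per round. The string is the reversed
  -- coefficient part, so blocks come last first, each turned back by `reverse`; on ill-formed input
  -- the final block may be short.
  data Blocks (n : ℕ) : String → List String → Set where
    []  : Blocks n [] []
    cut : ∀ {b r cs} → Blocks n (drop n (b ∷ r)) cs → Blocks n (b ∷ r) (reverse (take n (b ∷ r)) ∷ cs)

  -- Later blocks are put in front, which undoes the last-first order of `Blocks`.
  emitAll : (String → String) → List String → String → String
  emitAll f []       out = out
  emitAll f (c ∷ cs) out = emitAll f cs (f c ++ out)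

  blocks : ∀ n → .{{NonZero n}} → ∀ r → ∃[ cs ] Blocks n r cs
  blocks (suc n) r = go r (<-wellFounded (length r))
    where
    go : ∀ r → Acc _<_ (length r) → ∃[ cs ] Blocks (suc n) r cs
    go []      _         = _ , []
    go (b ∷ r) (acc rec) = let _ , bs = go (drop n r) (rec (s≤s smaller)) in _ , cut bs
      where
      smaller : length (drop n r) ≤ length r
      smaller = ≤-trans (≤-reflexive (List.length-drop n r)) (m∸n≤m (length r) n)

  -- Rounding preserves the number of bits, so a query has `n * n` coefficient bits only if the
  -- input had them. `well-formed` rests on this.
  length-emitAll : ∀ {n r cs} f → (∀ x → length (f x) ≡ length x) → Blocks n r cs →
    ∀ out → length (emitAll f cs out) ≡ length r + length out
  length-emitAll f f-length [] out = refl
  length-emitAll {n} f f-length (cut {b} {r} bs) out = begin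
    _ ≡⟨ length-emitAll f f-length bs _ ⟩
    length (drop n (b ∷ r)) + length (f (reverse c) ++ out)          ≡⟨ cong (length (drop n (b ∷ r)) +_) (List.length-++ (f (reverse c))) ⟩
    length (drop n (b ∷ r)) + (length (f (reverse c)) + length out)  ≡⟨ cong (λ a → length (drop n (b ∷ r)) + (a + length out)) (trans (f-length _) (List.length-reverse c)) ⟩
    length (drop n (b ∷ r)) + (length c + length out)                ≡⟨ +-assoc (length (drop n (b ∷ r))) _ _ ⟨
    length (drop n (b ∷ r)) + length c + length out                  ≡⟨ cong (_+ length out) (+-comm (length (drop n (b ∷ r))) (length c)) ⟩
    length c + length (drop n (b ∷ r)) + length out                  ≡⟨ cong (_+ length out) (List.length-++ c) ⟨
    length (c ++ drop n (b ∷ r)) + length out                        ≡⟨ cong (λ a → length a + length out) (List.take++drop≡id n (b ∷ r)) ⟩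
    length (b ∷ r) + length out                                      ∎
    where
    open ≡-Reasoning
    c : String
    c = take n (b ∷ r)

  length-blocks : ∀ {n r cs} → .{{NonZero n}} → Blocks n r cs → length cs ≤ length r
  length-blocks [] = z≤n
  length-blocks {suc n} (cut {b} {r} bs) =
    s≤s (≤-trans (length-blocks bs) (≤-trans (≤-reflexive (List.length-drop n r)) (m∸n≤m (length r) n)))

  module _ {k : ℕ} where

    increase : Bool → Prog (16 + k)
    increase false = skip
    increase true  = on (14F ∷ 9F ∷ 12F ∷ []) incr

    -- Stacks 9 to 12 and 14 are scratch space that each subroutine leaves empty apart from its
    -- result, and stack 13 collects the blocks already treated.
    block : Bool → Prog (16 + k)
    block b = on (7F ∷ 12F ∷ 6F ∷ 9F ∷ 13F ∷ []) grab
            ⨾ on (8F ∷ 12F ∷ 9F ∷ 10F ∷ 11F ∷ []) shift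
            ⨾ increase b
            ⨾ on (9F ∷ 10F ∷ 15F ∷ []) emit

    module _ {ℓ : ℕ} {n d y s t size m : String} {as : Store k}
             (size< : length size < ℓ) (m< : length m < ℓ) where

      0<ℓ : 0 < ℓ
      0<ℓ = ≤-trans (s≤s z≤n) size<

      working : (r x r′ out : String) → Store (16 + k)
      working r x r′ out = work [] n d y s t r size m x [] [] [] r′ [] (out ∷ as)

      increase-lin : ∀ b {r x r′ out} → length x < ℓ →
        Lin (increase b) (working r (shiftRight (length m) x) r′ out) (working r (adjust b (length m) x) r′ out) 16 ℓ
      increase-lin false _ = constant 0<ℓ (run ⇓skip (m≤m+n 1 15))
      increase-lin true {x = x} x< =
        on-lin (14F ∷ 9F ∷ 12F ∷ []) (incr-lin (subst (_< ℓ) (sym (length-shiftRight (length m) x)) x<))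

      block-lin : ∀ b {r r′ out} → length r < ℓ → let c = take (length size) r in
        Lin (block b) (working r [] r′ out)
          (working (drop (length size) r) [] (c ʳ++ r′) (adjust b (length m) (reverse c) ++ out)) 68 ℓ
      block-lin b {r} {r′} {out} r< =
        working r [] r′ out
          ⟨ on-lin (7F ∷ 12F ∷ 6F ∷ 9F ∷ 13F ∷ []) (grab-lin size<) ⟩
        working (drop (length size) r) (reverse c) (c ʳ++ r′) out
          ⟨ on-lin (8F ∷ 12F ∷ 9F ∷ 10F ∷ 11F ∷ []) (shift-lin m< c<) ⟩
        working (drop (length size) r) (shiftRight (length m) (reverse c)) (c ʳ++ r′) out
          ⟨ increase-lin b c< ⟩
        on-lin′ (9F ∷ 10F ∷ 15F ∷ []) (working (drop (length size) r) (adjust b (length m) (reverse c)) (c ʳ++ r′) out) (emit-lin (subst (_< ℓ) (sym (length-adjust b (length m) _)) c<))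
        where
        c : String
        c = take (length size) r
        c< : length (reverse (take (length size) r)) < ℓ
        c< = ≤-<-trans (≤-trans (≤-reflexive (trans (List.length-reverse (take (length size) r)) (List.length-take (length size) r)))
               (m⊓n≤n (length size) (length r))) r<

      blocks-run : ∀ b {r cs} → Blocks (length size) r cs → ∀ {r′ out} → length r < ℓ →
        Run (while 6F (block b)) (working r [] r′ out)
          (working [] [] (r ʳ++ r′) (emitAll (adjust b (length m)) cs out)) (1 + length cs * (1 + 68 * ℓ))
      blocks-run b [] _ = run (⇓done refl) ≤-refl
      blocks-run b {r} {_ ∷ cs} (cut bs) {r′} {out} r<
        = weaken (s≤s (≤-reflexive (+-suc (68 * ℓ) _)))
            (retarget (cong (λ a → working [] [] a (emitAll (adjust b (length m)) cs (adjust b (length m) (reverse c) ++ out)))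
                (trans (sym (List.++-ʳ++ c)) (cong (_ʳ++ r′) (List.take++drop≡id (length size) r))))
              (loop-run refl (toRun (block-lin b r<)) (blocks-run b bs
                (≤-<-trans (≤-trans (≤-reflexive (List.length-drop (length size) r)) (m∸n≤m _ (length size))) r<))))
        where
        c : String
        c = take (length size) r

      blocks-lin : ∀ b {r cs} → .{{NonZero (length size)}} → Blocks (length size) r cs → ∀ {r′ out} → length r < ℓ →
        Lin (while 6F (block b)) (working r [] r′ out)
          (working [] [] (r ʳ++ r′) (emitAll (adjust b (length m)) cs out)) 70 (ℓ * ℓ)
      blocks-lin b {r} {cs} bs r< = lin (weaken bound (blocks-run b bs r<))
        where
        open ≤-Reasoning
        instance
          ℓ≢0 : NonZero ℓ
          ℓ≢0 = >-nonZero 0<ℓ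
        bound : 1 + length cs * (1 + 68 * ℓ) ≤ 70 * (ℓ * ℓ)
        bound = begin
          1 + length cs * (1 + 68 * ℓ)   ≤⟨ +-mono-≤ (*-mono-≤ 0<ℓ 0<ℓ) (*-mono-≤ (≤-trans (length-blocks bs) (<⇒≤ r<)) (+-monoˡ-≤ (68 * ℓ) 0<ℓ)) ⟩
          ℓ * ℓ + ℓ * (69 * ℓ)           ≡⟨ cong (ℓ * ℓ +_) (trans (sym (*-assoc ℓ 69 ℓ)) (trans (cong (_* ℓ) (*-comm ℓ 69)) (*-assoc 69 ℓ ℓ))) ⟩
          70 * (ℓ * ℓ)                   ∎

    -- A stack grows at its front, so the query is assembled from its end: coefficients, threshold,
    -- structure, size. Every source is restored for the next query.
    build : Bool → Prog (16 + k)
    build b = while 6F (block b)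
            ⨾ on (13F ∷ 6F ∷ []) move
            ⨾ on (5F ∷ 10F ∷ 9F ∷ []) copy
            ⨾ on (8F ∷ 12F ∷ 9F ∷ 10F ∷ 11F ∷ []) shift
            ⨾ on (9F ∷ 10F ∷ 15F ∷ []) emitDelimited
            ⨾ on (4F ∷ 10F ∷ 9F ∷ []) copy
            ⨾ on (9F ∷ 10F ∷ 15F ∷ []) emitDelimited
            ⨾ push 15F false
            ⨾ on (7F ∷ 10F ∷ 15F ∷ []) moveTwice
            ⨾ on (10F ∷ 7F ∷ []) move

    query : Bool → (size s t m : String) → List String → String
    query b size s t m cs =
      size ʳ++ (false ∷ delimit s ++ delimit (shiftRight (length m) t) ++ emitAll (adjust b (length m)) cs [])

    abstract
      -- Quadratic, since at most `ℓ` blocks are treated, each at a cost linear in `ℓ`. The constant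
      -- is found by unification, and `abstract` keeps it from unfolding later.
      build-lin : ∃[ κ ] ∀ b {ℓ n d y s t r size m cs as} → .{{NonZero (length size)}} →
        length s < ℓ → length t < ℓ → length r < ℓ → length size < ℓ → length m < ℓ → Blocks (length size) r cs →
        Lin (build b) (work [] n d y s t r size m [] [] [] [] [] [] ([] ∷ as))
                      (work [] n d y s t r size m [] [] [] [] [] [] (query b size s t m cs ∷ as)) κ (ℓ * ℓ)
      build-lin = _ , λ b {ℓ} {n} {d} {y} {s} {t} {r} {size} {m} {cs} {as} s< t< r< size< m< bs →
        let instance
              ℓ≢0 : NonZero ℓ
              ℓ≢0 = >-nonZero (≤-trans (s≤s z≤n) size<)
            ℓ≤ = m≤m*n ℓ ℓ
            at : (r size x r′ out : String) → Store (16 + k)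
            at r size x r′ out = work [] n d y s t r size m x [] [] [] r′ [] (out ∷ as)
            o₁ = emitAll (adjust b (length m)) cs []
            o₂ = delimit (shiftRight (length m) t) ++ o₁
            o₃ = delimit s ++ o₂
        in target (cong₂ (λ a c → at a c [] [] (query b size s t m cs))
                    (reverse-twice[] r) (reverse-twice[] size))
           (blocks-lin {ℓ = ℓ} size< m< b bs r< ▷ scale ℓ≤ (
           at [] size [] (r ʳ++ []) o₁
             ⟨ on-lin (13F ∷ 6F ∷ []) (move-lin (shorter[] r r<)) ⟩
           at ((r ʳ++ []) ʳ++ []) size [] [] o₁
             ⟨ on-lin (5F ∷ 10F ∷ 9F ∷ []) (copy-lin t<) ⟩
           at ((r ʳ++ []) ʳ++ []) size t [] o₁
             ⟨ on-lin (8F ∷ 12F ∷ 9F ∷ 10F ∷ 11F ∷ []) (shift-lin m< t<) ⟩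
           at ((r ʳ++ []) ʳ++ []) size (shiftRight (length m) t) [] o₁
             ⟨ on-lin (9F ∷ 10F ∷ 15F ∷ []) (emitDelimited-lin (subst (_< ℓ) (sym (length-shiftRight (length m) t)) t<)) ⟩
           at ((r ʳ++ []) ʳ++ []) size [] [] o₂
             ⟨ on-lin (4F ∷ 10F ∷ 9F ∷ []) (copy-lin s<) ⟩
           at ((r ʳ++ []) ʳ++ []) size s [] o₂
             ⟨ on-lin (9F ∷ 10F ∷ 15F ∷ []) (emitDelimited-lin s<) ⟩
           at ((r ʳ++ []) ʳ++ []) size [] [] o₃
             ⟨ constant (≤-trans (s≤s z≤n) size<) (run ⇓push ≤-refl) ⟩
           at ((r ʳ++ []) ʳ++ []) size [] [] (false ∷ o₃)
             ⟨ on-lin (7F ∷ 10F ∷ 15F ∷ []) (moveTwice-lin size<) ⟩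
           on-lin′ (10F ∷ 7F ∷ []) (work [] n d y s t ((r ʳ++ []) ʳ++ []) [] m [] (size ʳ++ []) [] [] [] [] ((size ʳ++ (false ∷ o₃)) ∷ as)) (move-lin (shorter[] size size<))))

  -- The decision algorithm

  -- Filling a stack bit by bit reverses, which accounts for `reverse` in the first and the last;
  -- for the coefficients this is the orientation that `Blocks` wants.
  sizeOf structureOf thresholdOf coefficientsOf : String → String
  sizeOf y         = reverse (ones y)
  structureOf y    = payload (afterOnes y)
  thresholdOf y    = payload (afterDelimited (afterOnes y))
  coefficientsOf y = reverse (afterDelimited (afterDelimited (afterOnes y)))

  -- Blocks of size 0 exist only for the empty string. The condition holds at every query, as an
  -- empty size field makes the loop over `m` end at once.
  CoefficientBlocks : String → List String → Set
  CoefficientBlocks y cs = NonZero (length (sizeOf y)) → Blocks (length (sizeOf y)) (coefficientsOf y) cs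

  length-ones : ∀ y → length (ones y) ≤ length y
  length-ones []          = z≤n
  length-ones (false ∷ y) = z≤n
  length-ones (true ∷ y)  = s≤s (length-ones y)

  length-afterOnes : ∀ y → length (afterOnes y) ≤ length y
  length-afterOnes []          = z≤n
  length-afterOnes (false ∷ y) = n≤1+n _
  length-afterOnes (true ∷ y)  = m≤n⇒m≤1+n (length-afterOnes y)

  length-payload : ∀ y → length (payload y) ≤ length y
  length-payload []             = z≤n
  length-payload (false ∷ y)    = z≤n
  length-payload (true ∷ [])    = z≤n
  length-payload (true ∷ b ∷ y) = s≤s (m≤n⇒m≤1+n (length-payload y))

  length-afterDelimited : ∀ y → length (afterDelimited y) ≤ length y
  length-afterDelimited []             = z≤n
  length-afterDelimited (false ∷ y)    = n≤1+n _
  length-afterDelimited (true ∷ [])    = z≤n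
  length-afterDelimited (true ∷ b ∷ y) = m≤n⇒m≤1+n (m≤n⇒m≤1+n (length-afterDelimited y))

  module _ {k : ℕ} where

    undelimit : Fin (16 + k) → Prog (16 + k)
    undelimit i = push 14F true ⨾ on (14F ∷ 0F ∷ 9F ∷ []) undelimitLoop ⨾ on (9F ∷ i ∷ []) move

    parse : Prog (16 + k)
    parse = on (0F ∷ 10F ∷ 3F ∷ []) copy
          ⨾ push 14F true
          ⨾ on (14F ∷ 0F ∷ 7F ∷ []) countLoop
          ⨾ on (7F ∷ 10F ∷ 8F ∷ []) copy
          ⨾ undelimit 4F
          ⨾ undelimit 5F
          ⨾ on (0F ∷ 6F ∷ []) move

    abstract
      parse-lin : ∃[ κ ] ∀ {ℓ n d y as} → suc (length y) < ℓ →
        Lin parse (work y n d [] [] [] [] [] [] [] [] [] [] [] [] as)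
          (work [] n d y (structureOf y) (thresholdOf y) (coefficientsOf y) (sizeOf y) (sizeOf y) [] [] [] [] [] [] as) κ ℓ
      parse-lin = _ , λ {ℓ} {n} {d} {y} {as} y< →
        let 0< = ≤-trans (s≤s z≤n) y<
            y<ℓ = <-trans (n<1+n _) y<
            size< = shorter[] (ones y) (≤-<-trans (length-ones y) y<ℓ)
            y₁ = afterOnes y
            y₁≤ = length-afterOnes y
            y₂ = afterDelimited y₁
            y₂≤ = ≤-trans (length-afterDelimited y₁) y₁≤
            y₃ = afterDelimited y₂
            y₃≤ = ≤-trans (length-afterDelimited y₂) y₂≤
            s< = ≤-<-trans (length-payload y₁) (≤-<-trans y₁≤ y<ℓ)
            t< = ≤-<-trans (length-payload y₂) (≤-<-trans y₂≤ y<ℓ)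
            at : (in′ y s t r size m x g : String) → Store (16 + k)
            at in′ y s t r size m x g = work in′ n d y s t r size m x [] [] [] [] g as
            size = sizeOf y
            s = (payload y₁ ʳ++ []) ʳ++ []
            t = (payload y₂ ʳ++ []) ʳ++ []
        in target (cong₂ (λ s t → at [] y s t (reverse y₃) size size [] []) (reverse-twice[] (payload y₁)) (reverse-twice[] (payload y₂)))
          (at y [] [] [] [] [] [] [] []
             ⟨ on-lin (0F ∷ 10F ∷ 3F ∷ []) (copy-lin y<ℓ) ⟩
           at y y [] [] [] [] [] [] []
             ⟨ constant 0< (run ⇓push ≤-refl) ⟩
           at y y [] [] [] [] [] [] (true ∷ [])
             ⟨ on-lin (14F ∷ 0F ∷ 7F ∷ []) (affine 4 y< (countLoop-run y)) ⟩
           at y₁ y [] [] [] size [] [] []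
             ⟨ on-lin (7F ∷ 10F ∷ 8F ∷ []) (copy-lin size<) ⟩
           at y₁ y [] [] [] size size [] []
             ⟨ (_ ⟨ constant 0< (run ⇓push ≤-refl) ⟩
                at y₁ y [] [] [] size size [] (true ∷ [])
                  ⟨ on-lin (14F ∷ 0F ∷ 9F ∷ []) (affine 6 (≤-<-trans (s≤s y₁≤) y<) (undelimitLoop-run y₁)) ⟩
                on-lin′ (9F ∷ 4F ∷ []) (at y₂ y [] [] [] size size (payload y₁ ʳ++ []) []) (move-lin (shorter[] (payload y₁) s<))) ⟩
           at y₂ y s [] [] size size [] []
             ⟨ (_ ⟨ constant 0< (run ⇓push ≤-refl) ⟩
                at y₂ y s [] [] size size [] (true ∷ [])
                  ⟨ on-lin (14F ∷ 0F ∷ 9F ∷ []) (affine 6 (≤-<-trans (s≤s y₂≤) y<) (undelimitLoop-run y₂)) ⟩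
                on-lin′ (9F ∷ 5F ∷ []) (at y₃ y s [] [] size size (payload y₂ ʳ++ []) []) (move-lin (shorter[] (payload y₂) t<))) ⟩
           on-lin′ (0F ∷ 6F ∷ []) (at y₃ y s t [] size size [] []) (move-lin (≤-<-trans y₃≤ y<ℓ)))

  heads : String → Bool
  heads (true ∷ _) = true
  heads _          = false

  heads-head : ∀ x → heads x ≡ true ⇔ List.head x ≡ just true
  heads-head []          = mk⇔ (λ ()) (λ ())
  heads-head (false ∷ _) = mk⇔ (λ ()) (λ ())
  heads-head (true ∷ _)  = mk⇔ (λ _ → refl) (λ _ → refl)

  -- Rejection is the empty stack, so that after a refused query stack 14 is ready for the next one.
  flag : Bool → String
  flag true  = true ∷ []
  flag false = []

  -- Queries and rounds of the solver

  module Oracle {k : ℕ} (P : Prog (suc k)) (final : String → Store (suc k)) (time : String → ℕ)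
                (halts : ∀ q → P ⊢ q ∷ Vec.replicate k [] ⇓ final q ∣ time q) where

    verdict : String → Bool
    verdict q = heads (Vec.head (final q))

    ask : Prog (16 + k)
    ask = rename (15 ↑ʳ_) P ⨾ case 15F skip skip (push 14F true) ⨾ rename (15 ↑ʳ_) (clearAll (suc k))

    -- Two steps read the verdict; the last summand pays for clearing `suc k` stacks, none higher
    -- than `length q + time q` by `height-growth`.
    askCost : String → ℕ
    askCost q = time q + (2 + (1 + suc k * (1 + (length q + time q) * 2)))

    ask-run : ∀ {a n d y s t r size m x v z w r′} q →
      Run ask (work a n d y s t r size m x v z w r′ [] (q ∷ Vec.replicate k []))
              (work a n d y s t r size m x v z w r′ (flag (verdict q)) (Vec.replicate (suc k) [])) (askCost q)
    ask-run {a} {n} {d} {y} {s} {t} {r} {size} {m} {x} {v} {z} {w} {r′} q =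
      raise-run (ξ []) (run (halts q) ≤-refl) then look (final q) then
      raise-run (ξ (flag (verdict q))) (clearAll-run (final q) bound)
      where
      ξ : String → Store 15
      ξ g = work a n d y s t r size m x v z w r′ g []
      look : ∀ σ → Run (case 15F skip skip (push 14F true)) (ξ [] Vec.++ σ) (ξ (flag (heads (Vec.head σ))) Vec.++ σ) 2
      look ([] ∷ σ)          = run (⇓empty refl ⇓skip) ≤-refl
      look ((false ∷ q) ∷ σ) = run (⇓false refl ⇓skip) ≤-refl
      look ((true ∷ q) ∷ σ)  = run (⇓true refl ⇓push) ≤-refl
      start : ∀ i → length (lookup (q ∷ Vec.replicate k []) i) ≤ length q
      start zero    = ≤-refl
      start (suc i) = subst (λ a → length a ≤ length q) (sym (Vec.lookup-replicate i [])) z≤n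
      bound : ∀ i → length (lookup (final q) i) ≤ length q + time q
      bound i = ≤-trans (height-growth (halts q) i) (+-monoˡ-≤ (time q) (start i))

    -- Emptying stack 8 stops the loop over `m`, and a nonempty stack 0 tells `finish` that the
    -- answer is known.
    conclude : Bool → Prog (16 + k)
    conclude b = push 0F b ⨾ on (8F ∷ []) (while 0F (pop 0F))

    round : Prog (16 + k)
    round = (build true ⨾ ask) ⨾ case 14F
      ((build false ⨾ ask) ⨾ case 14F (conclude false) (conclude false) (pop 14F ⨾ pop 8F))
      (conclude true) (conclude true)

    finish : Prog (16 + k)
    finish = case 0F (on (3F ∷ 10F ∷ 15F ∷ []) emit ⨾ ask ⨾ case 14F skip skip (push 0F true)) skip skip

    solver : Prog (16 + k)
    solver = parse ⨾ while 8F round ⨾ finish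

    κ : ℕ
    κ = proj₁ (build-lin {k})

    module Rounds {ℓ : ℕ} (y s t r size : String) (cs : List String)
                  (s< : length s < ℓ) (t< : length t < ℓ) (r< : length r < ℓ) (size< : length size < ℓ)
                  (bs : NonZero (length size) → Blocks (length size) r cs) where

      state : (n d ans m g : String) → Store (16 + k)
      state n d ans m g = work ans n d y s t r size m [] [] [] [] [] g (Vec.replicate (suc k) [])

      Q : Bool → String → String
      Q b m = query {k} b size s t m cs

      -- The string stands in unary for the number of bits to drop; `nothing` means that no rounding
      -- decided and the original instance is to be asked.
      outcome : String → Maybe Bool
      outcome []      = nothing
      outcome (b ∷ m) = if verdict (Q true (b ∷ m)) then just true
        else if verdict (Q false (b ∷ m)) then outcome m else just false

      -- Charges both questions and a conclusion, whichever way the round ends.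
      roundCost : String → ℕ
      roundCost m = (κ * (ℓ * ℓ) + askCost (Q true m)) + suc ((κ * (ℓ * ℓ) + askCost (Q false m)) + suc (2 + 2 * ℓ))

      loopCost : String → ℕ
      loopCost []      = 1
      loopCost (b ∷ m) = suc (roundCost (b ∷ m) + (if verdict (Q true (b ∷ m)) then 1
        else if verdict (Q false (b ∷ m)) then loopCost m else 1))

      module _ (n d : String) where

        Ending : Maybe Bool → Store (16 + k) → Set
        Ending nothing  τ = τ ≡ state n d [] [] []
        Ending (just b) τ = Vec.head τ ≡ b ∷ [] × lookup τ 8F ≡ []

        ask-query : ∀ b {m} → length m ≤ length size → NonZero (length m) →
          Run (build b ⨾ ask) (state n d [] m []) (state n d [] m (flag (verdict (Q b m)))) (κ * (ℓ * ℓ) + askCost (Q b m))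
        ask-query b {m} m≤ nz =
          toRun (proj₂ build-lin b {{size≢0}} s< t< r< size< (≤-<-trans m≤ size<) (bs size≢0)) then ask-run (Q b m)
          where
          size≢0 : NonZero (length size)
          size≢0 = >-nonZero (≤-trans (>-nonZero⁻¹ (length m) {{nz}}) m≤)

        conclude-run : ∀ b {m g} → length m < ℓ → Run (conclude b) (state n d [] m g) (state n d (b ∷ []) [] g) (2 + 2 * ℓ)
        conclude-run b {m} {g} m< = weaken (s≤s (s≤s (≤-trans (*-monoˡ-≤ 2 (<⇒≤ m<)) (≤-reflexive (*-comm ℓ 2)))))
          (run ⇓push ≤-refl then on-run (8F ∷ []) (clear-run m))

        rounds-run : ∀ m → length m ≤ length size →
          ∃[ τ ] Run (while 8F round) (state n d [] m []) τ (loopCost m) × Ending (outcome m) τ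
        rounds-run [] _ = _ , run (⇓done refl) ≤-refl , refl
        rounds-run (b ∷ m) m≤ = judge (verdict (Q true (b ∷ m))) refl (verdict (Q false (b ∷ m))) refl
          where
          M = b ∷ m
          m< : length M < ℓ
          m< = ≤-<-trans m≤ size<
          asked : ∀ b {v} → verdict (Q b M) ≡ v →
            Run (build b ⨾ ask) (state n d [] M []) (state n d [] M (flag v)) (κ * (ℓ * ℓ) + askCost (Q b M))
          asked b eq = retarget (cong (λ v → state n d [] M (flag v)) eq) (ask-query b m≤ (record { nonZero = _ }))
          stop : ∀ {ans g} → Run (while 8F round) (state n d ans [] g) (state n d ans [] g) 1
          stop = run (⇓done refl) ≤-refl
          extra : suc (2 + 2 * ℓ) ≤ suc ((κ * (ℓ * ℓ) + askCost (Q false M)) + suc (2 + 2 * ℓ))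
          extra = m≤n⇒m≤1+n (m≤n+m (suc (2 + 2 * ℓ)) (κ * (ℓ * ℓ) + askCost (Q false M)))
          judge : ∀ v → verdict (Q true M) ≡ v → ∀ v′ → verdict (Q false M) ≡ v′ →
            ∃[ τ ] Run (while 8F round) (state n d [] M []) τ (suc (roundCost M + (if v then 1 else if v′ then loopCost m else 1)))
                 × Ending (if v then just true else if v′ then outcome m else just false) τ
          judge true eq _ _ = _ ,
            loop-run refl
              (weaken (+-monoʳ-≤ (κ * (ℓ * ℓ) + askCost (Q true M)) extra)
                (asked true eq then case-true refl (conclude-run true m<))) stop , refl , refl
          judge false eq false eq′ = _ ,
            loop-run refl (asked true eq then case-empty refl (asked false eq′ then case-empty refl (conclude-run false m<))) stop ,
            refl , refl
          judge false eq true eq′ =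
            let τ , p , e = rounds-run m (≤-trans (n≤1+n _) m≤)
            in τ , loop-run refl (asked true eq then case-empty refl (asked false eq′ then
                     case-true refl (weaken (m≤m+n 2 (2 * ℓ)) (run (⇓seq ⇓pop ⇓pop) ≤-refl)))) p , e

    module _ (y : String) (cs : List String) (bs : CoefficientBlocks y cs) where

      -- Two more than the length, because the loops that read a field may run once more than there
      -- are bits, and the bounds of the subroutines are strict.
      ℓ : ℕ
      ℓ = 2 + length y

      private
        y<ℓ : length y < ℓ
        y<ℓ = <-trans (n<1+n _) (n<1+n _)
        y₁≤ = length-afterOnes y
        y₂≤ = ≤-trans (length-afterDelimited (afterOnes y)) y₁≤

        module R = Rounds {ℓ} y (structureOf y) (thresholdOf y) (coefficientsOf y) (sizeOf y) cs
          (≤-<-trans (length-payload (afterOnes y)) (≤-<-trans y₁≤ y<ℓ))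
          (≤-<-trans (length-payload (afterDelimited (afterOnes y))) (≤-<-trans y₂≤ y<ℓ))
          (shorter[] (afterDelimited (afterDelimited (afterOnes y)))
            (≤-<-trans (≤-trans (length-afterDelimited (afterDelimited (afterOnes y))) y₂≤) y<ℓ))
          (shorter[] (ones y) (≤-<-trans (length-ones y) y<ℓ)) bs

      open R using (rounds-run; Ending; state)
      open R public using (Q; outcome; loopCost; roundCost)

      answer : Bool
      answer = fromMaybe (verdict y) (outcome (sizeOf y))

      solverCost : ℕ
      solverCost = proj₁ (parse-lin {k}) * ℓ + (loopCost (sizeOf y)
        + (if ⌊ Maybe.≡-dec Bool._≟_ (outcome (sizeOf y)) nothing ⌋ then suc (10 * ℓ + (askCost y + 2)) else 2))

      solver-run : ∀ n d → ∃[ τ ]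
        Run solver (work y n d [] [] [] [] [] [] [] [] [] [] [] [] (Vec.replicate (suc k) [])) τ solverCost × heads (Vec.head τ) ≡ answer
      solver-run n d =
        let σ , p , e = rounds-run n d (sizeOf y) ≤-refl
            τ , q , f = finish-run (outcome (sizeOf y)) e
        in τ , (toRun (proj₂ (parse-lin {k}) (n<1+n _)) then p then q) , f
        where
        finish-run : ∀ o {σ} → Ending n d o σ → ∃[ τ ]
          Run finish σ τ (if ⌊ Maybe.≡-dec Bool._≟_ o nothing ⌋ then suc (10 * ℓ + (askCost y + 2)) else 2)
            × heads (Vec.head τ) ≡ fromMaybe (verdict y) o
        finish-run (just false) {_ ∷ _} (refl , _) = _ , run (⇓false refl ⇓skip) ≤-refl , refl
        finish-run (just true)  {_ ∷ _} (refl , _) = _ , run (⇓true refl ⇓skip) ≤-refl , refl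
        finish-run nothing refl = _ , case-empty refl
            (toRun (target (cong store (List.++-identityʳ y)) (on-lin′ (3F ∷ 10F ∷ 15F ∷ []) (state n d [] [] []) (emit-lin {ℓ} y<ℓ)))
              then ask-run y then look (verdict y)) , heads-flag (verdict y)
          where
          store : String → Store (16 + k)
          store x = work [] n d [] (structureOf y) (thresholdOf y) (coefficientsOf y) (sizeOf y) [] [] [] [] [] [] [] (x ∷ Vec.replicate k [])
          look : ∀ v {as : Store (suc k)} → Run (case 14F skip skip (push 0F true))
            (work [] n d [] (structureOf y) (thresholdOf y) (coefficientsOf y) (sizeOf y) [] [] [] [] [] [] (flag v) as)
            (work (flag v) n d [] (structureOf y) (thresholdOf y) (coefficientsOf y) (sizeOf y) [] [] [] [] [] [] (flag v) as) 2
          look true  = run (⇓true refl ⇓push) ≤-refl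
          look false = run (⇓empty refl ⇓skip) ≤-refl
          heads-flag : ∀ v → heads (flag v) ≡ v
          heads-flag true  = refl
          heads-flag false = refl

  -- Bit strings and encodings

  bit : Bool → ℕ
  bit b = if b then 1 else 0

  number : String → ℕ
  number []       = 0
  number (b ∷ bs) = bit b + number bs * 2

  bit-parity : ∀ m → bit (m % 2 ≡ᵇ 1) ≡ m % 2
  bit-parity m with m % 2 | m%n<n m 2
  ... | 0             | _ = refl
  ... | 1             | _ = refl
  ... | suc (suc _)   | s≤s (s≤s ())

  number-bits : ∀ k {m} → m < 2 ^ k → number (bits k m) ≡ m
  number-bits zero    {zero} _ = refl
  number-bits zero    {suc m} (s≤s ())
  number-bits (suc k) {m} m< = begin
    bit (m % 2 ≡ᵇ 1) + number (bits k (m / 2)) * 2 ≡⟨ cong₂ (λ a b → a + b * 2) (bit-parity m) (number-bits k (m<n*o⇒m/o<n {n = 2 ^ k} (subst (m <_) (*-comm 2 (2 ^ k)) m<))) ⟩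
    m % 2 + m / 2 * 2                              ≡⟨ m≡m%n+[m/n]*n m 2 ⟨
    m                                              ∎
    where open ≡-Reasoning

  number< : ∀ x → number x < 2 ^ length x
  number< []       = s≤s z≤n
  number< (b ∷ bs) = begin-strict
    bit b + number bs * 2  <⟨ +-monoˡ-< (number bs * 2) (bit<2 b) ⟩
    2 + number bs * 2      ≤⟨ *-monoˡ-≤ 2 (number< bs) ⟩
    2 ^ length bs * 2      ≡⟨ *-comm (2 ^ length bs) 2 ⟩
    2 ^ suc (length bs)    ∎
    where
    open ≤-Reasoning
    bit<2 : ∀ b → bit b < 2
    bit<2 true  = s≤s (s≤s z≤n)
    bit<2 false = s≤s z≤n

  bits-number : ∀ x → bits (length x) (number x) ≡ x
  bits-number []       = refl
  bits-number (b ∷ bs) = cong₂ _∷_ (low b) (trans (cong (bits (length bs)) (high b)) (bits-number bs))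
    where
    low : ∀ b → ((bit b + number bs * 2) % 2 ≡ᵇ 1) ≡ b
    low b with b | [m+kn]%n≡m%n (bit b) (number bs) 2
    ... | true  | eq rewrite eq = refl
    ... | false | eq rewrite eq = refl
    high : ∀ b → (bit b + number bs * 2) / 2 ≡ number bs
    high b = trans (+-distrib-/-∣ʳ (bit b) {d = 2} (divides (number bs) refl)) (trans (cong (_+ number bs * 2 / 2) (bit/2 b)) (m*n/n≡m (number bs) 2))
      where
      bit/2 : ∀ b → bit b / 2 ≡ 0
      bit/2 true  = refl
      bit/2 false = refl

  length-bits : ∀ k m → length (bits k m) ≡ k
  length-bits zero    m = refl
  length-bits (suc k) m = cong suc (length-bits k (m / 2))

  bits-injective : ∀ k {a b} → a < 2 ^ k → b < 2 ^ k → bits k a ≡ bits k b → a ≡ b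
  bits-injective k a< b< eq = trans (sym (number-bits k a<)) (trans (cong number eq) (number-bits k b<))

  -- Right shifts of numbers and of their bit strings

  infixl 7 _≫_

  -- Halving bit by bit runs in step with `bits`; that the result is the quotient by `2ᵐ` is
  -- captured by `≫-upper` and `≫-lower`.
  _≫_ : ℕ → ℕ → ℕ
  v ≫ zero  = v
  v ≫ suc m = (v / 2) ≫ m

  ≫-upper : ∀ v m → v < 2 ^ m * suc (v ≫ m)
  ≫-upper v zero    = ≤-reflexive (sym (*-identityˡ (suc v)))
  ≫-upper v (suc m) = begin-strict
    v                              ≡⟨ m≡m%n+[m/n]*n v 2 ⟩
    v % 2 + v / 2 * 2              <⟨ +-monoˡ-< (v / 2 * 2) (m%n<n v 2) ⟩
    suc (v / 2) * 2                ≤⟨ *-monoˡ-≤ 2 (≫-upper (v / 2) m) ⟩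
    2 ^ m * suc (v / 2 ≫ m) * 2    ≡⟨ *-comm (2 ^ m * suc (v / 2 ≫ m)) 2 ⟩
    2 * (2 ^ m * suc (v / 2 ≫ m))  ≡⟨ *-assoc 2 (2 ^ m) _ ⟨
    2 ^ suc m * suc (v / 2 ≫ m)    ∎
    where open ≤-Reasoning

  ≫-lower : ∀ v m → 2 ^ m * (v ≫ m) ≤ v
  ≫-lower v zero    = ≤-reflexive (*-identityˡ v)
  ≫-lower v (suc m) = begin
    2 ^ suc m * (v / 2 ≫ m)    ≡⟨ *-assoc 2 (2 ^ m) _ ⟩
    2 * (2 ^ m * (v / 2 ≫ m))  ≤⟨ *-monoʳ-≤ 2 (≫-lower (v / 2) m) ⟩
    2 * (v / 2)                ≡⟨ *-comm 2 (v / 2) ⟩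
    v / 2 * 2                  ≤⟨ m/n*n≤m v 2 ⟩
    v                          ∎
    where open ≤-Reasoning

  -- The universal property of the floor. It lets a rounded-down weight be compared with a
  -- rounded-down threshold without loss.
  ≫-greatest : ∀ {v m a} → 2 ^ m * a ≤ v → a ≤ v ≫ m
  ≫-greatest {v} {m} {a} a≤ = s≤s⁻¹ (*-cancelˡ-< (2 ^ m) a (suc (v ≫ m)) (≤-<-trans a≤ (≫-upper v m)))

  ≫-bounded : ∀ k {v} m → v < 2 ^ k → v ≫ m < 2 ^ (k ∸ m)
  ≫-bounded k       zero    v< = v<
  ≫-bounded zero    {zero}  (suc m) v< = ≤-trans (≫-bounded zero m (s≤s z≤n)) (≤-reflexive (cong (2 ^_) (0∸n≡0 m)))
  ≫-bounded zero    {suc v} (suc m) (s≤s ())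
  ≫-bounded (suc k) {v} (suc m) v< = ≫-bounded k m (m<n*o⇒m/o<n {n = 2 ^ k} (subst (v <_) (*-comm 2 (2 ^ k)) v<))

  drop-bits : ∀ k v m → drop m (bits k v) ≡ bits (k ∸ m) (v ≫ m)
  drop-bits k       v zero    = refl
  drop-bits zero    v (suc m) = refl
  drop-bits (suc k) v (suc m) = drop-bits k (v / 2) m

  bits-pad : ∀ k {v} j → v < 2 ^ k → bits (k + j) v ≡ bits k v ++ replicate j false
  bits-pad zero    {suc v} j (s≤s ())
  bits-pad zero    {zero} zero    _ = refl
  bits-pad zero    {zero} (suc j) v< = cong (false ∷_) (bits-pad zero j v<)
  bits-pad (suc k) {v} j v< = cong (_ ∷_) (bits-pad k j (m<n*o⇒m/o<n {n = 2 ^ k} (subst (v <_) (*-comm 2 (2 ^ k)) v<)))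

  shiftRight-bits : ∀ k {v} m → v < 2 ^ k → shiftRight m (bits k v) ≡ bits k (v ≫ m)
  shiftRight-bits k {v} m v< = begin
    drop m (bits k v) ++ replicate (m ⊓ length (bits k v)) false ≡⟨ cong₂ (λ a b → a ++ replicate (m ⊓ b) false) (drop-bits k v m) (length-bits k v) ⟩
    bits (k ∸ m) (v ≫ m) ++ replicate (m ⊓ k) false              ≡⟨ bits-pad (k ∸ m) (m ⊓ k) (≫-bounded k m v<) ⟨
    bits (k ∸ m + m ⊓ k) (v ≫ m)                                 ≡⟨ cong (λ a → bits a (v ≫ m)) (trans (+-comm (k ∸ m) _) (m⊓n+n∸m≡n m k)) ⟩
    bits k (v ≫ m)                                               ∎
    where open ≡-Reasoning

  increment-bits : ∀ k {v} → suc v < 2 ^ k → increment (bits k v) ≡ bits k (suc v)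
  increment-bits zero    (s≤s ())
  increment-bits (suc k) {v} v< with v % 2 | m%n<n v 2 | m≡m%n+[m/n]*n v 2
  ... | suc (suc _) | s≤s (s≤s ()) | _
  ... | 0 | _ | eq = cong₂ _∷_ (sym (cong (_≡ᵇ 1) odd)) (cong (bits k) half)
    where
    odd : suc v % 2 ≡ 1
    odd = trans (cong (λ a → suc a % 2) eq) ([m+kn]%n≡m%n 1 (v / 2) 2)
    half : v / 2 ≡ suc v / 2
    half = sym (trans (cong (λ a → suc a / 2) eq) (trans (+-distrib-/-∣ʳ 1 {d = 2} (divides (v / 2) refl)) (m*n/n≡m (v / 2) 2)))
  ... | 1 | _ | eq = cong₂ _∷_ (sym (cong (_≡ᵇ 1) even)) (trans (increment-bits k {v / 2} bound) (cong (bits k) half))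
    where
    v+1≡ : suc v ≡ suc (v / 2) * 2
    v+1≡ = cong suc eq
    even : suc v % 2 ≡ 0
    even = trans (cong (_% 2) v+1≡) (m*n%n≡0 (suc (v / 2)) 2)
    half : suc (v / 2) ≡ suc v / 2
    half = sym (trans (cong (_/ 2) v+1≡) (m*n/n≡m (suc (v / 2)) 2))
    bound : suc (v / 2) < 2 ^ k
    bound = *-cancelʳ-< 2 (suc (v / 2)) (2 ^ k) (subst₂ _<_ v+1≡ (*-comm 2 (2 ^ k)) v<)

  -- Parsing and unique decoding of instances

  enc : ℕ → (s t r : String) → String
  enc n s t r = replicate n true ++ false ∷ delimit s ++ delimit t ++ r

  ones-replicate : ∀ n {y} → ones (replicate n true ++ false ∷ y) ≡ replicate n true
  ones-replicate zero    = refl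
  ones-replicate (suc n) = cong (true ∷_) (ones-replicate n)

  afterOnes-replicate : ∀ n {y} → afterOnes (replicate n true ++ false ∷ y) ≡ y
  afterOnes-replicate zero    = refl
  afterOnes-replicate (suc n) = afterOnes-replicate n

  payload-delimit : ∀ s {y} → payload (delimit s ++ y) ≡ s
  payload-delimit []      = refl
  payload-delimit (b ∷ s) = cong (b ∷_) (payload-delimit s)

  afterDelimited-delimit : ∀ s {y} → afterDelimited (delimit s ++ y) ≡ y
  afterDelimited-delimit []      = refl
  afterDelimited-delimit (b ∷ s) = afterDelimited-delimit s

  -- An empty remainder may also come from a string that breaks off; a nonempty one proves that the
  -- end marker was there, so that parsing lost nothing.
  ones-++ : ∀ y {a} → afterOnes y ≡ a → ¬ a ≡ [] → ones y ++ false ∷ a ≡ y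
  ones-++ []          refl a≢[] = ⊥-elim (a≢[] refl)
  ones-++ (false ∷ y) refl a≢[] = refl
  ones-++ (true ∷ y)  eq   a≢[] = cong (true ∷_) (ones-++ y eq a≢[])

  delimit-++ : ∀ y {a} → afterDelimited y ≡ a → ¬ a ≡ [] → delimit (payload y) ++ a ≡ y
  delimit-++ []             refl a≢[] = ⊥-elim (a≢[] refl)
  delimit-++ (false ∷ y)    refl a≢[] = refl
  delimit-++ (true ∷ [])    refl a≢[] = ⊥-elim (a≢[] refl)
  delimit-++ (true ∷ b ∷ y) eq   a≢[] = cong (λ y → true ∷ b ∷ y) (delimit-++ y eq a≢[])

  ones-are-ones : ∀ y → ones y ≡ replicate (length (ones y)) true
  ones-are-ones []          = refl
  ones-are-ones (false ∷ y) = refl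
  ones-are-ones (true ∷ y)  = cong (true ∷_) (ones-are-ones y)

  sizeℕ : String → ℕ
  sizeℕ y = length (ones y)

  restOf : String → String
  restOf y = afterDelimited (afterDelimited (afterOnes y))

  module _ (n : ℕ) (s t r : String) where

    sizeℕ-enc : sizeℕ (enc n s t r) ≡ n
    sizeℕ-enc = trans (cong length (ones-replicate n)) (List.length-replicate n)

    structureOf-enc : structureOf (enc n s t r) ≡ s
    structureOf-enc = trans (cong payload (afterOnes-replicate n)) (payload-delimit s)

    thresholdOf-enc : thresholdOf (enc n s t r) ≡ t
    thresholdOf-enc = trans (cong (payload ∘ afterDelimited) (afterOnes-replicate n))
      (trans (cong payload (afterDelimited-delimit s)) (payload-delimit t))

    restOf-enc : restOf (enc n s t r) ≡ r
    restOf-enc = trans (cong (afterDelimited ∘ afterDelimited) (afterOnes-replicate n))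
      (trans (cong afterDelimited (afterDelimited-delimit s)) (afterDelimited-delimit t))

  -- Applied to an input not yet known to be an instance, which is why `enc` takes raw strings. A
  -- nonempty last field certifies all markers before it.
  enc-restOf : ∀ y → ¬ restOf y ≡ [] → enc (sizeℕ y) (structureOf y) (thresholdOf y) (restOf y) ≡ y
  enc-restOf y r≢[] = begin
    replicate (sizeℕ y) true ++ false ∷ delimit (payload y₁) ++ delimit (payload y₂) ++ restOf y
      ≡⟨ cong (λ a → replicate (sizeℕ y) true ++ false ∷ delimit (payload y₁) ++ a) (delimit-++ y₂ refl r≢[]) ⟩
    replicate (sizeℕ y) true ++ false ∷ delimit (payload y₁) ++ y₂
      ≡⟨ cong (λ a → replicate (sizeℕ y) true ++ false ∷ a) (delimit-++ y₁ refl (λ eq → r≢[] (cong afterDelimited eq))) ⟩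
    replicate (sizeℕ y) true ++ false ∷ y₁
      ≡⟨ cong (_++ false ∷ y₁) (ones-are-ones y) ⟨
    ones y ++ false ∷ y₁
      ≡⟨ ones-++ y refl (λ eq → r≢[] (cong (afterDelimited ∘ afterDelimited) eq)) ⟩
    y ∎
    where
    open ≡-Reasoning
    y₁ = afterOnes y
    y₂ = afterDelimited y₁

  enc-injective : ∀ {n s t r n′ s′ t′ r′} → enc n s t r ≡ enc n′ s′ t′ r′ →
    n ≡ n′ × s ≡ s′ × t ≡ t′ × r ≡ r′
  enc-injective {n} {s} {t} {r} {n′} {s′} {t′} {r′} eq =
    project sizeℕ (sizeℕ-enc n s t r) (sizeℕ-enc n′ s′ t′ r′) ,
    project structureOf (structureOf-enc n s t r) (structureOf-enc n′ s′ t′ r′) ,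
    project thresholdOf (thresholdOf-enc n s t r) (thresholdOf-enc n′ s′ t′ r′) ,
    project restOf (restOf-enc n s t r) (restOf-enc n′ s′ t′ r′)
    where
    project : ∀ {A : Set} (f : String → A) {a b} → f (enc n s t r) ≡ a → f (enc n′ s′ t′ r′) ≡ b → a ≡ b
    project f p q = trans (sym p) (trans (cong f eq) q)

  fields : ∀ n {k} → Vec (Fin (2 ^ n)) k → String
  fields n w = List.concat (List.map (λ wᵢ → bits n (toℕ wᵢ)) (Vec.toList w))

  length-fields : ∀ n {k} (w : Vec (Fin (2 ^ n)) k) → length (fields n w) ≡ k * n
  length-fields n []                = refl
  length-fields n {suc k} (v ∷ w) = begin
    length (bits n (toℕ v) ++ fields n w)       ≡⟨ List.length-++ (bits n (toℕ v)) ⟩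
    length (bits n (toℕ v)) + length (fields n w) ≡⟨ cong₂ _+_ (length-bits n (toℕ v)) (length-fields n w) ⟩
    n + k * n                                 ∎
    where open ≡-Reasoning

  ++-split : ∀ {x x′ y y′ : String} → length x ≡ length x′ → x ++ y ≡ x′ ++ y′ → x ≡ x′ × y ≡ y′
  ++-split {[]}    {[]}     _  eq = refl , eq
  ++-split {b ∷ x} {b′ ∷ x′} l eq with refl , eq′ ← List.∷-injective eq
    with refl , q ← ++-split {x} {x′} (suc-injective l) eq′ = refl , q

  fields-injective : ∀ n {k} (w w′ : Vec (Fin (2 ^ n)) k) → fields n w ≡ fields n w′ → w ≡ w′
  fields-injective n []      []        _  = refl
  fields-injective n (v ∷ w) (v′ ∷ w′) eq
    with p , q ← ++-split {bits n (toℕ v)} {bits n (toℕ v′)} (trans (length-bits n _) (sym (length-bits n _))) eq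
    = cong₂ _∷_ (Fin.toℕ-injective (bits-injective n (Fin.toℕ<n v) (Fin.toℕ<n v′) p)) (fields-injective n w w′ q)

  bits-surjective : ∀ n {x} → length x ≡ n → ∃[ v ] bits n (toℕ {2 ^ n} v) ≡ x
  bits-surjective _ {x} refl = fromℕ< (number< x) ,
    trans (cong (bits (length x)) (Fin.toℕ-fromℕ< (number< x))) (bits-number x)

  fields-surjective : ∀ n k {r} → length r ≡ k * n → Σ (Vec (Fin (2 ^ n)) k) λ w → fields n w ≡ r
  fields-surjective n zero    {[]} _ = [] , refl
  fields-surjective n (suc k) {r} eq =
    let v , p = bits-surjective n {take n r} (trans (List.length-take n r) (m≤n⇒m⊓n≡m (≤-trans (m≤m+n n (k * n)) (≤-reflexive (sym eq)))))
        w , q = fields-surjective n k {drop n r} (trans (List.length-drop n r) (trans (cong (_∸ n) eq) (m+n∸m≡n n (k * n))))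
    in v ∷ w , trans (cong₂ _++_ p q) (List.take++drop≡id n r)

  -- The solver is analysed for any division into blocks; this identifies that division with the
  -- coefficients of the instance.
  Blocks-deterministic : ∀ {n r cs cs′} → Blocks n r cs → Blocks n r cs′ → cs ≡ cs′
  Blocks-deterministic []       []        = refl
  Blocks-deterministic (cut bs) (cut bs′) = cong (_ ∷_) (Blocks-deterministic bs bs′)

  take-length-++ : ∀ (d : String) {r} → take (length d) (d ++ r) ≡ d
  take-length-++ []      = refl
  take-length-++ (b ∷ d) = cong (b ∷_) (take-length-++ d)

  drop-length-++ : ∀ (d : String) {r} → drop (length d) (d ++ r) ≡ r
  drop-length-++ []      = refl
  drop-length-++ (b ∷ d) = drop-length-++ d

  cut-reverse : ∀ {n c r cs} → .{{NonZero n}} → length c ≡ n → Blocks n r cs → Blocks n (reverse c ++ r) (c ∷ cs)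
  cut-reverse {n} {c} {r} {cs} len bs = go (reverse c) (List.reverse-involutive c) (trans (List.length-reverse c) len)
    where
    go : ∀ d → reverse d ≡ c → length d ≡ n → Blocks n (d ++ r) (c ∷ cs)
    go []      _    refl = ⊥-elim (≢-nonZero⁻¹ 0 refl)
    go (b ∷ d) refl refl = subst (λ a → Blocks n (b ∷ d ++ r) (reverse a ∷ cs)) (take-length-++ (b ∷ d))
      (cut (subst (λ a → Blocks n a cs) (sym (drop-length-++ (b ∷ d))) bs))

  reversed : ∀ n {k} → Vec (Fin (2 ^ n)) k → List String
  reversed n w = List.map (λ wᵢ → bits n (toℕ wᵢ)) (Vec.toList w) ʳ++ []

  blocks-fields : ∀ n {k} → .{{NonZero n}} → (w : Vec (Fin (2 ^ n)) k) → Blocks n (reverse (fields n w)) (reversed n w)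
  blocks-fields n w = subst (λ a → Blocks n a (reversed n w)) (List.++-identityʳ (reverse (fields n w))) (go w [])
    where
    go : ∀ {k r cs} (w : Vec (Fin (2 ^ n)) k) → Blocks n r cs →
      Blocks n (reverse (fields n w) ++ r) (List.map (λ wᵢ → bits n (toℕ wᵢ)) (Vec.toList w) ʳ++ cs)
    go []      bs = bs
    go {r = r} (v ∷ w) bs = subst (λ a → Blocks n a _)
      (trans (sym (List.++-assoc (reverse (fields n w)) (reverse (bits n (toℕ v))) r))
             (cong (_++ r) (sym (List.reverse-++ (bits n (toℕ v)) (fields n w)))))
      (go w (cut-reverse (length-bits n (toℕ v)) bs))

  emitAll-reverse : ∀ f cs {ds out} → emitAll f (cs ʳ++ ds) out ≡ emitAll f ds (List.concat (List.map f cs) ++ out)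
  emitAll-reverse f []       = refl
  emitAll-reverse f (c ∷ cs) {ds} {out} = trans (emitAll-reverse f cs {c ∷ ds})
    (cong (emitAll f ds) (sym (List.++-assoc (f c) (List.concat (List.map f cs)) out)))

  -- Rounded coefficients and weights

  approx : Bool → ℕ → ℕ → ℕ
  approx false m v = v ≫ m
  approx true  m v = suc (v ≫ m)

  -- Reduction modulo `2ⁿ` makes the function total; for `1 ≤ m ≤ n` there is no overflow, by
  -- `toℕ-approxFin`.
  approxFin : ∀ n → Bool → ℕ → Fin (2 ^ n) → Fin (2 ^ n)
  approxFin n b m v = _mod_ (approx b m (toℕ v)) (2 ^ n) {{m^n≢0 2 n}}

  2^-suc∸ : ∀ {n m} → 1 ≤ m → m ≤ n → 2 * 2 ^ (n ∸ m) ≤ 2 ^ n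
  2^-suc∸ {n} {m} 1≤m m≤n = ^-monoʳ-≤ 2 (≤-trans (≤-reflexive (sym (+-∸-assoc 1 m≤n))) (∸-monoʳ-≤ {1} {m} (suc n) 1≤m))

  -- There remain `n ∸ m` leading bits, and adding 1 can cost one bit more. The bound serves twice:
  -- it rules out overflow, and it gives the magnitude of the coefficients in a query.
  approx-bounded : ∀ b {n m v} → m ≤ n → v < 2 ^ n → approx b m v < 2 * 2 ^ (n ∸ m)
  approx-bounded b {n} {m} {v} m≤n v< = ≤-<-trans (≤suc b) (begin-strict
    suc (v ≫ m)                   ≤⟨ ≫-bounded n m v< ⟩
    2 ^ (n ∸ m)                   <⟨ m<m*n (2 ^ (n ∸ m)) 2 {{m^n≢0 2 (n ∸ m)}} (s≤s (s≤s z≤n)) ⟩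
    2 ^ (n ∸ m) * 2               ≡⟨ *-comm (2 ^ (n ∸ m)) 2 ⟩
    2 * 2 ^ (n ∸ m)               ∎)
    where
    open ≤-Reasoning
    ≤suc : ∀ b → approx b m v ≤ suc (v ≫ m)
    ≤suc false = n≤1+n _
    ≤suc true  = ≤-refl

  module _ {n m : ℕ} (1≤m : 1 ≤ m) (m≤n : m ≤ n) where

    toℕ-approxFin : ∀ b (v : Fin (2 ^ n)) → toℕ (approxFin n b m v) ≡ approx b m (toℕ v)
    toℕ-approxFin b v = trans (Fin.toℕ-fromℕ< (m%n<n (approx b m (toℕ v)) (2 ^ n) {{m^n≢0 2 n}}))
      (m<n⇒m%n≡m {{m^n≢0 2 n}} (≤-trans (approx-bounded b m≤n (Fin.toℕ<n v)) (2^-suc∸ 1≤m m≤n)))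

    adjust-bits : ∀ b (v : Fin (2 ^ n)) → adjust b m (bits n (toℕ v)) ≡ bits n (toℕ (approxFin n b m v))
    adjust-bits false v = trans (shiftRight-bits n m (Fin.toℕ<n v)) (cong (bits n) (sym (toℕ-approxFin false v)))
    adjust-bits true  v = begin
      increment (shiftRight m (bits n (toℕ v))) ≡⟨ cong increment (shiftRight-bits n m (Fin.toℕ<n v)) ⟩
      increment (bits n (toℕ v ≫ m))            ≡⟨ increment-bits n (≤-trans (approx-bounded true m≤n (Fin.toℕ<n v)) (2^-suc∸ 1≤m m≤n)) ⟩
      bits n (suc (toℕ v ≫ m))                  ≡⟨ cong (bits n) (toℕ-approxFin true v) ⟨
      bits n (toℕ (approxFin n true m v))         ∎
      where open ≡-Reasoning

    adjust-fields : ∀ b {k} (w : Vec (Fin (2 ^ n)) k) →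
      List.concat (List.map (adjust b m) (List.map (λ wᵢ → bits n (toℕ wᵢ)) (Vec.toList w))) ≡ fields n (Vec.map (approxFin n b m) w)
    adjust-fields b []      = refl
    adjust-fields b (v ∷ w) = cong₂ _++_ (adjust-bits b v) (adjust-fields b w)

    emitAll-fields : ∀ b {k} (w : Vec (Fin (2 ^ n)) k) →
      emitAll (adjust b m) (reversed n w) [] ≡ fields n (Vec.map (approxFin n b m) w)
    emitAll-fields b w = trans (emitAll-reverse (adjust b m) (List.map (λ wᵢ → bits n (toℕ wᵢ)) (Vec.toList w)))
      (trans (List.++-identityʳ _) (adjust-fields b w))

  weightℕ : ∀ {k} → Vec ℕ k → Vec Bool k → ℕ
  weightℕ u x = Vec.sum (Vec.zipWith (λ uᵢ xᵢ → if xᵢ then uᵢ else 0) u x)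

  weight-toℕ : ∀ {n} (w : Vec (Fin (2 ^ n)) n) x → weight w x ≡ weightℕ (Vec.map toℕ w) x
  weight-toℕ w x = cong Vec.sum (sym (Vec.zipWith-map₁ (λ uᵢ xᵢ → if xᵢ then uᵢ else 0) toℕ w x))

  weight-approx : ∀ {n m} → 1 ≤ m → m ≤ n → ∀ b (w : Vec (Fin (2 ^ n)) n) x →
    weight (Vec.map (approxFin n b m) w) x ≡ weightℕ (Vec.map (approx b m) (Vec.map toℕ w)) x
  weight-approx {n} {m} 1≤m m≤n b w x = trans (weight-toℕ (Vec.map (approxFin n b m) w) x) (cong (λ u → weightℕ u x) (begin
    Vec.map toℕ (Vec.map (approxFin n b m) w)  ≡⟨ Vec.map-∘ toℕ (approxFin n b m) w ⟨
    Vec.map (toℕ ∘ approxFin n b m) w          ≡⟨ Vec.map-cong (toℕ-approxFin 1≤m m≤n b) w ⟩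
    Vec.map (approx b m ∘ toℕ) w             ≡⟨ Vec.map-∘ (approx b m) toℕ w ⟩
    Vec.map (approx b m) (Vec.map toℕ w)     ∎))
    where open ≡-Reasoning

  weight-lower : ∀ {k} m (u : Vec ℕ k) x → 2 ^ m * weightℕ (Vec.map (_≫ m) u) x ≤ weightℕ u x
  weight-lower m []      []          = ≤-reflexive (*-zeroʳ (2 ^ m))
  weight-lower m (v ∷ u) (false ∷ x) = weight-lower m u x
  weight-lower m (v ∷ u) (true ∷ x)  = ≤-trans (≤-reflexive (*-distribˡ-+ (2 ^ m) (v ≫ m) _))
    (+-mono-≤ (≫-lower v m) (weight-lower m u x))

  weight-upper : ∀ {k} m (u : Vec ℕ k) x → weightℕ u x ≤ 2 ^ m * weightℕ (Vec.map (approx true m) u) x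
  weight-upper m []      []          = z≤n
  weight-upper m (v ∷ u) (false ∷ x) = weight-upper m u x
  weight-upper m (v ∷ u) (true ∷ x)  = ≤-trans (+-mono-≤ (<⇒≤ (≫-upper v m)) (weight-upper m u x))
    (≤-reflexive (sym (*-distribˡ-+ (2 ^ m) (suc (v ≫ m)) _)))

  -- Each chosen item gains 1, and there are at most `k` of them. This is the source of the window
  -- width.
  weight-gap : ∀ {k} m (u : Vec ℕ k) x → weightℕ (Vec.map (approx true m) u) x ≤ weightℕ (Vec.map (_≫ m) u) x + k
  weight-gap m []      []          = z≤n
  weight-gap {suc k} m (v ∷ u) (false ∷ x) = ≤-trans (weight-gap m u x) (+-monoʳ-≤ (weightℕ (Vec.map (_≫ m) u) x) (n≤1+n k))
  weight-gap {suc k} m (v ∷ u) (true ∷ x)  = begin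
    suc (v ≫ m) + weightℕ (Vec.map (approx true m) u) x      ≤⟨ +-monoʳ-≤ (suc (v ≫ m)) (weight-gap m u x) ⟩
    suc (v ≫ m) + (weightℕ (Vec.map (_≫ m) u) x + k)         ≡⟨ +-assoc (suc (v ≫ m)) _ k ⟨
    suc ((v ≫ m) + weightℕ (Vec.map (_≫ m) u) x + k)         ≡⟨ +-suc _ k ⟨
    (v ≫ m) + weightℕ (Vec.map (_≫ m) u) x + suc k           ∎
    where open ≤-Reasoning

  -- Correctness

  query-enc : ∀ {k} b y m cs → query {k} b (sizeOf y) (structureOf y) (thresholdOf y) m cs ≡
    enc (sizeℕ y) (structureOf y) (shiftRight (length m) (thresholdOf y)) (emitAll (adjust b (length m)) cs [])
  query-enc b y m cs = trans (reverse-twice (ones y)) (cong (λ a → a ++ false ∷ delimit (structureOf y) ++ delimit (shiftRight (length m) (thresholdOf y))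
      ++ emitAll (adjust b (length m)) cs []) (ones-are-ones y))

  module _ (Π : BinaryProblem) where
    open BinaryProblem Π

    thresholdLength : ℕ → ℕ
    thresholdLength n = poly thresholdDegree n

    shifted : ∀ {n} → ℕ → Threshold n → Threshold n
    shifted {n} m t = _mod_ (toℕ t ≫ m) (2 ^ thresholdLength n) {{m^n≢0 2 (thresholdLength n)}}

    ≫-threshold : ∀ {n} m (t : Threshold n) → toℕ t ≫ m < 2 ^ thresholdLength n
    ≫-threshold {n} m t = ≤-trans (≫-bounded (thresholdLength n) m (Fin.toℕ<n t)) (^-monoʳ-≤ 2 (m∸n≤m (thresholdLength n) m))

    toℕ-shifted : ∀ {n} m (t : Threshold n) → toℕ (shifted m t) ≡ toℕ t ≫ m
    toℕ-shifted {n} m t = trans (Fin.toℕ-fromℕ< (m%n<n (toℕ t ≫ m) (2 ^ thresholdLength n) {{m^n≢0 2 (thresholdLength n)}}))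
      (m<n⇒m%n≡m {{m^n≢0 2 (thresholdLength n)}} (≫-threshold m t))

    encode-injective : ∀ {n s w t n′ s′ w′ t′} → encode Π n s w t ≡ encode Π n′ s′ w′ t′ →
      _≡_ {A = Σ ℕ λ n → String × Coefficients n × Threshold n} (n , s , w , t) (n′ , s′ , w′ , t′)
    encode-injective {n} {s} {w} {t} {n′} {s′} {w′} {t′} eq
      with refl , refl , p , q ← enc-injective {n} {s} {r = fields n w} {n′} {s′} {r′ = fields n′ w′} eq
      with refl ← Fin.toℕ-injective (bits-injective (thresholdLength n) (Fin.toℕ<n t) (Fin.toℕ<n t′) p)
      with refl ← fields-injective n w w′ q = refl

    sizeℕ-encode : ∀ n s w t → sizeℕ (encode Π n s w t) ≡ n
    sizeℕ-encode n s w t = sizeℕ-enc n s (bits (thresholdLength n) (toℕ t)) (fields n w)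

    Solvable : ∀ n → String → Coefficients n → Threshold n → Set
    Solvable n s w t = ∃[ x ] Feasible n s x × weight w x ≤ toℕ t

    -- Membership only provides some decoding; `encode-injective` makes it the given one.
    language-encode : ∀ {n s w t} → Language Π (encode Π n s w t) → IsStructure n s × Solvable n s w t
    language-encode {n} {s} {w} {t} (n′ , _ , s′ , w′ , t′ , structure , eq , solvable)
      with refl ← encode-injective {n} {s} {w} {t} {n′} {s′} {w′} {t′} eq = structure , solvable

    module _ {n m : ℕ} (1≤m : 1 ≤ m) (m≤n : m ≤ n) (w : Coefficients n) (t : Threshold n) where

      roundUp-sound : ∀ x → weight (Vec.map (approxFin n true m) w) x ≤ toℕ (shifted m t) → weight w x ≤ toℕ t
      roundUp-sound x w≤ = begin
        weight w x                                                 ≡⟨ weight-toℕ w x ⟩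
        weightℕ (Vec.map toℕ w) x                                  ≤⟨ weight-upper m (Vec.map toℕ w) x ⟩
        2 ^ m * weightℕ (Vec.map (approx true m) (Vec.map toℕ w)) x ≡⟨ cong (2 ^ m *_) (weight-approx 1≤m m≤n true w x) ⟨
        2 ^ m * weight (Vec.map (approxFin n true m) w) x          ≤⟨ *-monoʳ-≤ (2 ^ m) w≤ ⟩
        2 ^ m * toℕ (shifted m t)                                  ≡⟨ cong (2 ^ m *_) (toℕ-shifted m t) ⟩
        2 ^ m * (toℕ t ≫ m)                                        ≤⟨ ≫-lower (toℕ t) m ⟩
        toℕ t                                                      ∎
        where open ≤-Reasoning

      roundDown-complete : ∀ x → weight w x ≤ toℕ t → weight (Vec.map (approxFin n false m) w) x ≤ toℕ (shifted m t)
      roundDown-complete x w≤ = begin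
        weight (Vec.map (approxFin n false m) w) x          ≡⟨ weight-approx 1≤m m≤n false w x ⟩
        weightℕ (Vec.map (_≫ m) (Vec.map toℕ w)) x          ≤⟨ ≫-greatest {toℕ t} {m} (≤-trans (weight-lower m (Vec.map toℕ w) x) (≤-trans (≤-reflexive (sym (weight-toℕ w x))) w≤)) ⟩
        toℕ t ≫ m                                           ≡⟨ toℕ-shifted m t ⟨
        toℕ (shifted m t)                                   ∎
        where open ≤-Reasoning

    query-encode : ∀ {k n s w t} → .{{NonZero n}} → ∀ b {y m cs} → 1 ≤ length m → length m ≤ n → y ≡ encode Π n s w t →
      Blocks (length (sizeOf y)) (coefficientsOf y) cs →
      query {k} b (sizeOf y) (structureOf y) (thresholdOf y) m cs
        ≡ encode Π n s (Vec.map (approxFin n b (length m)) w) (shifted (length m) t)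
    query-encode {k} {n} {s} {w} {t} b {y} {m} {cs} 1≤m m≤n refl bs = begin
      query {k} b (sizeOf y) (structureOf y) (thresholdOf y) m cs
        ≡⟨ query-enc {k} b y m cs ⟩
      enc (sizeℕ y) (structureOf y) (shiftRight (length m) (thresholdOf y)) (emitAll (adjust b (length m)) cs [])
        ≡⟨ cong₂ (λ n s → enc n s (shiftRight (length m) (thresholdOf y)) (emitAll (adjust b (length m)) cs [])) size (structureOf-enc n s tb (fields n w)) ⟩
      enc n s (shiftRight (length m) (thresholdOf y)) (emitAll (adjust b (length m)) cs [])
        ≡⟨ cong₂ (enc n s) threshold coefficients ⟩
      enc n s (bits (thresholdLength n) (toℕ (shifted (length m) t))) (fields n (Vec.map (approxFin n b (length m)) w)) ∎
      where
      open ≡-Reasoning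
      tb : String
      tb = bits (thresholdLength n) (toℕ t)
      size : sizeℕ y ≡ n
      size = sizeℕ-enc n s tb (fields n w)
      threshold : shiftRight (length m) (thresholdOf y) ≡ bits (thresholdLength n) (toℕ (shifted (length m) t))
      threshold = trans (cong (shiftRight (length m)) (thresholdOf-enc n s tb (fields n w)))
        (trans (shiftRight-bits (thresholdLength n) (length m) (Fin.toℕ<n t))
          (cong (bits (thresholdLength n)) (sym (toℕ-shifted (length m) t))))
      determined : cs ≡ reversed n w
      determined = Blocks-deterministic
        (subst₂ (λ n r → Blocks n (reverse r) cs) (trans (List.length-reverse (ones y)) size) (restOf-enc n s tb (fields n w)) bs)
        (blocks-fields n w)
      coefficients : emitAll (adjust b (length m)) cs [] ≡ fields n (Vec.map (approxFin n b (length m)) w)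
      coefficients = trans (cong (λ cs → emitAll (adjust b (length m)) cs []) determined) (emitAll-fields 1≤m m≤n b w)

    -- Guards against accepting an ill-formed string. Rounding preserves lengths, so a query that is
    -- an instance forces the right lengths on the input, and the `n * n > 0` coefficient bits show
    -- that parsing did not run off the end.
    well-formed : ∀ {k n s w t} → .{{NonZero n}} → ∀ b {y m cs} → Blocks (length (sizeOf y)) (coefficientsOf y) cs →
      query {k} b (sizeOf y) (structureOf y) (thresholdOf y) m cs ≡ encode Π n s w t →
      ∃[ w′ ] ∃[ t′ ] y ≡ encode Π n s w′ t′
    well-formed {k} {n} {s} {w} {t} b {y} {m} {cs} bs eq
      with refl , refl , p , q ← enc-injective {sizeℕ y} {structureOf y} {shiftRight (length m) (thresholdOf y)} {emitAll (adjust b (length m)) cs []} {n′ = n} {s} {r′ = fields n w} (trans (sym (query-enc {k} b y m cs)) eq) =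
      let t′ , p′ = bits-surjective (thresholdLength n) {thresholdOf y} (begin
            length (thresholdOf y)                         ≡⟨ length-shiftRight (length m) (thresholdOf y) ⟨
            length (shiftRight (length m) (thresholdOf y)) ≡⟨ cong length p ⟩
            length (bits (thresholdLength n) (toℕ t))      ≡⟨ length-bits (thresholdLength n) (toℕ t) ⟩
            thresholdLength n                              ∎)
          w′ , q′ = fields-surjective n n rest
      in w′ , t′ , (begin
        y                                                        ≡⟨ enc-restOf y nonempty ⟨
        enc n s (thresholdOf y) (restOf y)                       ≡⟨ cong₂ (enc n s) p′ q′ ⟨
        encode Π n s w′ t′                                       ∎)
      where
      open ≡-Reasoning
      rest : length (restOf y) ≡ n * n
      rest = begin
        length (restOf y)                                ≡⟨ List.length-reverse (restOf y) ⟨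
        length (coefficientsOf y)                        ≡⟨ +-identityʳ _ ⟨
        length (coefficientsOf y) + 0                    ≡⟨ length-emitAll (adjust b (length m)) (length-adjust b (length m)) bs [] ⟨
        length (emitAll (adjust b (length m)) cs [])     ≡⟨ cong length q ⟩
        length (fields n w)                              ≡⟨ length-fields n w ⟩
        n * n                                            ∎
      nonempty : ¬ restOf y ≡ []
      nonempty eq = ≢-nonZero⁻¹ (n * n) {{m*n≢0 n n}} (trans (sym rest) (cong length eq))

    module Solver {k : ℕ} (P : Prog (suc k)) (time : String → ℕ)
                  (decides : Decides P (λ y → y ∷ Vec.replicate k []) (Language Π) time) where

      open Decides decides
      open Oracle P final time halts public

      verdict-correct : ∀ q → verdict q ≡ true ⇔ Language Π q
      verdict-correct q = correct q ⇔-∘ heads-head (Vec.head (final q))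

      module _ (y : String) (cs : List String) (bs : CoefficientBlocks y cs) where

        query-of : Bool → String → String
        query-of b m = query {k} b (sizeOf y) (structureOf y) (thresholdOf y) m cs

        accept-sound : ∀ m → 1 ≤ length m → length m ≤ length (sizeOf y) → verdict (query-of true m) ≡ true → Language Π y
        accept-sound m 1≤m m≤ accepted
          with n , nz , s , w , t , structure , eq , _ ← Equivalence.to (verdict-correct (query-of true m)) accepted
          with w′ , t′ , y≡ ← well-formed {k} {n} {s} {w} {t} {{nz}} true {m = m} (bs (>-nonZero (≤-trans 1≤m m≤))) eq =
          let m≤n = ≤-trans m≤ (≤-reflexive (trans (List.length-reverse (ones y)) (trans (cong sizeℕ y≡) (sizeℕ-encode n s w′ t′))))
              -- The first decoding of the accepted query names its own coefficients `w`; decoding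
              -- it again as the rounding of `w′` yields a solution that can be carried over to
              -- `w′`.
              _ , x , feasible , w≤ = language-encode {n} {s} {Vec.map (approxFin n true (length m)) w′} {shifted (length m) t′} (subst (Language Π)
                (query-encode {k} {n} {s} {w′} {t′} {{nz}} true {m = m} 1≤m m≤n y≡ (bs (>-nonZero (≤-trans 1≤m m≤))))
                (Equivalence.to (verdict-correct (query-of true m)) accepted))
          in n , nz , s , w′ , t′ , structure , y≡ , x , feasible , roundUp-sound 1≤m m≤n w′ t′ x w≤

        -- Stated positively for members of the language: a refusal then excludes membership for
        -- every string, well-formed or not.
        reject-sound : ∀ m → 1 ≤ length m → length m ≤ length (sizeOf y) → Language Π y → verdict (query-of false m) ≡ true
        reject-sound m 1≤m m≤ (n , nz , s , w , t , structure , y≡ , x , feasible , w≤) =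
          Equivalence.from (verdict-correct (query-of false m))
            (n , nz , s , Vec.map (approxFin n false (length m)) w , shifted (length m) t , structure ,
              query-encode {k} {n} {s} {w} {t} {{nz}} false {m = m} 1≤m m≤n y≡ (bs (>-nonZero (≤-trans 1≤m m≤))) ,
              x , feasible , roundDown-complete 1≤m m≤n w t x w≤)
          where
          m≤n : length m ≤ n
          m≤n = ≤-trans m≤ (≤-reflexive (trans (List.length-reverse (ones y)) (trans (cong sizeℕ y≡) (sizeℕ-encode n s w t))))

        answer-correct : answer y cs bs ≡ true ⇔ Language Π y
        answer-correct = go (sizeOf y) ≤-refl
          where
          go : ∀ m → length m ≤ length (sizeOf y) → fromMaybe (verdict y) (outcome y cs bs m) ≡ true ⇔ Language Π y
          go []      _  = verdict-correct y
          go (b ∷ m) m≤ with verdict (query-of true (b ∷ m)) in eq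
          ... | true = mk⇔ (λ _ → accept-sound (b ∷ m) (s≤s z≤n) m≤ eq) (λ _ → refl)
          ... | false with verdict (query-of false (b ∷ m)) in eq′
          ...   | true  = go m (≤-trans (n≤1+n _) m≤)
          ...   | false = mk⇔ (λ ()) (λ l → trans (sym eq′) (reject-sound (b ∷ m) (s≤s z≤n) m≤ l))

  -- Running time

  -- Wrapped in a record so that `A` and `a` can be inferred. In the bounds below both are solved by
  -- unification outside the quantifiers over instances, hence are uniform.
  record PolyBound (u x A a : ℕ) : Set where
    constructor polyBound
    field
      proof : x ≤ A * u ^ a

  open PolyBound

  module _ {u : ℕ} .{{_ : NonZero u}} where

    infixl 6 _⊕_
    infixl 7 _⊗_

    -- Exponents are added instead of maximized, which is coarse but sound for `u ≥ 1` and leaves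
    -- them in the same form as for products.
    _⊕_ : ∀ {x A a y B b} → PolyBound u x A a → PolyBound u y B b → PolyBound u (x + y) (A + B) (a + b)
    _⊕_ {x} {A} {a} {y} {B} {b} (polyBound p) (polyBound q) = polyBound (begin
      x + y                                    ≤⟨ +-mono-≤ p q ⟩
      A * u ^ a + B * u ^ b                    ≤⟨ +-mono-≤ (*-monoʳ-≤ A (^-monoʳ-≤ u (m≤m+n a b))) (*-monoʳ-≤ B (^-monoʳ-≤ u (m≤n+m b a))) ⟩
      A * u ^ (a + b) + B * u ^ (a + b)        ≡⟨ *-distribʳ-+ (u ^ (a + b)) A B ⟨
      (A + B) * u ^ (a + b)                    ∎)
      where open ≤-Reasoning

    _⊗_ : ∀ {x A a y B b} → PolyBound u x A a → PolyBound u y B b → PolyBound u (x * y) (A * B) (a + b)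
    _⊗_ {x} {A} {a} {y} {B} {b} (polyBound p) (polyBound q) = polyBound (begin
      x * y                          ≤⟨ *-mono-≤ p q ⟩
      (A * u ^ a) * (B * u ^ b)      ≡⟨ [m*n]*[o*p]≡[m*o]*[n*p] A (u ^ a) B (u ^ b) ⟩
      (A * B) * (u ^ a * u ^ b)      ≡⟨ cong (A * B *_) (^-distribˡ-+-* u a b) ⟨
      (A * B) * u ^ (a + b)          ∎)
      where open ≤-Reasoning

    ⟦_⟧ : ∀ n → PolyBound u n n 0
    ⟦ n ⟧ = polyBound (≤-reflexive (sym (*-identityʳ n)))

    base : PolyBound u u 1 1
    base = polyBound (≤-reflexive (sym (trans (*-identityˡ (u ^ 1)) (*-identityʳ u))))

    power : ∀ {x A a} k → PolyBound u x A a → PolyBound u (x ^ k) (A ^ k) (a * k)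
    power {x} {A} {a} k (polyBound p) = polyBound (begin
      x ^ k                    ≤⟨ ^-monoˡ-≤ k p ⟩
      (A * u ^ a) ^ k          ≡⟨ ^-distribʳ-* k A (u ^ a) ⟩
      A ^ k * (u ^ a) ^ k      ≡⟨ cong (A ^ k *_) (^-*-assoc u a k) ⟩
      A ^ k * u ^ (a * k)      ∎)
      where
      open ≤-Reasoning
      ^-distribʳ-* : ∀ k x y → (x * y) ^ k ≡ x ^ k * y ^ k
      ^-distribʳ-* zero    x y = refl
      ^-distribʳ-* (suc k) x y = trans (cong (x * y *_) (^-distribʳ-* k x y)) ([m*n]*[o*p]≡[m*o]*[n*p] x y (x ^ k) (y ^ k))

    below : ∀ {x y A a} → x ≤ y → PolyBound u y A a → PolyBound u x A a
    below x≤y (polyBound p) = polyBound (≤-trans x≤y p)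

    -- A single power, with base a multiple of `u` and nonzero exponent, is what a root can undo
    -- later.
    asPower : ∀ {x A a} → PolyBound u x A a → x ≤ (suc A * u) ^ suc a
    asPower {x} {A} {a} (polyBound p) = begin
      x                        ≤⟨ p ⟩
      A * u ^ a                ≤⟨ *-mono-≤ (≤-trans (n≤1+n A) (m≤m*n (suc A) u)) (^-monoˡ-≤ a (m≤n*m u (suc A))) ⟩
      (suc A * u) ^ suc a      ∎
      where open ≤-Reasoning

  length-delimit : ∀ s → length (delimit s) ≡ 1 + 2 * length s
  length-delimit []      = refl
  length-delimit (b ∷ s) = trans (cong (2 +_) (length-delimit s))
    (cong suc (sym (trans (*-suc 2 (length s)) refl)))

  indicator : Bool → ℕ
  indicator b = if b then 1 else 0

  module _ (Π : BinaryProblem) where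
    open BinaryProblem Π

    length-encode : ∀ n s w t → length (encode Π n s w t) ≡
      n + (1 + ((1 + 2 * length s) + ((1 + 2 * thresholdLength Π n) + n * n)))
    length-encode n s w t = begin
      length (replicate n true ++ _)                          ≡⟨ List.length-++ (replicate n true) ⟩
      length (replicate n true) + suc (length (delimit s ++ _))
        ≡⟨ cong₂ (λ a b → a + suc b) (List.length-replicate n) (List.length-++ (delimit s)) ⟩
      n + suc (length (delimit s) + length (delimit tb ++ fields n w))
        ≡⟨ cong₂ (λ a b → n + suc (a + b)) (length-delimit s) (List.length-++ (delimit tb)) ⟩
      n + suc (1 + 2 * length s + (length (delimit tb) + length (fields n w)))
        ≡⟨ cong₂ (λ a b → n + suc (1 + 2 * length s + (a + b)))
             (trans (length-delimit tb) (cong (λ a → 1 + 2 * a) (length-bits (thresholdLength Π n) (toℕ t)))) (length-fields n w) ⟩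
      _ ∎
      where
      open ≡-Reasoning
      tb = bits (thresholdLength Π n) (toℕ t)

    module Timing {k : ℕ} (P : Prog (suc k)) (time : String → ℕ)
                  (decides : Decides P (λ y → y ∷ Vec.replicate k []) (Language Π) time)
                  (c C : ℕ)
                  (fast : ∀ n → NonZero n → ∀ s w t → IsStructure n s → ∀ b → All (λ wᵢ → toℕ wᵢ < 2 ^ b) w →
                          time (encode Π n s w t) ≤ C * (n * 2 ^ b) ^ c) where

      open Solver Π P time decides

      module _ (n : ℕ) (s : String) (w : Coefficients n) (t : Threshold n) where

        rounded : Bool → ℕ → String
        rounded b m = encode Π n s (Vec.map (approxFin n b m) w) (shifted Π m t)

        undecided : ℕ → Bool
        undecided m = not (verdict (rounded true m)) ∧ verdict (rounded false m)

        -- the number of leading bits inspected from level b on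
        level : ℕ → ℕ → ℕ
        level zero    b = b
        level (suc m) b = if undecided (suc m) then level m (suc b) else b

        level-≥ : ∀ m b → b ≤ level m b
        level-≥ zero    b = ≤-refl
        level-≥ (suc m) b with undecided (suc m)
        ... | true  = ≤-trans (n≤1+n b) (level-≥ m (suc b))
        ... | false = ≤-refl

        -- The summand for `suc m` is 2 to the number of leading bits that the next round inspects.
        -- Being a weighted sum of indicators, it can be averaged term by term.
        undecidedSum : ℕ → ℕ
        undecidedSum zero    = 0
        undecidedSum (suc m) = indicator (undecided (suc m)) * 2 ^ (n ∸ m) + undecidedSum m

        -- Each step trades `2 ^ b` for the summand of the current round, which is `2 ^ suc b`
        -- because `b + suc m ≡ n`. In effect the last undecided round alone pays for the level.
        2^level : ∀ m b → b + m ≡ n → 2 ^ level m b ≤ 2 ^ b + undecidedSum m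
        2^level zero    b eq = m≤m+n _ _
        2^level (suc m) b eq with undecided (suc m)
        ... | false = m≤m+n _ _
        ... | true  = begin
          2 ^ level m (suc b)                                ≤⟨ 2^level m (suc b) (trans (sym (+-suc b m)) eq) ⟩
          2 ^ suc b + undecidedSum m                         ≡⟨ cong (λ a → 2 ^ a + undecidedSum m) (trans (sym (m+n∸n≡m (suc b) m)) (cong (_∸ m) (trans (sym (+-suc b m)) eq))) ⟩
          2 ^ (n ∸ m) + undecidedSum m                       ≤⟨ m≤n+m _ (2 ^ b) ⟩
          2 ^ b + (2 ^ (n ∸ m) + undecidedSum m)             ≡⟨ cong (λ a → 2 ^ b + (a + undecidedSum m)) (sym (+-identityʳ (2 ^ (n ∸ m)))) ⟩
          2 ^ b + (2 ^ (n ∸ m) + 0 + undecidedSum m)         ∎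
          where open ≤-Reasoning

      abstract
        ℓ-bound : ∃[ A ] ∃[ a ] ∀ {n s w t u} → .{{_ : NonZero u}} → IsStructure n s → n ≤ u →
          PolyBound u (2 + length (encode Π n s w t)) A a
        ℓ-bound = _ , _ , λ {n} {s} {w} {t} {u} structure n≤u →
          let n≼ = below n≤u base
          in ⟦ 2 ⟧ ⊕ below (≤-reflexive (length-encode n s w t))
            (n≼ ⊕ (⟦ 1 ⟧ ⊕ ((⟦ 1 ⟧ ⊕ ⟦ 2 ⟧ ⊗ below (structure-length structure) (power structureDegree n≼ ⊕ ⟦ structureDegree ⟧))
              ⊕ ((⟦ 1 ⟧ ⊕ ⟦ 2 ⟧ ⊗ (power thresholdDegree n≼ ⊕ ⟦ thresholdDegree ⟧)) ⊕ n≼ ⊗ n≼))))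

      abstract
        -- The factor 2 leaves room for the extra bit that rounding up may need.
        ask-bound : ∃[ A ] ∃[ a ] ∀ {n s w t u b} → .{{_ : NonZero u}} → NonZero n → IsStructure n s →
          All (λ wᵢ → toℕ wᵢ < 2 ^ b) w → n * 2 ^ b ≤ 2 * u → n ≤ u →
          PolyBound u (askCost (encode Π n s w t)) A a
        ask-bound = _ , _ , λ {n} {s} {w} {t} {u} {b} nz structure small u≤ n≤u →
          let time≼ = below (fast n nz s w t structure b small) (⟦ C ⟧ ⊗ power c (below u≤ (⟦ 2 ⟧ ⊗ base)))
              length≼ = below (m≤n+m (length (encode Π n s w t)) 2) (proj₂ (proj₂ ℓ-bound) {w = w} {t} structure n≤u)
          in time≼ ⊕ (⟦ 2 ⟧ ⊕ (⟦ 1 ⟧ ⊕ ⟦ suc k ⟧ ⊗ (⟦ 1 ⟧ ⊕ (length≼ ⊕ time≼) ⊗ ⟦ 2 ⟧)))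

      finishCost : ℕ → Maybe Bool → ℕ
      finishCost T o = if ⌊ Maybe.≡-dec Bool._≟_ o nothing ⌋ then T else 2

      abstract
        -- The 4 covers what a loop ending with this round adds: its loop test, the test that ends
        -- the loop, and two steps of `finish`.
        round-bound : ∃[ A ] ∃[ a ] ∀ {n s w t cs bs m b} → .{{_ : NonZero (n * 2 ^ b)}} → NonZero n → IsStructure n s →
          1 ≤ length m → b + length m ≡ n →
          PolyBound (n * 2 ^ b) (roundCost (encode Π n s w t) cs bs m + 4) A a
        round-bound = _ , _ , λ {n} {s} {w} {t} {cs} {bs} {m} {b} nz structure 1≤m eq →
          let y = encode Π n s w t
              m≤n = ≤-trans (m≤n+m (length m) b) (≤-reflexive eq)
              n≤u = m≤m*n n (2 ^ b) {{m^n≢0 2 b}}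
              size≢0 = >-nonZero (≤-trans (>-nonZero⁻¹ n {{nz}}) (≤-reflexive (sym (trans (List.length-reverse (ones y)) (sizeℕ-encode Π n s w t)))))
              b≡ = trans (sym (m+n∸n≡m b (length m))) (cong (_∸ length m) eq)
              small : ∀ β → All (λ wᵢ → toℕ wᵢ < 2 ^ suc b) (Vec.map (approxFin n β (length m)) w)
              small β = All.map⁺ (All.universal (λ v → subst₂ _<_ (sym (toℕ-approxFin 1≤m m≤n β v)) (cong (λ b → 2 * 2 ^ b) (sym b≡))
                          (approx-bounded β m≤n (Fin.toℕ<n v))) w)
              asked : ∀ β → PolyBound (n * 2 ^ b) (askCost (query-of y cs bs β m)) (proj₁ ask-bound) (proj₁ (proj₂ ask-bound))
              asked β = below (≤-reflexive (cong askCost (query-encode Π {k} {n} {s} {w} {t} {{nz}} β {y} {m} 1≤m m≤n refl (bs size≢0))))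
                (proj₂ (proj₂ ask-bound) {b = suc b} nz structure (small β) (≤-reflexive (trans (sym (*-assoc n 2 (2 ^ b))) (trans (cong (_* 2 ^ b) (*-comm n 2)) (*-assoc 2 n (2 ^ b))))) n≤u)
              ℓ≼ = proj₂ (proj₂ ℓ-bound) {w = w} {t} structure n≤u
              built = ⟦ κ ⟧ ⊗ (ℓ≼ ⊗ ℓ≼)
          in ((built ⊕ asked true) ⊕ (⟦ 1 ⟧ ⊕ ((built ⊕ asked false) ⊕ (⟦ 1 ⟧ ⊕ (⟦ 2 ⟧ ⊕ ⟦ 2 ⟧ ⊗ ℓ≼))))) ⊕ ⟦ 4 ⟧

      abstract
        -- The original instance has `n`-bit coefficients, which matches the level `n` of a loop
        -- that decided nothing. The leading 1 is the last loop test.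
        finish-bound : ∃[ A ] ∃[ a ] ∀ {n s w t} → .{{_ : NonZero (n * 2 ^ n)}} → NonZero n → IsStructure n s →
          let y = encode Π n s w t in
          PolyBound (n * 2 ^ n) (1 + (1 + (10 * (2 + length y) + (askCost y + 2)))) A a
        finish-bound = _ , _ , λ {n} {s} {w} {t} nz structure →
          let n≤u = m≤m*n n (2 ^ n) {{m^n≢0 2 n}}
          in ⟦ 1 ⟧ ⊕ (⟦ 1 ⟧ ⊕ (⟦ 10 ⟧ ⊗ proj₂ (proj₂ ℓ-bound) {w = w} {t} structure n≤u
               ⊕ (proj₂ (proj₂ ask-bound) {b = n} nz structure (All.universal Fin.toℕ<n w) (m≤n*m (n * 2 ^ n) 2) n≤u ⊕ ⟦ 2 ⟧)))

      module _ {n : ℕ} {s : String} {w : Coefficients n} {t : Threshold n} (nz : NonZero n) (structure : IsStructure n s) (cs : List String)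
               (bs : CoefficientBlocks (encode Π n s w t) cs) where

        private
          y : String
          y = encode Π n s w t
          T : ℕ
          T = suc (10 * (2 + length y) + (askCost y + 2))
          A a : ℕ
          A = proj₁ round-bound + proj₁ finish-bound
          a = proj₁ (proj₂ round-bound) + proj₁ (proj₂ finish-bound)
          X : ℕ → ℕ
          X b = A * (n * 2 ^ b) ^ a
          u≢0 : ∀ b → NonZero (n * 2 ^ b)
          u≢0 b = m*n≢0 n (2 ^ b) {{nz}} {{m^n≢0 2 b}}
          X-mono : ∀ {b b′} → b ≤ b′ → X b ≤ X b′
          X-mono b≤ = *-monoʳ-≤ A (^-monoˡ-≤ a (*-monoʳ-≤ n (^-monoʳ-≤ 2 b≤)))
          round≤ : ∀ m {b} → 1 ≤ length m → b + length m ≡ n → roundCost y cs bs m + 4 ≤ X b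
          round≤ m {b} 1≤m eq = ≤-trans (proof (proj₂ (proj₂ round-bound) {n} {s} {w} {t} {cs} {bs} {m} {b} {{u≢0 b}} nz structure 1≤m eq))
            (*-mono-≤ (m≤m+n (proj₁ round-bound) _) (^-monoʳ-≤ (n * 2 ^ b) {{u≢0 b}} (m≤m+n (proj₁ (proj₂ round-bound)) _)))
          finish≤ : 1 + T ≤ X n
          finish≤ = ≤-trans (proof (proj₂ (proj₂ finish-bound) {w = w} {t} {{u≢0 n}} nz structure))
            (*-mono-≤ (m≤n+m (proj₁ finish-bound) (proj₁ round-bound)) (^-monoʳ-≤ (n * 2 ^ n) {{u≢0 n}} (m≤n+m (proj₁ (proj₂ finish-bound)) (proj₁ (proj₂ round-bound)))))

        -- Levels only grow, so by monotonicity of `X` each round costs no more than the last level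
        -- allows. The additional unit in `suc (length m)` pays for `finish`.
        loop-bound : ∀ m b → b + length m ≡ n →
          loopCost y cs bs m + finishCost T (outcome y cs bs m) ≤ suc (length m) * X (level n s w t (length m) b)
        loop-bound []      b eq = ≤-trans finish≤ (≤-trans (≤-reflexive (cong X (trans (sym eq) (+-identityʳ b)))) (≤-reflexive (sym (*-identityˡ (X b)))))
        -- `loopCost` branches on verdicts about raw query strings, `level` on verdicts about
        -- encoded roundings. `same` identifies them, which leaves `judge` with two free booleans.
        loop-bound (β ∷ m) b eq = subst (λ x → loopCost y cs bs M + finishCost T (outcome y cs bs M) ≤ suc (suc (length m)) * X (if x then level n s w t (length m) (suc b) else b)) same
            (judge (verdict (query-of y cs bs true M)) (verdict (query-of y cs bs false M)))
          where
          open ≤-Reasoning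
          M = β ∷ m
          m≤n : length M ≤ n
          m≤n = ≤-trans (m≤n+m (length M) b) (≤-reflexive eq)
          size≢0 : NonZero (length (sizeOf y))
          size≢0 = >-nonZero (≤-trans (>-nonZero⁻¹ n {{nz}}) (≤-reflexive (sym (trans (List.length-reverse (ones y)) (sizeℕ-encode Π n s w t)))))
          as-rounded : ∀ β → query-of y cs bs β M ≡ rounded n s w t β (suc (length m))
          as-rounded β = query-encode Π {k} {n} {s} {w} {t} {{nz}} β {y} {M} (s≤s z≤n) m≤n refl (bs size≢0)
          same : not (verdict (query-of y cs bs true M)) ∧ verdict (query-of y cs bs false M) ≡ undecided n s w t (suc (length m))
          same = cong₂ (λ q q′ → not (verdict q) ∧ verdict q′) (as-rounded true) (as-rounded false)
          halt≤ : suc (roundCost y cs bs M + 1) + 2 ≤ suc (suc (length m)) * X b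
          halt≤ = begin
            suc (roundCost y cs bs M + 1) + 2   ≡⟨ cong suc (+-assoc (roundCost y cs bs M) 1 2) ⟩
            suc (roundCost y cs bs M + 3)       ≡⟨ +-suc (roundCost y cs bs M) 3 ⟨
            roundCost y cs bs M + 4             ≤⟨ round≤ M (s≤s z≤n) eq ⟩
            X b                                 ≤⟨ m≤n*m (X b) (suc (suc (length m))) ⟩
            suc (suc (length m)) * X b          ∎
          judge : ∀ v v′ → suc (roundCost y cs bs M + (if v then 1 else if v′ then loopCost y cs bs m else 1))
              + finishCost T (if v then just true else if v′ then outcome y cs bs m else just false)
            ≤ suc (suc (length m)) * X (if not v ∧ v′ then level n s w t (length m) (suc b) else b)
          judge true  _     = halt≤
          judge false false = halt≤
          judge false true  = begin
            suc (roundCost y cs bs M + loopCost y cs bs m) + finishCost T (outcome y cs bs m)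
              ≡⟨ +-assoc (suc (roundCost y cs bs M)) (loopCost y cs bs m) _ ⟩
            suc (roundCost y cs bs M) + (loopCost y cs bs m + finishCost T (outcome y cs bs m))
              ≤⟨ +-mono-≤ (≤-trans (≤-reflexive (+-comm 1 _)) (≤-trans (+-monoʳ-≤ (roundCost y cs bs M) (s≤s z≤n)) (round≤ M (s≤s z≤n) eq)))
                   (loop-bound m (suc b) (trans (sym (+-suc b (length m))) eq)) ⟩
            X b + suc (length m) * X (level n s w t (length m) (suc b))
              ≤⟨ +-monoˡ-≤ _ (X-mono (≤-trans (n≤1+n b) (level-≥ n s w t (length m) (suc b)))) ⟩
            suc (suc (length m)) * X (level n s w t (length m) (suc b)) ∎

      abstract
        cost-poly : ∃[ A ] ∃[ a ] ∀ {n s w t} → NonZero n → IsStructure n s → ∀ cs bs →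
          PolyBound (n * 2 ^ level n s w t n 0) (solverCost (encode Π n s w t) cs bs) A a
        cost-poly = _ , _ , λ {n} {s} {w} {t} nz structure cs bs →
          let y = encode Π n s w t
              L = level n s w t n 0
              instance
                u≢0 : NonZero (n * 2 ^ L)
                u≢0 = m*n≢0 n (2 ^ L) {{nz}} {{m^n≢0 2 L}}
              n≤u = m≤m*n n (2 ^ L) {{m^n≢0 2 L}}
              size : length (sizeOf y) ≡ n
              size = trans (List.length-reverse (ones y)) (sizeℕ-encode Π n s w t)
              loop≤ = subst (λ N → loopCost y cs bs (sizeOf y) + finishCost (suc (10 * (2 + length y) + (askCost y + 2))) (outcome y cs bs (sizeOf y))
                             ≤ suc N * ((proj₁ round-bound + proj₁ finish-bound) * (n * 2 ^ level n s w t N 0) ^ (proj₁ (proj₂ round-bound) + proj₁ (proj₂ finish-bound))))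
                        size (loop-bound nz structure cs bs (sizeOf y) 0 size)
          in (⟦ proj₁ (parse-lin {k}) ⟧ ⊗ proj₂ (proj₂ ℓ-bound) {w = w} {t} structure n≤u
               ⊕ below loop≤ ((⟦ 1 ⟧ ⊕ below n≤u base) ⊗ (⟦ proj₁ round-bound + proj₁ finish-bound ⟧ ⊗ power (proj₁ (proj₂ round-bound) + proj₁ (proj₂ finish-bound)) base)))

      cost-bound : ∃[ A ] ∃[ a ] ∀ {n s w t} → NonZero n → IsStructure n s → ∀ cs bs →
        solverCost (encode Π n s w t) cs bs ≤ (suc A * (n * 2 ^ level n s w t n 0)) ^ suc a
      cost-bound = proj₁ cost-poly , proj₁ (proj₂ cost-poly) , λ {n} {s} {w} {t} nz structure cs bs →
        asPower {{m*n≢0 n _ {{nz}} {{m^n≢0 2 (level n s w t n 0)}}}} (proj₂ (proj₂ cost-poly) {w = w} {t} nz structure cs bs)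

  -- Undecided roundings

  -- The second summand is free of `a`: varying the coefficient of a used item changes the weight of
  -- `x` through that item's own rounded value alone.
  weightℕ-update : ∀ {k} f (u : Vec ℕ k) x i a → lookup x i ≡ true →
    weightℕ (Vec.map f (u [ i ]≔ a)) x ≡ f a + weightℕ (Vec.map f u [ i ]≔ 0) x
  weightℕ-update f (v ∷ u) (true ∷ x)  zero    a refl = refl
  weightℕ-update f (v ∷ u) (false ∷ x) (suc i) a xᵢ = weightℕ-update f u x i a xᵢ
  weightℕ-update f (v ∷ u) (true ∷ x)  (suc i) a xᵢ = begin
    f v + weightℕ (Vec.map f (u [ i ]≔ a)) x           ≡⟨ cong (f v +_) (weightℕ-update f u x i a xᵢ) ⟩
    f v + (f a + weightℕ (Vec.map f u [ i ]≔ 0) x)     ≡⟨ +-assoc (f v) (f a) _ ⟨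
    f v + f a + weightℕ (Vec.map f u [ i ]≔ 0) x       ≡⟨ cong (_+ weightℕ (Vec.map f u [ i ]≔ 0) x) (+-comm (f v) (f a)) ⟩
    f a + f v + weightℕ (Vec.map f u [ i ]≔ 0) x       ≡⟨ +-assoc (f a) (f v) _ ⟩
    f a + (f v + weightℕ (Vec.map f u [ i ]≔ 0) x)     ∎
    where open ≡-Reasoning

  weightℕ-zero : ∀ {k} (u : Vec ℕ k) x → (∀ i → ¬ lookup x i ≡ true) → weightℕ u x ≡ 0
  weightℕ-zero []      []          _  = refl
  weightℕ-zero (v ∷ u) (false ∷ x) x≢ = weightℕ-zero u x (x≢ ∘ suc)
  weightℕ-zero (v ∷ u) (true ∷ x)  x≢ = ⊥-elim (x≢ zero refl)

  -- A solution x using item i that is light enough for uᵢ = a but too heavy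
  -- after rounding up for uᵢ = b confines a ≫ m from above.
  critical-gap : ∀ {k} m (u : Vec ℕ k) x i {a b θ} → lookup x i ≡ true →
    weightℕ (Vec.map (_≫ m) (u [ i ]≔ a)) x ≤ θ → θ < weightℕ (Vec.map (approx true m) (u [ i ]≔ b)) x →
    a ≫ m < (b ≫ m) + k
  critical-gap {k} m u x i {a} {b} {θ} xᵢ light heavy = +-cancelʳ-< rest (a ≫ m) ((b ≫ m) + k) (begin-strict
    (a ≫ m) + rest                                       ≡⟨ weightℕ-update (_≫ m) u x i a xᵢ ⟨
    weightℕ (Vec.map (_≫ m) (u [ i ]≔ a)) x              ≤⟨ light ⟩
    θ                                                    <⟨ heavy ⟩
    weightℕ (Vec.map (approx true m) (u [ i ]≔ b)) x     ≤⟨ weight-gap m (u [ i ]≔ b) x ⟩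
    weightℕ (Vec.map (_≫ m) (u [ i ]≔ b)) x + k          ≡⟨ cong (_+ k) (weightℕ-update (_≫ m) u x i b xᵢ) ⟩
    (b ≫ m) + rest + k                                   ≡⟨ +-assoc (b ≫ m) rest k ⟩
    (b ≫ m) + (rest + k)                                 ≡⟨ cong ((b ≫ m) +_) (+-comm rest k) ⟩
    (b ≫ m) + (k + rest)                                 ≡⟨ +-assoc (b ≫ m) k rest ⟨
    (b ≫ m) + k + rest                                   ∎)
    where
    open ≤-Reasoning
    rest : ℕ
    rest = weightℕ (Vec.map (_≫ m) u [ i ]≔ 0) x

  -- The two inequalities place `v ≫ m` strictly within `n` of `v₀ ≫ m`, and each shifted value
  -- stands for `2ᵐ` values of `v`. Truncated subtraction is harmless, as it only raises a negative
  -- lower end to 0.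
  ≫-window : ∀ {v v₀ m n} → v ≫ m < (v₀ ≫ m) + n → v₀ ≫ m < (v ≫ m) + n →
    2 ^ m * ((v₀ ≫ m) ∸ n) ≤ v × v < 2 ^ m * ((v₀ ≫ m) ∸ n) + 2 ^ m * (2 * n)
  ≫-window {v} {v₀} {m} {n} above below′ = (begin
      2 ^ m * ((v₀ ≫ m) ∸ n)   ≤⟨ *-monoʳ-≤ (2 ^ m) (≤-trans (∸-monoˡ-≤ n (<⇒≤ below′)) (≤-reflexive (m+n∸n≡m (v ≫ m) n))) ⟩
      2 ^ m * (v ≫ m)          ≤⟨ ≫-lower v m ⟩
      v                        ∎) ,
    (begin-strict
      v                                          <⟨ ≫-upper v m ⟩
      2 ^ m * suc (v ≫ m)                        ≤⟨ *-monoʳ-≤ (2 ^ m) (≤-trans above (+-monoˡ-≤ n (m≤n+m∸n (v₀ ≫ m) n))) ⟩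
      2 ^ m * (n + ((v₀ ≫ m) ∸ n) + n)           ≡⟨ cong (2 ^ m *_) (trans (cong (_+ n) (+-comm n _)) (trans (+-assoc ((v₀ ≫ m) ∸ n) n n) (cong (λ a → ((v₀ ≫ m) ∸ n) + (n + a)) (sym (+-identityʳ n))))) ⟩
      2 ^ m * (((v₀ ≫ m) ∸ n) + 2 * n)           ≡⟨ *-distribˡ-+ (2 ^ m) _ (2 * n) ⟩
      2 ^ m * ((v₀ ≫ m) ∸ n) + 2 ^ m * (2 * n)   ∎)
    where open ≤-Reasoning

  module Gap (Π : BinaryProblem) {k : ℕ} (P : Prog (suc k)) (time : String → ℕ)
             (decides : Decides P (λ y → y ∷ Vec.replicate k []) (Language Π) time)
             (c C : ℕ)
             (fast : ∀ n → NonZero n → ∀ s w t → BinaryProblem.IsStructure Π n s → ∀ b → All (λ wᵢ → toℕ wᵢ < 2 ^ b) w →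
                     time (encode Π n s w t) ≤ C * (n * 2 ^ b) ^ c) where

    open BinaryProblem Π
    open Solver Π P time decides
    open Timing Π P time decides c C fast

    module _ {n : ℕ} {s : String} (nz : NonZero n) (structure : IsStructure n s) (t : Threshold n)
             {m : ℕ} (1≤m : 1 ≤ m) (m≤n : m ≤ n) where

      -- `heavy` speaks of all feasible vectors and not of `x` alone, so that it can be applied to a
      -- solution chosen for different coefficients.
      record Critical (w : Coefficients n) (x : Vec Bool n) : Set where
        field
          feasible : Feasible n s x
          light    : weightℕ (Vec.map (_≫ m) (Vec.map toℕ w)) x ≤ toℕ (shifted Π m t)
          heavy    : ∀ x′ → Feasible n s x′ → toℕ (shifted Π m t) < weightℕ (Vec.map (approx true m) (Vec.map toℕ w)) x′

      open Critical

      critical : ∀ w → undecided n s w t m ≡ true → ∃[ x ] Critical w x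
      critical w eq with verdict (rounded n s w t true m) in no | verdict (rounded n s w t false m) in yes′
      critical w refl | false | true =
        let _ , x , feas , w≤ = language-encode Π {n} {s} {Vec.map (approxFin n false m) w} {shifted Π m t}
                                  (Equivalence.to (verdict-correct _) yes′)
        in x , record
          { feasible = feas
          ; light    = ≤-trans (≤-reflexive (sym (weight-approx 1≤m m≤n false w x))) w≤
          ; heavy    = λ x′ feas′ → ≰⇒> λ w≤′ → contradiction
              (trans (sym no) (Equivalence.from (verdict-correct (rounded n s w t true m))
                (n , nz , s , Vec.map (approxFin n true m) w , shifted Π m t , structure , refl , x′ , feas′ ,
                  ≤-trans (≤-reflexive (weight-approx 1≤m m≤n true w x′)) w≤′))) λ ()
          }

      -- Marks the items of the one solution that `critical` selects for `w`. This selection may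
      -- jump when a coefficient changes.
      picks : Coefficients n → Fin n → Bool
      picks w i with undecided n s w t m Bool.≟ true
      ... | yes eq = lookup (proj₁ (critical w eq)) i
      ... | no _   = false

      picks-critical : ∀ w i → picks w i ≡ true → ∃[ x ] Critical w x × lookup x i ≡ true
      picks-critical w i eq with undecided n s w t m Bool.≟ true
      ... | yes u = proj₁ (critical w u) , proj₂ (critical w u) , eq

      -- A solution without items has rounded-up weight 0, which cannot exceed a threshold.
      picks-some : ∀ w → undecided n s w t m ≡ true → ∃[ i ] picks w i ≡ true
      picks-some w u with undecided n s w t m Bool.≟ true
      ... | no ¬u = contradiction u ¬u
      ... | yes u′ with x , crit ← critical w u′ with Fin.any? (λ i → lookup x i Bool.≟ true)
      ...   | yes some = some
      ...   | no none  = ⊥-elim (n≮0 (subst (toℕ (shifted Π m t) <_) (weightℕ-zero (Vec.map (approx true m) (Vec.map toℕ w)) x (λ i xᵢ → none (i , xᵢ))) (heavy crit x (feasible crit))))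

      -- The solution is the one chosen for `a`; its feasibility does not depend on the
      -- coefficients, so rounded up it is too heavy for `b` as well. Exchanging `a` and `b` gives
      -- the other side of the window.
      picks-gap : ∀ w i {a b} → picks (w [ i ]≔ a) i ≡ true → picks (w [ i ]≔ b) i ≡ true →
        toℕ a ≫ m < (toℕ b ≫ m) + n
      picks-gap w i {a} {b} pa pb
        with x , crit , xᵢ ← picks-critical (w [ i ]≔ a) i pa
        with _ , crit′ , _ ← picks-critical (w [ i ]≔ b) i pb
        = critical-gap m (Vec.map toℕ w) x i xᵢ
            (subst (λ u → weightℕ (Vec.map (_≫ m) u) x ≤ toℕ (shifted Π m t)) (Vec.map-[]≔ toℕ w i) (light crit))
            (subst (λ u → toℕ (shifted Π m t) < weightℕ (Vec.map (approx true m) u) x) (Vec.map-[]≔ toℕ w i) (heavy crit′ x (feasible crit)))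

      -- Any picked value can serve as the centre, since every other picked value is close to it; it
      -- is found by search over the finite range. If there is none, the condition on `v` is vacuous
      -- and 0 is an arbitrary choice.
      picks-window : ∀ w i → ∃[ lo ] ∀ v → picks (w [ i ]≔ v) i ≡ true → lo ≤ toℕ v × toℕ v < lo + 2 ^ m * (2 * n)
      picks-window w i with Fin.any? (λ v → picks (w [ i ]≔ v) i Bool.≟ true)
      ... | no none       = 0 , λ v pv → ⊥-elim (none (v , pv))
      ... | yes (v₀ , p₀) = 2 ^ m * ((toℕ v₀ ≫ m) ∸ n) , λ v pv →
        ≫-window {toℕ v} {toℕ v₀} {m} (picks-gap w i pv p₀) (picks-gap w i p₀ pv)

open Algorithms

-- Ordered fields

module OrderedField (ℝ : OrderedFieldWithRoots) where

  open OrderedFieldWithRoots ℝ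
  open CommutativeRing commutativeRing public using
    ( +-cong; *-cong; +-comm; +-assoc; *-comm; *-assoc; +-identityˡ; +-identityʳ; *-identityˡ; *-identityʳ
    ; zeroˡ; zeroʳ; distribˡ; distribʳ; -_; -‿inverseˡ; -‿inverseʳ; semiring; +-congˡ; +-congʳ; *-congˡ; *-congʳ )
  open CommutativeRing commutativeRing using (ring)
  open import Algebra.Properties.Ring ring using (-‿distribˡ-*; -‿involutive)
  open import Algebra.Properties.Semiring.Mult semiring using (×1-homo-*; ×-homo-+; ×-homo-1)
  open import Algebra.Properties.Semiring.Exp semiring using (^-assocʳ; ^-congˡ)
  open import Algebra.Properties.CommutativeSemiring.Exp (CommutativeRing.commutativeSemiring commutativeRing) using (^-distrib-*)
  open IsDecTotalOrder isDecTotalOrder using (total; antisym; isPartialOrder; _≤?_; module Eq)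
    renaming (refl to ≤-refl; trans to ≤-trans; reflexive to ≤-reflexive) public

  poset : Poset _ _ _
  poset = record { isPartialOrder = isPartialOrder }

  module ≤-Reasoning where
    open import Relation.Binary.Reasoning.PartialOrder poset public
      using (begin_; _∎; step-≤; step-≈; step-≈-⟩; step-≈-⟨; step-≡; step-≡-⟩; step-≡-⟨; step-≡-∣)

  open ≤-Reasoning

  +-mono-≤ : ∀ {x y u v} → x ≤ y → u ≤ v → x + u ≤ y + v
  +-mono-≤ {x} {y} {u} {v} x≤y u≤v = begin
    x + u ≤⟨ +-monoˡ-≤ u x≤y ⟩
    y + u ≈⟨ +-comm y u ⟩
    u + y ≤⟨ +-monoˡ-≤ y u≤v ⟩
    v + y ≈⟨ +-comm v y ⟩
    y + v ∎

  +-nonNegative : ∀ {x y} → 0# ≤ x → 0# ≤ y → 0# ≤ x + y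
  +-nonNegative {x} {y} 0≤x 0≤y = begin
    0#      ≈⟨ +-identityˡ 0# ⟨
    0# + 0# ≤⟨ +-mono-≤ 0≤x 0≤y ⟩
    x + y   ∎

  difference-nonNegative : ∀ {x y} → x ≤ y → 0# ≤ y + - x
  difference-nonNegative {x} {y} x≤y = begin
    0#      ≈⟨ -‿inverseʳ x ⟨
    x + - x ≤⟨ +-monoˡ-≤ (- x) x≤y ⟩
    y + - x ∎

  *-monoˡ-≤ : ∀ {x y} z → 0# ≤ z → x ≤ y → x * z ≤ y * z
  *-monoˡ-≤ {x} {y} z 0≤z x≤y = begin
    x * z                     ≈⟨ +-identityˡ (x * z) ⟨
    0# + x * z                ≤⟨ +-monoˡ-≤ (x * z) (*-nonNegative (difference-nonNegative x≤y) 0≤z) ⟩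
    (y + - x) * z + x * z     ≈⟨ distribʳ z (y + - x) x ⟨
    (y + - x + x) * z         ≈⟨ *-congʳ (+-assoc y (- x) x) ⟩
    (y + (- x + x)) * z       ≈⟨ *-congʳ (+-congˡ (-‿inverseˡ x)) ⟩
    (y + 0#) * z              ≈⟨ *-congʳ (+-identityʳ y) ⟩
    y * z                     ∎

  *-monoʳ-≤ : ∀ {x y} z → 0# ≤ z → x ≤ y → z * x ≤ z * y
  *-monoʳ-≤ {x} {y} z 0≤z x≤y = begin
    z * x ≈⟨ *-comm z x ⟩
    x * z ≤⟨ *-monoˡ-≤ z 0≤z x≤y ⟩
    y * z ≈⟨ *-comm y z ⟩
    z * y ∎

  0≤1 : 0# ≤ 1#
  0≤1 with total 0# 1#
  ... | inj₁ 0≤1 = 0≤1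
  ... | inj₂ 1≤0 = begin
    0#              ≤⟨ *-nonNegative 0≤-1 0≤-1 ⟩
    - 1# * - 1#     ≈⟨ -‿distribˡ-* 1# (- 1#) ⟨
    - (1# * - 1#)   ≈⟨ CommutativeRing.-‿cong commutativeRing (*-identityˡ (- 1#)) ⟩
    - (- 1#)        ≈⟨ -‿involutive 1# ⟩
    1#              ∎
    where
    0≤-1 : 0# ≤ - 1#
    0≤-1 = ≤-trans (difference-nonNegative 1≤0) (≤-reflexive (+-identityˡ (- 1#)))

  1≰0 : ¬ 1# ≤ 0#
  1≰0 1≤0 = 0≉1 (antisym 0≤1 1≤0)

  *-cancelʳ-≤ : ∀ {x y} z → 0# < z → x * z ≤ y * z → x ≤ y
  *-cancelʳ-≤ {x} {y} z (0≤z , 0≉z) xz≤yz = begin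
    x             ≈⟨ undo x ⟨
    x * z * z⁻¹   ≤⟨ *-monoˡ-≤ z⁻¹ 0≤z⁻¹ xz≤yz ⟩
    y * z * z⁻¹   ≈⟨ undo y ⟩
    y             ∎
    where
    z≉0 : ¬ z ≈ 0#
    z≉0 eq = 0≉z (Eq.sym eq)
    z⁻¹ : Carrier
    z⁻¹ = proj₁ (inverse z z≉0)
    undo : ∀ x → x * z * z⁻¹ ≈ x
    undo x = Eq.trans (*-assoc x z z⁻¹) (Eq.trans (*-congˡ (proj₂ (inverse z z≉0))) (*-identityʳ x))
    0≤z⁻¹ : 0# ≤ z⁻¹
    0≤z⁻¹ with total 0# z⁻¹
    ... | inj₁ 0≤ = 0≤
    ... | inj₂ ≤0 = contradiction (begin
      1#        ≈⟨ proj₂ (inverse z z≉0) ⟨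
      z * z⁻¹   ≤⟨ *-monoʳ-≤ z 0≤z ≤0 ⟩
      z * 0#    ≈⟨ zeroʳ z ⟩
      0#        ∎) 1≰0

  *-positive : ∀ {x y} → 0# < x → 0# < y → 0# < x * y
  *-positive {x} {y} (0≤x , 0≉x) (0≤y , 0≉y) = *-nonNegative 0≤x 0≤y , λ 0≈xy →
    0≉x (antisym 0≤x (*-cancelʳ-≤ y (0≤y , 0≉y) (begin
      x * y   ≈⟨ 0≈xy ⟨
      0#      ≈⟨ zeroˡ y ⟨
      0# * y  ∎)))

  0<1 : 0# < 1#
  0<1 = 0≤1 , 0≉1

  ^-nonNegative : ∀ {x} k → 0# ≤ x → 0# ≤ x ^ k
  ^-nonNegative zero    0≤x = 0≤1
  ^-nonNegative (suc k) 0≤x = *-nonNegative 0≤x (^-nonNegative k 0≤x)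

  ^-positive : ∀ {x} k → 0# < x → 0# < x ^ k
  ^-positive zero    0<x = 0<1
  ^-positive (suc k) 0<x = *-positive 0<x (^-positive k 0<x)

  ^-monoˡ-≤ : ∀ {x y} k → 0# ≤ x → x ≤ y → x ^ k ≤ y ^ k
  ^-monoˡ-≤ zero    0≤x x≤y = ≤-refl
  ^-monoˡ-≤ {x} {y} (suc k) 0≤x x≤y = begin
    x * x ^ k ≤⟨ *-monoˡ-≤ (x ^ k) (^-nonNegative k 0≤x) x≤y ⟩
    y * x ^ k ≤⟨ *-monoʳ-≤ y (≤-trans 0≤x x≤y) (^-monoˡ-≤ k 0≤x x≤y) ⟩
    y * y ^ k ∎

  1^ : ∀ k → 1# ^ k ≈ 1#
  1^ zero    = Eq.refl
  1^ (suc k) = Eq.trans (*-identityˡ (1# ^ k)) (1^ k)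

  1≤^ : ∀ {x} k → 1# ≤ x → 1# ≤ x ^ k
  1≤^ zero    1≤x = ≤-refl
  1≤^ {x} (suc k) 1≤x = begin
    1#        ≤⟨ 1≤^ k 1≤x ⟩
    x ^ k     ≈⟨ *-identityˡ (x ^ k) ⟨
    1# * x ^ k ≤⟨ *-monoˡ-≤ (x ^ k) (≤-trans 0≤1 (1≤^ k 1≤x)) 1≤x ⟩
    x * x ^ k ∎

  ^-monoʳ-≤ : ∀ {x j k} → 1# ≤ x → j ℕ.≤ k → x ^ j ≤ x ^ k
  ^-monoʳ-≤ {k = k} 1≤x z≤n = 1≤^ k 1≤x
  ^-monoʳ-≤ {x} 1≤x (s≤s j≤k) = *-monoʳ-≤ x (≤-trans 0≤1 1≤x) (^-monoʳ-≤ 1≤x j≤k)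

  -- If `y ≤ x` but not `x ≤ y`, then `x` is positive and `x * x ^ k ≤ y * y ^ k ≤ y * x ^ k`, where
  -- the positive factor `x ^ k` cancels.
  ^-cancel-≤ : ∀ {x y} k → .{{NonZero k}} → 0# ≤ y → x ^ k ≤ y ^ k → x ≤ y
  ^-cancel-≤ {x} {y} (suc k) 0≤y xᵏ≤yᵏ with total x y
  ... | inj₁ x≤y = x≤y
  ... | inj₂ y≤x with x ≤? y
  ...   | yes x≤y = x≤y
  ...   | no x≰y  = *-cancelʳ-≤ (x ^ k) (^-positive k (≤-trans 0≤y y≤x , λ 0≈x → x≰y (≤-trans (≤-reflexive (Eq.sym 0≈x)) 0≤y))) (begin
    x * x ^ k ≤⟨ xᵏ≤yᵏ ⟩
    y * y ^ k ≤⟨ *-monoʳ-≤ y 0≤y (^-monoˡ-≤ k 0≤y y≤x) ⟩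
    y * x ^ k ∎)

  fromℕ-+ : ∀ m n → fromℕ (m ℕ.+ n) ≈ fromℕ m + fromℕ n
  fromℕ-+ m n = ×-homo-+ 1# m n

  fromℕ-* : ∀ m n → fromℕ (m ℕ.* n) ≈ fromℕ m * fromℕ n
  fromℕ-* = ×1-homo-*

  fromℕ-1 : fromℕ 1 ≈ 1#
  fromℕ-1 = ×-homo-1 1#

  fromℕ-^ : ∀ m k → fromℕ (m ℕ.^ k) ≈ fromℕ m ^ k
  fromℕ-^ m zero    = fromℕ-1
  fromℕ-^ m (suc k) = Eq.trans (fromℕ-* m (m ℕ.^ k)) (*-congˡ (fromℕ-^ m k))

  fromℕ-nonNegative : ∀ m → 0# ≤ fromℕ m
  fromℕ-nonNegative zero    = ≤-refl
  fromℕ-nonNegative (suc m) = +-nonNegative 0≤1 (fromℕ-nonNegative m)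

  fromℕ-mono-≤ : ∀ {m n} → m ℕ.≤ n → fromℕ m ≤ fromℕ n
  fromℕ-mono-≤ {n = n} z≤n = fromℕ-nonNegative n
  fromℕ-mono-≤ (s≤s m≤n) = +-mono-≤ ≤-refl (fromℕ-mono-≤ m≤n)

  1≤fromℕ : ∀ {m} → 1 ℕ.≤ m → 1# ≤ fromℕ m
  1≤fromℕ 1≤m = ≤-trans (≤-reflexive (Eq.sym fromℕ-1)) (fromℕ-mono-≤ 1≤m)

  fromℕ-positive : ∀ {m} → 1 ℕ.≤ m → 0# < fromℕ m
  fromℕ-positive {m} 1≤m = fromℕ-nonNegative m , λ 0≈m → 1≰0 (≤-trans (1≤fromℕ 1≤m) (≤-reflexive (Eq.sym 0≈m)))

  fromℕ-cancel-≤ : ∀ {m n} → fromℕ m ≤ fromℕ n → m ℕ.≤ n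
  fromℕ-cancel-≤ {m} {n} m≤n with m ℕ.≤? n
  ... | yes p = p
  ... | no ¬p = contradiction (begin
    1#                         ≈⟨ +-identityʳ 1# ⟨
    1# + 0#                    ≈⟨ +-congˡ (-‿inverseʳ (fromℕ n)) ⟨
    1# + (fromℕ n + - fromℕ n) ≈⟨ +-assoc 1# (fromℕ n) (- fromℕ n) ⟨
    fromℕ (suc n) + - fromℕ n  ≤⟨ +-monoˡ-≤ (- fromℕ n) (≤-trans (fromℕ-mono-≤ (ℕ.≰⇒> ¬p)) m≤n) ⟩
    fromℕ n + - fromℕ n        ≈⟨ -‿inverseʳ (fromℕ n) ⟩
    0#                         ∎) 1≰0

  module _ (q : ℕ) .{{_ : NonZero q}} where

    private
      q≥1 : 1 ℕ.≤ q
      q≥1 = ℕ.>-nonZero⁻¹ q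
      q⁻¹ : ∃[ ε ] fromℕ q * ε ≈ 1#
      q⁻¹ = inverse (fromℕ q) (λ q≈0 → proj₂ (fromℕ-positive q≥1) (Eq.sym q≈0))

    reciprocal : Carrier
    reciprocal = proj₁ q⁻¹

    reciprocal-positive : 0# < reciprocal
    reciprocal-positive = 0≤ , λ 0≈ε → 0≉1 (begin-equality
      0#                    ≈⟨ zeroʳ (fromℕ q) ⟨
      fromℕ q * 0#          ≈⟨ *-congˡ 0≈ε ⟩
      fromℕ q * reciprocal  ≈⟨ proj₂ q⁻¹ ⟩
      1#                    ∎)
      where
      open import Relation.Binary.Reasoning.PartialOrder poset using (begin-equality_)
      0≤ : 0# ≤ reciprocal
      0≤ with total 0# reciprocal
      ... | inj₁ p = p
      ... | inj₂ p = contradiction (begin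
        1#                    ≈⟨ proj₂ q⁻¹ ⟨
        fromℕ q * reciprocal  ≤⟨ *-monoʳ-≤ (fromℕ q) (fromℕ-nonNegative q) p ⟩
        fromℕ q * 0#          ≈⟨ zeroʳ (fromℕ q) ⟩
        0#                    ∎) 1≰0

    private
      scaled : ∀ m → fromℕ m * reciprocal * fromℕ q ≈ fromℕ m
      scaled m = Eq.trans (*-assoc (fromℕ m) reciprocal (fromℕ q))
        (Eq.trans (*-congˡ (Eq.trans (*-comm reciprocal (fromℕ q)) (proj₂ q⁻¹))) (*-identityʳ (fromℕ m)))

    1≤root : ∀ {t} → 1# ≤ t → 1# ≤ root q t
    1≤root {t} 1≤t = ^-cancel-≤ q (root-nonNegative q (≤-trans 0≤1 1≤t)) (begin
      1# ^ q         ≈⟨ 1^ q ⟩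
      1#             ≤⟨ 1≤t ⟩
      t              ≈⟨ root-power q (≤-trans 0≤1 1≤t) ⟨
      root q t ^ q   ∎)

    -- As `r ^ q` is `t`, the power `t ^ p` is `r ^ (q * p)`. Both conditions thus compare natural
    -- exponents over the base `r ≥ 1`.
    root-isPower : ∀ {t} → 1 ℕ.≤ t → IsPower t reciprocal (root q (fromℕ t))
    root-isPower {t} 1≤t = root-nonNegative q (fromℕ-nonNegative t) , λ p p′ →
      (λ p≤ → begin
        fromℕ t ^ p          ≈⟨ powers p ⟩
        r ^ (q ℕ.* p)        ≤⟨ ^-monoʳ-≤ 1≤r (fromℕ-cancel-≤ {q ℕ.* p} {p′} (begin
          fromℕ (q ℕ.* p)                     ≈⟨ fromℕ-* q p ⟩
          fromℕ q * fromℕ p                   ≈⟨ *-comm (fromℕ q) (fromℕ p) ⟩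
          fromℕ p * fromℕ q                   ≤⟨ *-monoˡ-≤ (fromℕ q) (fromℕ-nonNegative q) p≤ ⟩
          fromℕ p′ * reciprocal * fromℕ q     ≈⟨ scaled p′ ⟩
          fromℕ p′                            ∎)) ⟩
        r ^ p′               ∎) ,
      (λ ≤p → begin
        r ^ p′               ≤⟨ ^-monoʳ-≤ 1≤r (fromℕ-cancel-≤ {p′} {q ℕ.* p} (begin
          fromℕ p′                            ≈⟨ scaled p′ ⟨
          fromℕ p′ * reciprocal * fromℕ q     ≤⟨ *-monoˡ-≤ (fromℕ q) (fromℕ-nonNegative q) ≤p ⟩
          fromℕ p * fromℕ q                   ≈⟨ *-comm (fromℕ p) (fromℕ q) ⟩
          fromℕ q * fromℕ p                   ≈⟨ fromℕ-* q p ⟨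
          fromℕ (q ℕ.* p)                     ∎)) ⟩
        r ^ (q ℕ.* p)        ≈⟨ powers p ⟨
        fromℕ t ^ p          ∎)
      where
      r : Carrier
      r = root q (fromℕ t)
      1≤r : 1# ≤ r
      1≤r = 1≤root (1≤fromℕ 1≤t)
      powers : ∀ p → fromℕ t ^ p ≈ r ^ (q ℕ.* p)
      powers p = Eq.trans (^-congˡ p (Eq.sym (root-power q (fromℕ-nonNegative t)))) (^-assocʳ r q p)

-- Sums and expectations

module Expectation (ℝ : OrderedFieldWithRoots) where

  open OrderedFieldWithRoots ℝ
  open OrderedField ℝ
  open ≤-Reasoning
  open import Algebra.Properties.Semiring.Sum semiring using (*-distribˡ-sum; *-distribʳ-sum; ∑-distrib-+)

  sum-cong : ∀ {n} (f g : Fin n → Carrier) → (∀ i → f i ≈ g i) → sum f ≈ sum g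
  sum-cong {zero}  f g f≈g = Eq.refl
  sum-cong {suc n} f g f≈g = +-cong (f≈g zero) (sum-cong (f ∘ suc) (g ∘ suc) (f≈g ∘ suc))

  sum-mono : ∀ {n} (f g : Fin n → Carrier) → (∀ i → f i ≤ g i) → sum f ≤ sum g
  sum-mono {zero}  f g f≤g = ≤-refl
  sum-mono {suc n} f g f≤g = +-mono-≤ (f≤g zero) (sum-mono (f ∘ suc) (g ∘ suc) (f≤g ∘ suc))

  sum-nonNegative : ∀ {n} (f : Fin n → Carrier) → (∀ i → 0# ≤ f i) → 0# ≤ sum f
  sum-nonNegative {zero}  f 0≤f = ≤-refl
  sum-nonNegative {suc n} f 0≤f = +-nonNegative (0≤f zero) (sum-nonNegative (f ∘ suc) (0≤f ∘ suc))

  sum-≤-const : ∀ {n} (f : Fin n → Carrier) β → (∀ i → f i ≤ β) → sum f ≤ fromℕ n * β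
  sum-≤-const {zero}  f β f≤ = ≤-reflexive (Eq.sym (zeroˡ β))
  sum-≤-const {suc n} f β f≤ = begin
    f zero + sum (f ∘ suc)    ≤⟨ +-mono-≤ (f≤ zero) (sum-≤-const (f ∘ suc) β (f≤ ∘ suc)) ⟩
    β + fromℕ n * β           ≈⟨ +-congʳ (*-identityˡ β) ⟨
    1# * β + fromℕ n * β      ≈⟨ distribʳ β 1# (fromℕ n) ⟨
    fromℕ (suc n) * β         ∎

  0≤indicator : ∀ b → 0# ≤ fromℕ (indicator b)
  0≤indicator b = fromℕ-nonNegative (indicator b)

  indicator-≤-sum : ∀ {n} (g : Fin n → Bool) → (∃[ i ] g i ≡ true) → 1# ≤ sum (λ i → fromℕ (indicator (g i)))
  indicator-≤-sum {suc n} g (zero , eq) rewrite eq = begin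
    1#                                                 ≈⟨ +-identityʳ 1# ⟨
    1# + 0#                                            ≤⟨ +-mono-≤ (1≤fromℕ {1} (s≤s z≤n)) (sum-nonNegative (λ i → fromℕ (indicator (g (suc i)))) (λ i → 0≤indicator (g (suc i)))) ⟩
    fromℕ 1 + sum (λ i → fromℕ (indicator (g (suc i)))) ∎
  indicator-≤-sum {suc n} g (suc i , eq) = begin
    1#                                                 ≤⟨ indicator-≤-sum (g ∘ suc) (i , eq) ⟩
    sum (λ i → fromℕ (indicator (g (suc i))))          ≈⟨ +-identityˡ (sum (λ i → fromℕ (indicator (g (suc i))))) ⟨
    0# + sum (λ i → fromℕ (indicator (g (suc i))))     ≤⟨ +-mono-≤ (0≤indicator (g zero)) ≤-refl ⟩
    fromℕ (indicator (g zero)) + sum (λ i → fromℕ (indicator (g (suc i)))) ∎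

  module _ {ψ : Carrier} (0≤ψ : 0# ≤ ψ) where

    -- An induction along `Fin M`: values before the window contribute nothing, each of the next `K`
    -- at most `ψ`, and the remaining ones again nothing.
    window-sum : ∀ {M} (p : Fin M → Carrier) → (∀ v → p v ≤ ψ) → (g : Fin M → Bool) → ∀ lo K →
      (∀ v → g v ≡ true → lo ℕ.≤ toℕ v × toℕ v ℕ.< lo ℕ.+ K) →
      sum (λ v → p v * fromℕ (indicator (g v))) ≤ fromℕ K * ψ
    window-sum {zero}  p p≤ g lo K w = *-nonNegative (fromℕ-nonNegative K) 0≤ψ
    window-sum {suc M} p p≤ g (suc lo) K w = begin
      p zero * fromℕ (indicator (g zero)) + rest ≈⟨ +-congʳ (head-0 (g zero) refl) ⟩
      0# + rest                                   ≈⟨ +-identityˡ rest ⟩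
      rest                                        ≤⟨ window-sum (p ∘ suc) (p≤ ∘ suc) (g ∘ suc) lo K (λ v gv → ℕ.s≤s⁻¹ (proj₁ (w (suc v) gv)) , ℕ.s≤s⁻¹ (proj₂ (w (suc v) gv))) ⟩
      fromℕ K * ψ                                 ∎
      where
      rest : Carrier
      rest = sum (λ v → p (suc v) * fromℕ (indicator (g (suc v))))
      head-0 : ∀ b → g zero ≡ b → p zero * fromℕ (indicator b) ≈ 0#
      head-0 false _  = zeroʳ (p zero)
      head-0 true  eq = ⊥-elim (ℕ.n≮0 (proj₁ (w zero eq)))
    window-sum {suc M} p p≤ g zero (suc K) w = begin
      p zero * fromℕ (indicator (g zero)) + sum (λ v → p (suc v) * fromℕ (indicator (g (suc v))))
        ≤⟨ +-mono-≤ (head-ψ (g zero)) (window-sum (p ∘ suc) (p≤ ∘ suc) (g ∘ suc) zero K (λ v gv → z≤n , ℕ.s≤s⁻¹ (proj₂ (w (suc v) gv)))) ⟩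
      ψ + fromℕ K * ψ         ≈⟨ +-congʳ (*-identityˡ ψ) ⟨
      1# * ψ + fromℕ K * ψ    ≈⟨ distribʳ ψ 1# (fromℕ K) ⟨
      fromℕ (suc K) * ψ       ∎
      where
      head-ψ : ∀ b → p zero * fromℕ (indicator b) ≤ ψ
      head-ψ false = ≤-trans (≤-reflexive (zeroʳ (p zero))) 0≤ψ
      head-ψ true  = ≤-trans (≤-reflexive (Eq.trans (*-congˡ fromℕ-1) (*-identityʳ (p zero)))) (p≤ zero)
    window-sum {suc M} p p≤ g zero zero w = begin
      sum (λ v → p v * fromℕ (indicator (g v)))  ≤⟨ sum-≤-const (λ v → p v * fromℕ (indicator (g v))) 0# (λ v → ≤-reflexive (vanish v (g v) refl)) ⟩
      fromℕ (suc M) * 0#                          ≈⟨ zeroʳ (fromℕ (suc M)) ⟩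
      0#                                          ≈⟨ zeroˡ ψ ⟨
      0# * ψ                                      ∎
      where
      vanish : ∀ v b → g v ≡ b → p v * fromℕ (indicator b) ≈ 0#
      vanish v false _  = zeroʳ (p v)
      vanish v true  eq = ⊥-elim (ℕ.n≮0 (proj₂ (w v eq)))

  -- Expectation over independent coordinates

  module _ {M : ℕ} where

    -- The product measure as iterated sums, so that inductions can peel off one coordinate;
    -- `sumOver-vectors` relates it to the product of the single probabilities.
    𝔼 : ∀ {k} → (Fin k → Fin M → Carrier) → (Vec (Fin M) k → Carrier) → Carrier
    𝔼 {zero}  p F = F []
    𝔼 {suc k} p F = sum (λ v → p zero v * 𝔼 (p ∘ suc) (λ w → F (v ∷ w)))

    slice : ∀ {k} → (Fin (suc k) → Fin M → Carrier) → (Vec (Fin M) (suc k) → Carrier) → Fin M → Carrier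
    slice p F v = p zero v * 𝔼 (p ∘ suc) (λ w → F (v ∷ w))

    record Distribution {k} (p : Fin k → Fin M → Carrier) : Set where
      field
        nonNegative : ∀ i v → 0# ≤ p i v
        total-one   : ∀ i → sum (p i) ≈ 1#

    open Distribution

    tail : ∀ {k} {p : Fin (suc k) → Fin M → Carrier} → Distribution p → Distribution (p ∘ suc)
    tail d = record { nonNegative = nonNegative d ∘ suc ; total-one = total-one d ∘ suc }

    𝔼-mono : ∀ {k} {p : Fin k → Fin M → Carrier} → Distribution p → ∀ {F G} → (∀ w → F w ≤ G w) → 𝔼 p F ≤ 𝔼 p G
    𝔼-mono {zero}  d F≤G = F≤G []
    𝔼-mono {suc k} {p} d {F} {G} F≤G = sum-mono (slice p F) (slice p G) (λ v → *-monoʳ-≤ (p zero v) (nonNegative d zero v) (𝔼-mono (tail d) (λ w → F≤G (v ∷ w))))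

    𝔼-cong : ∀ {k} (p : Fin k → Fin M → Carrier) {F G} → (∀ w → F w ≈ G w) → 𝔼 p F ≈ 𝔼 p G
    𝔼-cong {zero}  p F≈G = F≈G []
    𝔼-cong {suc k} p {F} {G} F≈G = sum-cong (slice p F) (slice p G) (λ v → *-congˡ (𝔼-cong (p ∘ suc) (λ w → F≈G (v ∷ w))))

    𝔼-const : ∀ {k} {p : Fin k → Fin M → Carrier} → Distribution p → ∀ c → 𝔼 p (λ _ → c) ≈ c
    𝔼-const {zero}  d c = Eq.refl
    𝔼-const {suc k} {p} d c = Eq.trans (sum-cong (slice p (λ _ → c)) (λ v → p zero v * c) (λ v → *-congˡ (𝔼-const (tail d) c)))
      (Eq.trans (Eq.sym (*-distribʳ-sum c (p zero))) (Eq.trans (*-congʳ (total-one d zero)) (*-identityˡ c)))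

    𝔼-+ : ∀ {k} (p : Fin k → Fin M → Carrier) F G → 𝔼 p (λ w → F w + G w) ≈ 𝔼 p F + 𝔼 p G
    𝔼-+ {zero}  p F G = Eq.refl
    𝔼-+ {suc k} p F G = Eq.trans
      (sum-cong (slice p (λ w → F w + G w)) (λ v → slice p F v + slice p G v) (λ v → Eq.trans (*-congˡ (𝔼-+ (p ∘ suc) (λ w → F (v ∷ w)) (λ w → G (v ∷ w))))
        (distribˡ (p zero v) (𝔼 (p ∘ suc) (λ w → F (v ∷ w))) (𝔼 (p ∘ suc) (λ w → G (v ∷ w))))))
      (∑-distrib-+ (slice p F) (slice p G))

    swap-factor : ∀ x y z → x * (y * z) ≈ y * (x * z)
    swap-factor x y z = Eq.trans (Eq.sym (*-assoc x y z)) (Eq.trans (*-congʳ (*-comm x y)) (*-assoc y x z))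

    𝔼-* : ∀ {k} (p : Fin k → Fin M → Carrier) c F → 𝔼 p (λ w → c * F w) ≈ c * 𝔼 p F
    𝔼-* {zero}  p c F = Eq.refl
    𝔼-* {suc k} p c F = Eq.trans
      (sum-cong (slice p (λ w → c * F w)) (λ v → c * slice p F v) (λ v → Eq.trans (*-congˡ (𝔼-* (p ∘ suc) c (λ w → F (v ∷ w)))) (swap-factor (p zero v) c (𝔼 (p ∘ suc) (λ w → F (v ∷ w))))))
      (Eq.sym (*-distribˡ-sum c (slice p F)))

    𝔼-sum : ∀ {k} {p : Fin k → Fin M → Carrier} → Distribution p → ∀ {j} (G : Fin j → Vec (Fin M) k → Carrier) →
      𝔼 p (λ w → sum (λ i → G i w)) ≈ sum (λ i → 𝔼 p (G i))
    𝔼-sum d {zero}  G = 𝔼-const d 0#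
    𝔼-sum {p = p} d {suc j} G = Eq.trans (𝔼-+ p (G zero) (λ w → sum (λ i → G (suc i) w))) (+-congˡ (𝔼-sum d (G ∘ suc)))

    -- Conditioning on all coordinates but one.
    𝔼-coordinate : ∀ {k} {p : Fin k → Fin M → Carrier} → Distribution p → Fin M → ∀ i {F β} →
      (∀ w → sum (λ v → p i v * F (w [ i ]≔ v)) ≤ β) → 𝔼 p F ≤ β
    𝔼-coordinate {p = p} d v₀ zero {F} {β} F≤ = begin
      sum (λ v → p zero v * 𝔼 (p ∘ suc) (λ w → F (v ∷ w)))    ≈⟨ sum-cong (λ v → 𝔼 (p ∘ suc) (λ w → p zero v * F (v ∷ w))) (slice p F) (λ v → 𝔼-* (p ∘ suc) (p zero v) (λ w → F (v ∷ w))) ⟨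
      sum (λ v → 𝔼 (p ∘ suc) (λ w → p zero v * F (v ∷ w)))    ≈⟨ 𝔼-sum (tail d) (λ v w → p zero v * F (v ∷ w)) ⟨
      𝔼 (p ∘ suc) (λ w → sum (λ v → p zero v * F (v ∷ w)))    ≤⟨ 𝔼-mono (tail d) (λ w → F≤ (v₀ ∷ w)) ⟩
      𝔼 (p ∘ suc) (λ _ → β)                                   ≈⟨ 𝔼-const (tail d) β ⟩
      β                                                       ∎
    𝔼-coordinate {p = p} d v₀ (suc i) {F} {β} F≤ = begin
      sum (λ v → p zero v * 𝔼 (p ∘ suc) (λ w → F (v ∷ w)))    ≤⟨ sum-mono (slice p F) (λ v → p zero v * β) (λ v → *-monoʳ-≤ (p zero v) (nonNegative d zero v) (𝔼-coordinate (tail d) v₀ i (λ w → F≤ (v ∷ w)))) ⟩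
      sum (λ v → p zero v * β)                                ≈⟨ *-distribʳ-sum β (p zero) ⟨
      sum (p zero) * β                                        ≈⟨ *-congʳ (total-one d zero) ⟩
      1# * β                                                  ≈⟨ *-identityˡ β ⟩
      β                                                       ∎

  -- Sums over lists of outcomes

  sumOver-++ : ∀ {A : Set} (xs ys : List A) f → sumOver (xs ++ ys) f ≈ sumOver xs f + sumOver ys f
  sumOver-++ []       ys f = Eq.sym (+-identityˡ (sumOver ys f))
  sumOver-++ (x ∷ xs) ys f = Eq.trans (+-congˡ (sumOver-++ xs ys f)) (Eq.sym (+-assoc (f x) (sumOver xs f) (sumOver ys f)))

  sumOver-cong : ∀ {A : Set} (xs : List A) {f g} → (∀ x → f x ≈ g x) → sumOver xs f ≈ sumOver xs g
  sumOver-cong []       f≈g = Eq.refl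
  sumOver-cong (x ∷ xs) f≈g = +-cong (f≈g x) (sumOver-cong xs f≈g)

  sumOver-* : ∀ {A : Set} (xs : List A) c f → sumOver xs (λ x → c * f x) ≈ c * sumOver xs f
  sumOver-* []       c f = Eq.sym (zeroʳ c)
  sumOver-* (x ∷ xs) c f = Eq.trans (+-congˡ (sumOver-* xs c f)) (Eq.sym (distribˡ c (f x) (sumOver xs f)))

  sumOver-map : ∀ {A B : Set} (h : A → B) xs f → sumOver (List.map h xs) f ≈ sumOver xs (f ∘ h)
  sumOver-map h []       f = Eq.refl
  sumOver-map h (x ∷ xs) f = +-congˡ (sumOver-map h xs f)

  sumOver-nonNegative : ∀ {A : Set} (xs : List A) {f} → (∀ x → 0# ≤ f x) → 0# ≤ sumOver xs f
  sumOver-nonNegative []       0≤f = ≤-refl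
  sumOver-nonNegative (x ∷ xs) 0≤f = +-nonNegative (0≤f x) (sumOver-nonNegative xs 0≤f)

  sumOver-tabulate : ∀ {A : Set} {n} (h : Fin n → A) f → sumOver (List.tabulate h) f ≈ sum (f ∘ h)
  sumOver-tabulate {n = zero}  h f = Eq.refl
  sumOver-tabulate {n = suc n} h f = +-congˡ (sumOver-tabulate (h ∘ suc) f)

  sumOver-concatMap : ∀ {A B : Set} (h : A → List B) xs f → sumOver (List.concatMap h xs) f ≈ sumOver xs (λ x → sumOver (h x) f)
  sumOver-concatMap h []       f = Eq.refl
  sumOver-concatMap h (x ∷ xs) f = Eq.trans (sumOver-++ (h x) (List.concatMap h xs) f) (+-congˡ (sumOver-concatMap h xs f))

  -- One occurrence of `x` is removed from `ys`; by uniqueness the other elements of `xs` survive.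
  -- This replaces the support by the list of all coefficient vectors, which may be larger.
  sumOver-⊆ : ∀ {A : Set} {xs ys : List A} {f} → (∀ x → 0# ≤ f x) → Unique xs → (∀ {x} → x ∈ xs → x ∈ ys) →
    sumOver xs f ≤ sumOver ys f
  sumOver-⊆ {xs = []} {ys} 0≤f _ _ = sumOver-nonNegative ys 0≤f
  sumOver-⊆ {xs = x ∷ xs} {f = f} 0≤f (x∉ ∷ unique) ⊆ys with as , bs , refl ← ∈.∈-∃++ (⊆ys (here refl)) = begin
    f x + sumOver xs f                          ≤⟨ +-mono-≤ ≤-refl (sumOver-⊆ 0≤f unique remaining) ⟩
    f x + sumOver (as ++ bs) f                  ≈⟨ +-congˡ (sumOver-++ as bs f) ⟩
    f x + (sumOver as f + sumOver bs f)         ≈⟨ +-assoc (f x) (sumOver as f) (sumOver bs f) ⟨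
    f x + sumOver as f + sumOver bs f           ≈⟨ +-congʳ (+-comm (f x) (sumOver as f)) ⟩
    sumOver as f + f x + sumOver bs f           ≈⟨ +-assoc (sumOver as f) (f x) (sumOver bs f) ⟩
    sumOver as f + sumOver (x ∷ bs) f           ≈⟨ sumOver-++ as (x ∷ bs) f ⟨
    sumOver (as ++ x ∷ bs) f                    ∎
    where
    remaining : ∀ {z} → z ∈ xs → z ∈ as ++ bs
    remaining z∈ with ∈.∈-++⁻ as (⊆ys (there z∈))
    ... | inj₁ z∈as         = ∈.∈-++⁺ˡ z∈as
    ... | inj₂ (here refl)  = contradiction refl (ListAll.lookup x∉ z∈)
    ... | inj₂ (there z∈bs) = ∈.∈-++⁺ʳ as z∈bs

  module _ (M : ℕ) where

    vectors : ∀ k → List (Vec (Fin M) k)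
    vectors zero    = [] ∷ []
    vectors (suc k) = List.concatMap (λ v → List.map (v ∷_) (vectors k)) (List.allFin M)

    ∈-vectors : ∀ {k} (w : Vec (Fin M) k) → w ∈ vectors k
    ∈-vectors []      = here refl
    ∈-vectors (v ∷ w) = ∈.∈-concatMap⁺ (λ v → List.map (v ∷_) (vectors _)) (lose (∈.∈-allFin v) (∈.∈-map⁺ (v ∷_) (∈-vectors w)))

    sumOver-vectors : ∀ {k} (p : Fin k → Fin M → Carrier) F →
      sumOver (vectors k) (λ w → product (λ i → p i (lookup w i)) * F w) ≈ 𝔼 p F
    sumOver-vectors {zero}  p F = Eq.trans (+-identityʳ (1# * F [])) (*-identityˡ (F []))
    sumOver-vectors {suc k} p F = Eq.trans (sumOver-concatMap (λ v → List.map (v ∷_) (vectors k)) (List.allFin M) G)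
      (Eq.trans (sumOver-tabulate id (λ v → sumOver (List.map (v ∷_) (vectors k)) G)) (sum-cong (λ v → sumOver (List.map (v ∷_) (vectors k)) G) (slice p F) λ v →
        Eq.trans (sumOver-map (v ∷_) (vectors k) G)
        (Eq.trans (sumOver-cong (vectors k) (λ w → *-assoc (p zero v) (Π w) (F (v ∷ w))))
        (Eq.trans (sumOver-* (vectors k) (p zero v) (λ w → Π w * F (v ∷ w))) (*-congˡ (sumOver-vectors (p ∘ suc) (λ w → F (v ∷ w))))))))
      where
      Π : Vec (Fin M) k → Carrier
      Π w = product (λ i → p (suc i) (lookup w i))
      G : Vec (Fin M) (suc k) → Carrier
      G w = product (λ i → p i (lookup w i)) * F w

-- Smoothed analysis

chunks : ∀ n r → ∃[ cs ] (NonZero n → Blocks n r cs)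
chunks zero    r = [] , λ nz → ⊥-elim (ℕ.≢-nonZero⁻¹ 0 {{nz}} refl)
chunks (suc n) r = proj₁ (blocks (suc n) r) , λ _ → proj₂ (blocks (suc n) r)

module Algorithm (Π : BinaryProblem) {k : ℕ} (P : Prog (suc k)) (time : String → ℕ)
                 (decides : Decides P (λ y → y ∷ Vec.replicate k []) (Language Π) time) where

  open Solver Π P time decides public

  coefficients : ∀ y → ∃[ cs ] CoefficientBlocks y cs
  coefficients y = chunks (length (sizeOf y)) (coefficientsOf y)

  cost : String → ℕ
  cost y = solverCost y (proj₁ (coefficients y)) (proj₂ (coefficients y))

  answered : ∀ (i : String × ℕ × String) → ∃[ τ ] Run solver (loadParam i) τ (cost (proj₁ i))
    × heads (Vec.head τ) ≡ answer (proj₁ i) (proj₁ (coefficients (proj₁ i))) (proj₂ (coefficients (proj₁ i)))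
  answered (y , n , d) = solver-run y (proj₁ (coefficients y)) (proj₂ (coefficients y)) (List.replicate n true) d

  -- `Decides` asks for the exact number of steps; the analysis only needs that it lies between 1
  -- and `cost`.
  solveTime : String × ℕ × String → ℕ
  solveTime i = Run.steps (proj₁ (proj₂ (answered i)))

  solveTime≤cost : ∀ i → solveTime i ℕ.≤ cost (proj₁ i)
  solveTime≤cost i = Run.bounded (proj₁ (proj₂ (answered i)))

  1≤solveTime : ∀ i → 1 ℕ.≤ solveTime i
  1≤solveTime i = steps-positive (Run.halts (proj₁ (proj₂ (answered i))))

  solver-decides : Decides solver loadParam (λ (y , _) → Language Π y) solveTime
  solver-decides = record
    { final   = proj₁ ∘ answered
    ; halts   = λ i → Run.halts (proj₁ (proj₂ (answered i)))
    ; correct = λ i → let y = proj₁ i in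
        answer-correct y (proj₁ (coefficients y)) (proj₂ (coefficients y))
          ⇔-∘ (mk⇔ (trans (sym (proj₂ (proj₂ (answered i))))) (trans (proj₂ (proj₂ (answered i))))
          ⇔-∘ ⇔-sym (heads-head (Vec.head (proj₁ (answered i)))))
    }

module Analysis (ℝ : OrderedFieldWithRoots) (Π : BinaryProblem) {k : ℕ} (P : Prog (suc k)) (time : String → ℕ)
                (decides : Decides P (λ y → y ∷ Vec.replicate k []) (Language Π) time)
                (c C : ℕ)
                (fast : ∀ n → NonZero n → ∀ s w t → BinaryProblem.IsStructure Π n s → ∀ b → All (λ wᵢ → toℕ wᵢ ℕ.< 2 ℕ.^ b) w →
                        time (encode Π n s w t) ℕ.≤ C ℕ.* (n ℕ.* 2 ℕ.^ b) ℕ.^ c) where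

  open OrderedFieldWithRoots ℝ
  open OrderedField ℝ
  open Expectation ℝ
  open ≤-Reasoning
  open BinaryProblem Π using (IsStructure; Coefficients; Threshold)
  open Algorithm Π P time decides
  open Timing Π P time decides c C fast
  open Gap Π P time decides c C fast
  open import Algebra.Properties.Semiring.Exp semiring using (^-assocʳ; ^-congˡ)
  open import Algebra.Properties.CommutativeSemiring.Exp
    (CommutativeRing.commutativeSemiring commutativeRing) using (^-distrib-*)

  A′ a′ q : ℕ
  A′ = suc (proj₁ cost-bound)
  a′ = suc (proj₁ (proj₂ cost-bound))
  q  = 4 ℕ.* a′

  rootTime : String × ℕ × String → Carrier
  rootTime i = root q (fromℕ (solveTime i))

  module _ {n : ℕ} (nz : NonZero n) {s : String} (structure : IsStructure n s) (t : Threshold n) where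

    private
      1≤n : 1 ℕ.≤ n
      1≤n = ℕ.>-nonZero⁻¹ n {{nz}}
      ν : Carrier
      ν = fromℕ n
      0≤ν : 0# ≤ ν
      0≤ν = fromℕ-nonNegative n

    undecidedAt : Coefficients n → ℕ → ℕ
    undecidedAt w m = undecidedSum n s w t m

    -- Makes linearity of expectation applicable: on the right the random `w` enters only through a
    -- weighted sum of indicators, whereas the root of the time is not linear in them.
    rootTime-bound : ∀ w d → fromℕ (n ℕ.* n) * rootTime (encode Π n s w t , n , d)
      ≤ fromℕ (n ℕ.* n ℕ.* n ℕ.+ A′ ℕ.* (1 ℕ.+ undecidedAt w n))
    rootTime-bound w d = bound (total Z ν)
      where
      i = encode Π n s w t , n , d
      Z : Carrier
      Z = rootTime i
      L : ℕ
      L = level n s w t n 0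
      0≤Z : 0# ≤ Z
      0≤Z = root-nonNegative q (fromℕ-nonNegative (solveTime i))
      Z⁴≤ : Z ^ 4 ≤ fromℕ (A′ ℕ.* (n ℕ.* 2 ℕ.^ L))
      Z⁴≤ = ^-cancel-≤ a′ (fromℕ-nonNegative (A′ ℕ.* (n ℕ.* 2 ℕ.^ L))) (begin
        (Z ^ 4) ^ a′                                   ≈⟨ ^-assocʳ Z 4 a′ ⟩
        Z ^ q                                          ≈⟨ root-power q (fromℕ-nonNegative (solveTime i)) ⟩
        fromℕ (solveTime i)                            ≤⟨ fromℕ-mono-≤ (ℕ.≤-trans (solveTime≤cost i)
                                                            (proj₂ (proj₂ cost-bound) {w = w} {t} nz structure (proj₁ (coefficients (proj₁ i))) (proj₂ (coefficients (proj₁ i))))) ⟩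
        fromℕ ((A′ ℕ.* (n ℕ.* 2 ℕ.^ L)) ℕ.^ a′)        ≈⟨ fromℕ-^ (A′ ℕ.* (n ℕ.* 2 ℕ.^ L)) a′ ⟩
        fromℕ (A′ ℕ.* (n ℕ.* 2 ℕ.^ L)) ^ a′            ∎)
      -- Either Z ≤ n, or n³ Z ≤ Z⁴ ≤ A′ n 2ᴸ.
      bound : (Z ≤ ν) ⊎ (ν ≤ Z) → fromℕ (n ℕ.* n) * Z ≤ fromℕ (n ℕ.* n ℕ.* n ℕ.+ A′ ℕ.* (1 ℕ.+ undecidedAt w n))
      bound (inj₁ Z≤ν) = begin
        fromℕ (n ℕ.* n) * Z     ≤⟨ *-monoʳ-≤ (fromℕ (n ℕ.* n)) (fromℕ-nonNegative (n ℕ.* n)) Z≤ν ⟩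
        fromℕ (n ℕ.* n) * ν     ≈⟨ fromℕ-* (n ℕ.* n) n ⟨
        fromℕ (n ℕ.* n ℕ.* n)   ≤⟨ fromℕ-mono-≤ (ℕ.m≤m+n (n ℕ.* n ℕ.* n) _) ⟩
        fromℕ (n ℕ.* n ℕ.* n ℕ.+ A′ ℕ.* (1 ℕ.+ undecidedAt w n)) ∎
      bound (inj₂ ν≤Z) = ≤-trans (*-cancelʳ-≤ ν (fromℕ-positive 1≤n) (begin
        fromℕ (n ℕ.* n) * Z * ν          ≈⟨ *-congʳ (*-congʳ (fromℕ-* n n)) ⟩
        ν * ν * Z * ν                    ≤⟨ *-monoʳ-≤ (ν * ν * Z) (*-nonNegative (*-nonNegative 0≤ν 0≤ν) 0≤Z) ν≤Z ⟩
        ν * ν * Z * Z                    ≤⟨ *-monoˡ-≤ Z 0≤Z (*-monoˡ-≤ Z 0≤Z (≤-trans (*-monoˡ-≤ ν 0≤ν ν≤Z) (*-monoʳ-≤ Z 0≤Z ν≤Z))) ⟩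
        Z * Z * Z * Z                    ≈⟨ *-assoc (Z * Z) Z Z ⟩
        Z * Z * (Z * Z)                  ≈⟨ *-assoc Z Z (Z * Z) ⟩
        Z * (Z * (Z * Z))                ≈⟨ *-congˡ (*-congˡ (*-congˡ (*-identityʳ Z))) ⟨
        Z ^ 4                            ≤⟨ Z⁴≤ ⟩
        fromℕ (A′ ℕ.* (n ℕ.* 2 ℕ.^ L))   ≡⟨ ≡.cong fromℕ (≡.trans (≡.cong (A′ ℕ.*_) (ℕ.*-comm n (2 ℕ.^ L))) (≡.sym (ℕ.*-assoc A′ (2 ℕ.^ L) n))) ⟩
        fromℕ (A′ ℕ.* 2 ℕ.^ L ℕ.* n)     ≈⟨ fromℕ-* (A′ ℕ.* 2 ℕ.^ L) n ⟩
        fromℕ (A′ ℕ.* 2 ℕ.^ L) * ν       ∎))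
        (fromℕ-mono-≤ (ℕ.≤-trans (ℕ.*-monoʳ-≤ A′ (2^level n s w t n 0 refl)) (ℕ.m≤n+m _ (n ℕ.* n ℕ.* n))))

    module _ (ψ : Carrier) (0≤ψ : 0# ≤ ψ) (p : Fin n → Fin (2 ℕ.^ n) → Carrier) (dist : Distribution p)
             (p≤ψ : ∀ i v → p i v ≤ ψ) where

      private
        -- Any value would do. It fills the place of the coordinate that `𝔼-coordinate` overwrites.
        v₀ : Fin (2 ℕ.^ n)
        v₀ = fromℕ< {0} (ℕ.m^n>0 2 n)
        r : Carrier
        r = fromℕ (2 ℕ.^ n) * ψ

      undecided-probability : ∀ {m} → 1 ℕ.≤ m → m ℕ.≤ n →
        𝔼 p (λ w → fromℕ (indicator (undecided n s w t m))) ≤ fromℕ (n ℕ.* (2 ℕ.^ m ℕ.* (2 ℕ.* n))) * ψ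
      undecided-probability {m} 1≤m m≤n = begin
        𝔼 p (λ w → fromℕ (indicator (undecided n s w t m)))
          ≤⟨ 𝔼-mono dist union ⟩
        𝔼 p (λ w → sum (λ i → fromℕ (indicator (pick w i))))
          ≈⟨ 𝔼-sum dist (λ i w → fromℕ (indicator (pick w i))) ⟩
        sum (λ i → 𝔼 p (λ w → fromℕ (indicator (pick w i))))
          ≤⟨ sum-≤-const (λ i → 𝔼 p (λ w → fromℕ (indicator (pick w i)))) (fromℕ K * ψ) single ⟩
        fromℕ n * (fromℕ K * ψ)   ≈⟨ *-assoc (fromℕ n) (fromℕ K) ψ ⟨
        fromℕ n * fromℕ K * ψ     ≈⟨ *-congʳ (fromℕ-* n K) ⟨
        fromℕ (n ℕ.* K) * ψ       ∎
        where
        K : ℕ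
        K = 2 ℕ.^ m ℕ.* (2 ℕ.* n)
        pick : Coefficients n → Fin n → Bool
        pick = picks nz structure t 1≤m m≤n
        union : ∀ w → fromℕ (indicator (undecided n s w t m)) ≤ sum (λ i → fromℕ (indicator (pick w i)))
        union w = go (undecided n s w t m) refl
          where
          go : ∀ u → undecided n s w t m ≡ u → fromℕ (indicator u) ≤ sum (λ i → fromℕ (indicator (pick w i)))
          go false _ = sum-nonNegative (λ i → fromℕ (indicator (pick w i))) (λ i → 0≤indicator (pick w i))
          go true  u = ≤-trans (≤-reflexive fromℕ-1) (indicator-≤-sum (pick w) (picks-some nz structure t 1≤m m≤n w u))
        single : ∀ i → 𝔼 p (λ w → fromℕ (indicator (pick w i))) ≤ fromℕ K * ψ
        single i = 𝔼-coordinate dist v₀ i λ w →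
          let lo , window = picks-window nz structure t 1≤m m≤n w i
          in window-sum 0≤ψ (p i) (p≤ψ i) (λ v → pick (w [ i ]≔ v) i) lo K window

      -- A common bound for all summands of `undecidedSum`: the weight `2ⁿ⁻ᵐ` times the window width
      -- `2ᵐ⁺¹ · 2n` is `4n · 2ⁿ`, free of `m`, and the union over the items contributes another
      -- `n`.
      β : Carrier
      β = fromℕ (4 ℕ.* (n ℕ.* n)) * r

      undecidedSum-expectation : ∀ m → m ℕ.≤ n → 𝔼 p (λ w → fromℕ (undecidedAt w m)) ≤ fromℕ m * β
      undecidedSum-expectation zero    _   = ≤-reflexive (Eq.trans (𝔼-const dist 0#) (Eq.sym (zeroˡ β)))
      undecidedSum-expectation (suc m) m<n = begin
        𝔼 p (λ w → fromℕ (undecidedAt w (suc m)))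
          ≈⟨ 𝔼-cong p (λ w → Eq.trans (fromℕ-+ (I w ℕ.* J) (undecidedAt w m))
               (+-congʳ (Eq.trans (fromℕ-* (I w) J) (*-comm (fromℕ (I w)) (fromℕ J))))) ⟩
        𝔼 p (λ w → fromℕ J * fromℕ (I w) + fromℕ (undecidedAt w m))
          ≈⟨ 𝔼-+ p (λ w → fromℕ J * fromℕ (I w)) (λ w → fromℕ (undecidedAt w m)) ⟩
        𝔼 p (λ w → fromℕ J * fromℕ (I w)) + 𝔼 p (λ w → fromℕ (undecidedAt w m))
          ≤⟨ +-mono-≤ head (undecidedSum-expectation m (ℕ.≤-trans (ℕ.n≤1+n m) m<n)) ⟩
        β + fromℕ m * β          ≈⟨ +-congʳ (*-identityˡ β) ⟨
        1# * β + fromℕ m * β     ≈⟨ distribʳ β 1# (fromℕ m) ⟨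
        fromℕ (suc m) * β        ∎
        where
        I : Coefficients n → ℕ
        I w = indicator (undecided n s w t (suc m))
        J K : ℕ
        J = 2 ℕ.^ (n ℕ.∸ m)
        K = n ℕ.* (2 ℕ.^ suc m ℕ.* (2 ℕ.* n))
        JK : J ℕ.* K ≡ 4 ℕ.* (n ℕ.* n) ℕ.* 2 ℕ.^ n
        JK = ≡.trans (rearrange J (2 ℕ.^ m) n)
          (≡.cong (4 ℕ.* (n ℕ.* n) ℕ.*_) (≡.trans (≡.sym (ℕ.^-distribˡ-+-* 2 (n ℕ.∸ m) m)) (≡.cong (2 ℕ.^_) (ℕ.m∸n+n≡m (ℕ.<⇒≤ m<n)))))
          where
          open import Data.Nat.Solver using (module +-*-Solver)
          open +-*-Solver
          rearrange : ∀ a b n → a ℕ.* (n ℕ.* (2 ℕ.* b ℕ.* (2 ℕ.* n))) ≡ 4 ℕ.* (n ℕ.* n) ℕ.* (a ℕ.* b)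
          rearrange = solve 3 (λ a b n → a :* (n :* (con 2 :* b :* (con 2 :* n))) := con 4 :* (n :* n) :* (a :* b)) refl
        head : 𝔼 p (λ w → fromℕ J * fromℕ (I w)) ≤ β
        head = begin
          𝔼 p (λ w → fromℕ J * fromℕ (I w))       ≈⟨ 𝔼-* p (fromℕ J) (λ w → fromℕ (I w)) ⟩
          fromℕ J * 𝔼 p (λ w → fromℕ (I w))       ≤⟨ *-monoʳ-≤ (fromℕ J) (fromℕ-nonNegative J) (undecided-probability (s≤s z≤n) m<n) ⟩
          fromℕ J * (fromℕ K * ψ)                 ≈⟨ *-assoc (fromℕ J) (fromℕ K) ψ ⟨
          fromℕ J * fromℕ K * ψ                   ≈⟨ *-congʳ (fromℕ-* J K) ⟨
          fromℕ (J ℕ.* K) * ψ                     ≡⟨ ≡.cong (λ x → fromℕ x * ψ) JK ⟩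
          fromℕ (4 ℕ.* (n ℕ.* n) ℕ.* 2 ℕ.^ n) * ψ ≈⟨ *-congʳ (fromℕ-* (4 ℕ.* (n ℕ.* n)) (2 ℕ.^ n)) ⟩
          fromℕ (4 ℕ.* (n ℕ.* n)) * fromℕ (2 ℕ.^ n) * ψ ≈⟨ *-assoc (fromℕ (4 ℕ.* (n ℕ.* n))) (fromℕ (2 ℕ.^ n)) ψ ⟩
          β                                       ∎

      -- With `r ≥ 1` every term is absorbed into `Y`, which is `n³ r`: one `Y` from the case of
      -- small roots, and `A′` times `1 + 4` from the expected number of bits. Cancelling `n²`
      -- leaves `n r`.
      expected-rootTime : ∀ d → 1# ≤ r →
        𝔼 p (λ w → rootTime (encode Π n s w t , n , d)) ≤ fromℕ (1 ℕ.+ A′ ℕ.* 5) * (fromℕ n * r)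
      expected-rootTime d 1≤r = *-cancelʳ-≤ ν² (fromℕ-positive (ℕ.*-mono-≤ 1≤n 1≤n)) (begin
        𝔼 p Z * ν²                                         ≈⟨ *-comm (𝔼 p Z) ν² ⟩
        ν² * 𝔼 p Z                                         ≈⟨ 𝔼-* p ν² Z ⟨
        𝔼 p (λ w → ν² * Z w)                               ≤⟨ 𝔼-mono dist (λ w → rootTime-bound w d) ⟩
        𝔼 p (λ w → fromℕ (N₃ ℕ.+ A′ ℕ.* (1 ℕ.+ undecidedAt w n)))
          ≈⟨ 𝔼-cong p (λ w → Eq.trans (fromℕ-+ N₃ (A′ ℕ.* (1 ℕ.+ undecidedAt w n))) (+-congˡ (fromℕ-* A′ (1 ℕ.+ undecidedAt w n)))) ⟩
        𝔼 p (λ w → fromℕ N₃ + fromℕ A′ * (1# + U w))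
          ≈⟨ 𝔼-+ p (λ _ → fromℕ N₃) (λ w → fromℕ A′ * (1# + U w)) ⟩
        𝔼 p (λ _ → fromℕ N₃) + 𝔼 p (λ w → fromℕ A′ * (1# + U w))
          ≈⟨ +-cong (𝔼-const dist (fromℕ N₃)) (Eq.trans (𝔼-* p (fromℕ A′) (λ w → 1# + U w))
               (*-congˡ (Eq.trans (𝔼-+ p (λ _ → 1#) U) (+-congʳ (𝔼-const dist 1#))))) ⟩
        fromℕ N₃ + fromℕ A′ * (1# + 𝔼 p U)
          ≤⟨ +-mono-≤ N₃≤Y (*-monoʳ-≤ (fromℕ A′) (fromℕ-nonNegative A′) (+-mono-≤ (≤-trans (1≤fromℕ 1≤N₃) N₃≤Y)
               (≤-trans (undecidedSum-expectation n ℕ.≤-refl) (≤-reflexive nβ)))) ⟩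
        Y + fromℕ A′ * (Y + fromℕ 4 * Y)                   ≈⟨ +-cong (*-identityˡ Y) (*-congˡ (Eq.trans (distribʳ Y 1# (fromℕ 4)) (+-congʳ (*-identityˡ Y)))) ⟨
        1# * Y + fromℕ A′ * (fromℕ 5 * Y)                  ≈⟨ +-congˡ (Eq.trans (*-congʳ (fromℕ-* A′ 5)) (*-assoc (fromℕ A′) (fromℕ 5) Y)) ⟨
        1# * Y + fromℕ (A′ ℕ.* 5) * Y                      ≈⟨ distribʳ Y 1# (fromℕ (A′ ℕ.* 5)) ⟨
        fromℕ (1 ℕ.+ A′ ℕ.* 5) * Y                         ≈⟨ *-congˡ Y≈ ⟩
        fromℕ (1 ℕ.+ A′ ℕ.* 5) * (ν * r * ν²)              ≈⟨ *-assoc (fromℕ (1 ℕ.+ A′ ℕ.* 5)) (ν * r) ν² ⟨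
        fromℕ (1 ℕ.+ A′ ℕ.* 5) * (ν * r) * ν²              ∎)
        where
        Z U : Coefficients n → Carrier
        Z w = rootTime (encode Π n s w t , n , d)
        U w = fromℕ (undecidedAt w n)
        N₃ : ℕ
        N₃ = n ℕ.* n ℕ.* n
        ν² Y : Carrier
        ν² = fromℕ (n ℕ.* n)
        Y  = fromℕ N₃ * r
        1≤N₃ : 1 ℕ.≤ N₃
        1≤N₃ = ℕ.*-mono-≤ (ℕ.*-mono-≤ 1≤n 1≤n) 1≤n
        N₃≤Y : fromℕ N₃ ≤ Y
        N₃≤Y = ≤-trans (≤-reflexive (Eq.sym (*-identityʳ (fromℕ N₃)))) (*-monoʳ-≤ (fromℕ N₃) (fromℕ-nonNegative N₃) 1≤r)
        Y≈ : Y ≈ ν * r * ν²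
        Y≈ = Eq.trans (*-congʳ (fromℕ-* (n ℕ.* n) n)) (Eq.trans (*-assoc ν² ν r) (*-comm ν² (ν * r)))
        nβ : fromℕ n * β ≈ fromℕ 4 * Y
        nβ = Eq.trans (Eq.sym (*-assoc ν (fromℕ (4 ℕ.* (n ℕ.* n))) r)) (Eq.trans (*-congʳ (Eq.trans (Eq.sym (fromℕ-* n (4 ℕ.* (n ℕ.* n))))
          (Eq.trans (Eq.reflexive (≡.cong fromℕ (≡.trans (ℕ.*-comm n (4 ℕ.* (n ℕ.* n))) (ℕ.*-assoc 4 (n ℕ.* n) n)))) (fromℕ-* 4 N₃))))
          (*-assoc (fromℕ 4) (fromℕ N₃) r))

  module _ (𝓓 : ParamFamily ℝ (IsInstance Π)) (perturbation : IsPerturbation ℝ Π 𝓓) where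

    open ParamFamily 𝓓
    open IsPerturbation perturbation

    expectation-bound : ∀ n x d → IsInstance Π n x → Admissible n x d →
      expectation n x d (λ y → rootTime (y , n , d)) ≤ fromℕ (1 ℕ.+ A′ ℕ.* 5) * (fromℕ n * fromℕ (N n x) * value n d)
    expectation-bound n x d inst@(nz , s , w₀ , t , structure , refl) adm = begin
      expectation n x d Z
        ≤⟨ sumOver-⊆ (λ y → *-nonNegative (mass-nonNegative inst adm y) (root-nonNegative q (fromℕ-nonNegative (solveTime (y , n , d)))))
             (support-unique inst) covered ⟩
      sumOver (List.map (λ w → encode Π n s w t) (vectors (2 ℕ.^ n) n)) (λ y → mass n x d y * Z y)
        ≈⟨ sumOver-map (λ w → encode Π n s w t) (vectors (2 ℕ.^ n) n) (λ y → mass n x d y * Z y) ⟩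
      sumOver (vectors (2 ℕ.^ n) n) (λ w → mass n x d (encode Π n s w t) * Z (encode Π n s w t))
        ≈⟨ sumOver-cong (vectors (2 ℕ.^ n) n) (λ w → *-congʳ (independent w)) ⟩
      sumOver (vectors (2 ℕ.^ n) n) (λ w → product (λ i → p i (lookup w i)) * Z (encode Π n s w t))
        ≈⟨ sumOver-vectors (2 ℕ.^ n) p (λ w → Z (encode Π n s w t)) ⟩
      𝔼 p (λ w → Z (encode Π n s w t))
        ≤⟨ expected-rootTime nz structure t ψ 0≤ψ p (record { nonNegative = p-nonNegative ; total-one = p-total }) p-upper d 1≤r ⟩
      fromℕ (1 ℕ.+ A′ ℕ.* 5) * (fromℕ n * r)
        ≤⟨ *-monoʳ-≤ (fromℕ (1 ℕ.+ A′ ℕ.* 5)) (fromℕ-nonNegative (1 ℕ.+ A′ ℕ.* 5)) (*-monoʳ-≤ (fromℕ n) (fromℕ-nonNegative n) r≤) ⟩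
      fromℕ (1 ℕ.+ A′ ℕ.* 5) * (fromℕ n * (fromℕ (N n x) * φ))
        ≈⟨ *-congˡ (*-assoc (fromℕ n) (fromℕ (N n x)) φ) ⟨
      fromℕ (1 ℕ.+ A′ ℕ.* 5) * (fromℕ n * fromℕ (N n x) * φ) ∎
      where
      instance
        n≢0 : NonZero n
        n≢0 = nz
      open DrawsCoefficients (draws n s w₀ t structure d adm)
      Z : String → Carrier
      Z y = rootTime (y , n , d)
      φ ψ r : Carrier
      φ = value n d
      ψ = root n φ
      r = fromℕ (2 ℕ.^ n) * ψ
      0≤φ : 0# ≤ φ
      -- `φ` dominates the mass of every string, here that of `x` itself.
      0≤φ = ≤-trans (mass-nonNegative inst adm x) (mass-upper inst adm x)
      0≤ψ : 0# ≤ ψ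
      0≤ψ = root-nonNegative n 0≤φ
      covered : ∀ {y} → y ∈ support n x → y ∈ List.map (λ w → encode Π n s w t) (vectors (2 ℕ.^ n) n)
      -- The support gathers the strings that are possible under any admissible parameter, so `d′`
      -- may differ from `d`; concentration on the encodings with the same `s` and `t` holds for
      -- each of them.
      covered {y} y∈ with Equivalence.to (∈-support inst y) y∈
      ... | d′ , adm′ , 0<mass with DrawsCoefficients.concentrated (draws n s w₀ t structure d′ adm′) y 0<mass
      ...   | w , refl = ∈.∈-map⁺ (λ w → encode Π n s w t) (∈-vectors (2 ℕ.^ n) w)
      rⁿ≈ : r ^ n ≈ fromℕ (N n x) * φ
      rⁿ≈ = Eq.trans (^-distrib-* (fromℕ (2 ℕ.^ n)) ψ n) (*-cong
        (Eq.trans (Eq.sym (fromℕ-^ (2 ℕ.^ n) n)) (Eq.reflexive (≡.cong fromℕ (≡.trans (ℕ.^-*-assoc 2 n n) (≡.sym (N-size inst))))))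
        (root-power n 0≤φ))
      1≤rⁿ : 1# ≤ r ^ n
      -- This is `φ ≥ 1 / N`: the uniform distribution has the least possible maximal probability.
      1≤rⁿ = ≤-trans (value-lower inst adm) (≤-reflexive (Eq.sym rⁿ≈))
      1≤r : 1# ≤ r
      1≤r = ^-cancel-≤ n (*-nonNegative (fromℕ-nonNegative (2 ℕ.^ n)) 0≤ψ) (≤-trans (≤-reflexive (1^ n)) 1≤rⁿ)
      r≤ : r ≤ fromℕ (N n x) * φ
      r≤ = begin
        r                    ≈⟨ *-identityʳ r ⟨
        r ^ 1                ≤⟨ ^-monoʳ-≤ 1≤r (ℕ.>-nonZero⁻¹ n) ⟩
        r ^ n                ≈⟨ rⁿ≈ ⟩
        fromℕ (N n x) * φ    ∎

theorem6p6 : (ℝ : OrderedFieldWithRoots) (Π : BinaryProblem) →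
    PseudoPolynomial Π →
    (𝓓 : ParamFamily ℝ (IsInstance Π)) → IsPerturbation ℝ Π 𝓓 →
    Smoothed-P ℝ (Language Π) 𝓓
theorem6p6 ℝ Π (k , P , time , decides , c , C , fast) 𝓓 perturbation =
  _ , solver , solveTime , solver-decides ,
  reciprocal q , reciprocal-positive q , 1 ℕ.+ A′ ℕ.* 5 , λ n x d inst adm →
    (λ y → rootTime (y , n , d)) , (λ y → root-isPower q (1≤solveTime (y , n , d))) ,
    expectation-bound 𝓓 perturbation n x d inst adm
  where
  open OrderedField ℝ using (reciprocal; reciprocal-positive; root-isPower)
  open Algorithm Π P time decides
  open Analysis ℝ Π P time decides c C fast
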